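{- Let $G$ be a connected, triangle-free graph. Then $\mu(G)=3$ if and only if $G$ is a tree with exactly three leaves or $G$ is a frog graph.
   Context: All graphs are finite, simple, undirected. For a connected graph $G$ and $X\subseteq V(G)$, two vertices $x,y\in X$ are $X$-visible (mutually visible) if there exists a shortest $x,y$-path $P$ in $G$ with $V(P)\cap X=\{x,y\}$. $X$ is a mutual-visibility set if every two of its vertices are $X$-visible. The mutual-visibility number $\mu(G)$ is the maximum size of a mutual-visibility set of $G$. For a cycle $C$ (chordless, $n(C)\ge 3$ vertices), two vertices $u,v$ of $C$ are antipodal if $d_C(u,v)=\lfloor n(C)/2\rfloor$. A frog graph is obtained from a cycle $C$ and two paths $P_r$ and $P_s$ on $r\ge 1$ and $s\ge 1$ vertices as follows: choose two antipodal vertices $v^r,v^s$ of $C$ and identify $v^r$ with an end-vertex of $P_r$ and $v^s$ with an end-vertex of $P_s$ (the paths being otherwise disjoint from $C$ and each other). In particular every cycle is a frog graph (case $r=s=1$). -}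

module Defs where

open import Data.Nat using (ℕ; zero; suc; _+_; _≤_; _/_; _%_)
open import Data.Nat.Properties using ()
open import Data.Bool using (Bool; true; false)
open import Data.Fin using (Fin; toℕ)
open import Data.Fin.Subset using (Subset; _∈_; ∣_∣)
open import Data.Vec using (tabulate)
open import Data.List using (List; []; _∷_)
open import Data.List.Relation.Unary.All using (All)
open import Data.List.Relation.Unary.Unique.Propositional using (Unique)
open import Data.Product using (Σ; _×_)
open import Data.Sum using (_⊎_)
open import Data.Empty using (⊥)
open import Relation.Binary.PropositionalEquality using (_≡_; _≢_)
open import Function.Bundles using (_↔_; _⇔_; Inverse)

record Graph : Set where
  field
    n      : ℕ
    adj    : Fin n → Fin n → Bool
    sym    : ∀ u v → adj u v ≡ adj v u
    irrefl : ∀ v → adj v v ≡ false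

module _ (G : Graph) where
  open Graph G

  Edge : Fin n → Fin n → Set
  Edge u v = adj u v ≡ true

  data Walk : Fin n → Fin n → Set where
    nil  : ∀ x → Walk x x
    cons : ∀ {x y z} → Edge x y → Walk y z → Walk x z

  len : ∀ {x y} → Walk x y → ℕ
  len (nil _)    = 0
  len (cons _ w) = suc (len w)

  verts : ∀ {x y} → Walk x y → List (Fin n)
  verts (nil x)             = x ∷ []
  verts (cons {x = x} _ w)  = x ∷ verts w

  IsPath : ∀ {x y} → Walk x y → Set
  IsPath w = Unique (verts w)

  IsShortestPath : ∀ {x y} → Walk x y → Set
  IsShortestPath {x} {y} w = IsPath w × (∀ (w' : Walk x y) → len w ≤ len w')

  Connected : Set
  Connected = ∀ x y → Walk x y

  TriangleFree : Set
  TriangleFree = ∀ x y z → Edge x y → Edge y z → Edge x z → ⊥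

  -- x,y are X-visible: some shortest x,y-path P with V(P) ∩ X ⊆ {x,y}
  -- (equality then holds since x,y ∈ X and x,y ∈ V(P))
  Visible : Subset n → Fin n → Fin n → Set
  Visible X x y =
    Σ (Walk x y) λ P → IsShortestPath P × All (λ v → v ∈ X → v ≡ x ⊎ v ≡ y) (verts P)

  MutualVisibilitySet : Subset n → Set
  MutualVisibilitySet X = ∀ x y → x ∈ X → y ∈ X → Visible X x y

  MuIs : ℕ → Set
  MuIs k = Σ (Subset n) (λ X → MutualVisibilitySet X × ∣ X ∣ ≡ k)
         × (∀ X → MutualVisibilitySet X → ∣ X ∣ ≤ k)

  -- a cycle: closed walk of length ≥ 3 whose vertices (besides the repeated
  -- start/end vertex) are pairwise distinct
  tailVerts : ∀ {x y} → Walk x y → List (Fin n)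
  tailVerts (nil _)    = []
  tailVerts (cons _ w) = verts w

  Acyclic : Set
  Acyclic = ∀ x (C : Walk x x) → 3 ≤ len C → Unique (tailVerts C) → ⊥

  IsTree : Set
  IsTree = Connected × Acyclic

  degree : Fin n → ℕ
  degree v = ∣ tabulate (adj v) ∣

  isLeafᵇ : Fin n → Bool
  isLeafᵇ v = Data.Nat._≡ᵇ_ (degree v) 1

  numLeaves : ℕ
  numLeaves = ∣ tabulate isLeafᵇ ∣

-- Frog graphs.  Cycle C on (3 + k) vertices c_0 … c_{k+2};
-- path P_r attached at v^r = c_0 with r = 1 + r' (extra vertices a_0 … a_{r'-1},
-- a_0 adjacent to c_0); path P_s attached at the antipodal vertex
-- v^s = c_{⌊(3+k)/2⌋} with s = 1 + s' (extra vertices b_0 … b_{s'-1}).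

FrogV : ℕ → ℕ → ℕ → Set
FrogV k r' s' = Fin (3 + k) ⊎ (Fin r' ⊎ Fin s')

data FrogBase (k r' s' : ℕ) : FrogV k r' s' → FrogV k r' s' → Set where
  cyc  : ∀ (i j : Fin (3 + k)) → (suc (toℕ i)) % (3 + k) ≡ toℕ j →
         FrogBase k r' s' (Data.Sum.inj₁ i) (Data.Sum.inj₁ j)
  attR : ∀ (i : Fin (3 + k)) (a : Fin r') → toℕ i ≡ 0 → toℕ a ≡ 0 →
         FrogBase k r' s' (Data.Sum.inj₁ i) (Data.Sum.inj₂ (Data.Sum.inj₁ a))
  pathR : ∀ (a b : Fin r') → suc (toℕ a) ≡ toℕ b →
         FrogBase k r' s' (Data.Sum.inj₂ (Data.Sum.inj₁ a)) (Data.Sum.inj₂ (Data.Sum.inj₁ b))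
  attS : ∀ (i : Fin (3 + k)) (b : Fin s') → toℕ i ≡ (3 + k) / 2 → toℕ b ≡ 0 →
         FrogBase k r' s' (Data.Sum.inj₁ i) (Data.Sum.inj₂ (Data.Sum.inj₂ b))
  pathS : ∀ (a b : Fin s') → suc (toℕ a) ≡ toℕ b →
         FrogBase k r' s' (Data.Sum.inj₂ (Data.Sum.inj₂ a)) (Data.Sum.inj₂ (Data.Sum.inj₂ b))

FrogAdj : ∀ k r' s' → FrogV k r' s' → FrogV k r' s' → Set
FrogAdj k r' s' x y = FrogBase k r' s' x y ⊎ FrogBase k r' s' y x

IsFrog : Graph → Set
IsFrog G = Σ ℕ λ k → Σ ℕ λ r' → Σ ℕ λ s' →
  Σ (Fin (Graph.n G) ↔ FrogV k r' s') λ φ →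
    ∀ u v → (Edge G u v ⇔ FrogAdj k r' s' (Inverse.to φ u) (Inverse.to φ v))

{-# OPTIONS --safe #-}

-- Write d for the distance.  A "bigon" is a geodesic from v to x through a neighbour a of x,
-- followed by an edge x y with y ≠ a that does not lead away from v.  Without bigons a walk that
-- never turns back is geodesic, so the graph is a tree; then the leaves are mutually visible, and
-- prolonging geodesics behind the points of a mutual-visibility set reaches distinct leaves, so μ
-- is the number of leaves.  Otherwise a least bigon closes up to an isometric cycle C.
--
-- Assume μ ≤ 3.  If v has neighbours v₁, v₂, v₃ and z is a further vertex whose distances to the vᵢ
-- differ by at most 1, then {v₁, v₂, v₃, z} is mutually visible.  This forces a vertex u outside C
-- with a neighbour c on C to be as far from C as c allows, then two such c to be antipodal, and then
-- every vertex outside C to be separated from C by one of them.  Two vertices outside C at equal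
-- distance from such a c would be mutually visible together with the two cycle neighbours of c, so
-- the rest of the graph consists of at most two paths.
--
-- In a frog, four mutually visible vertices are excluded by recording on which leg or on which side
-- of the cycle each of them lies.
module Submission where

open import Defs
open import Data.Nat as ℕ using (ℕ; zero; suc; _+_; _*_; _∸_; _/_; _%_; _⊔_; _≤_; _<_; _≤?_; z≤n; s≤s; NonZero)
open import Data.Nat.Properties hiding (_≟_)
open import Data.Nat.DivMod using (m<n⇒m%n≡m; n%n≡0; m%n<n; m%n%n≡m%n; %-distribˡ-+; [m+n]%n≡m%n; m≡m%n+[m/n]*n)
open import Data.Nat.Tactic.RingSolver using (solve-∀)
import Data.Integer as ℤ
open import Data.Bool as Bool using (Bool; true; false; T; _∧_; if_then_else_)
open import Data.Bool.Properties using (T-∧; T-≡)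
open import Data.Fin as Fin using (Fin; zero; suc; toℕ; fromℕ<; _≟_)
open import Data.Fin.Properties using (any?; toℕ<n; toℕ-fromℕ<; toℕ-injective)
open import Data.Fin.Subset using (Subset; inside; outside; ⁅_⁆; _∪_; ∣_∣) renaming (_∈_ to _∈ₛ_; ⊥ to ∅)
open import Data.Fin.Subset.Properties using (x∈⁅x⁆; x∈⁅y⁆⇒x≡y; x∈p∪q⁺; x∈p∪q⁻; ∉⊥; x∈p∧x≢y⇒x∈p-y; x∈p⇒∣p-x∣<∣p∣)
open import Data.Vec as Vec using (Vec; []; _∷_; here; there; zipWith; tabulate)
open import Data.Vec.Properties using (lookup∘tabulate; []=⇒lookup; lookup⇒[]=)
open import Data.List as List using (List; []; _∷_; _++_; map; length; foldr; filter; concatMap)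
open import Data.List.Properties using (length-map)
open import Data.List.Relation.Unary.All as All using (All; []; _∷_)
import Data.List.Relation.Unary.All.Properties as All
open import Data.List.Relation.Unary.Any using (here; there)
open import Data.List.Relation.Unary.AllPairs using (AllPairs; []; _∷_)
open import Data.List.Relation.Unary.Unique.Propositional using (Unique)
import Data.List.Relation.Unary.Unique.Propositional.Properties as Unique
open import Data.List.Membership.Propositional using (_∈_)
open import Data.List.Membership.Propositional.Properties using (∈-map⁺; ∈-map⁻; ∈-filter⁻)
open import Data.Product using (Σ; ∃; _×_; _,_; proj₁; proj₂)
open import Data.Sum using (_⊎_; inj₁; inj₂; [_,_]′)
open import Data.Unit using (⊤; tt)
open import Data.Empty using (⊥; ⊥-elim)
open import Function using (_∘_; case_of_)
open import Function.Bundles using (_↔_; _⇔_; mk⇔; mk↔ₛ′; Inverse; Equivalence)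
open import Relation.Nullary using (¬_; Dec; yes; no; contradiction; ¬?; _×-dec_)
open import Relation.Nullary.Decidable using (⌊_⌋; map′; decidable-stable)
open import Relation.Binary using (tri<; tri≈; tri>)
open import Relation.Binary.PropositionalEquality

-- A single lemma, `non-backtracking-geodesic`, charges every failure of the distance to rise to a
-- bigon of explicit size 1 + d v x + d v y. Fed with "no bigon" it settles geodesics in trees; fed
-- with "no bigon smaller than g" it gives the distances on the least cycle up to half of its length
-- g, and those from a vertex attached to it. Its reach ends near the antipode, where a failing
-- bigon need no longer be smaller than g and visibility has to take over. Odd and even g are
-- treated together through the two arc lengths h ≤ h' ≤ h + 1.
--
-- Triangle-freeness puts two neighbours of one vertex at distance exactly 2, so they see each other
-- through that vertex, and one of them blocks the other from z only if it is nearer to z by 2; this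
-- is where "at most 1" comes from. It also gives g ≥ 4, hence h ≥ 2.
--
-- In a frog, distances are only estimated from above, by explicit routes. Lower bounds come from
-- positions that cut the graph and from a potential measuring the way round the cycle.

-- Linear arithmetic over the naturals with checked certificates

module Linear where
  open ℤ using (ℤ; +_; -[1+_])

  infix  9 #_
  infixl 8 _:+_
  infix  7 _:≤_ _:<_ _:≡_
  infix  6 ⊢_
  infixr 5 _⟹_

  data Exp (n : ℕ) : Set where
    var  : Fin n → Exp n
    #_   : ℕ → Exp n
    _:+_ : Exp n → Exp n → Exp n

  data Form (n : ℕ) : Set where
    _:≤_ _:≡_ : Exp n → Exp n → Form n
    :⊥        : Form n

  _:<_ : ∀ {n} → Exp n → Exp n → Form n
  a :< b = # 1 :+ a :≤ b

  data Problem (n : ℕ) : Set where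
    ⊢_   : Form n → Problem n
    _⟹_ : Form n → Problem n → Problem n

  ⟦_⟧ : ∀ {n} → Exp n → Vec ℕ n → ℕ
  ⟦ var i ⟧ ρ  = Vec.lookup ρ i
  ⟦ # k ⟧ ρ    = k
  ⟦ a :+ b ⟧ ρ = ⟦ a ⟧ ρ + ⟦ b ⟧ ρ

  ⟦_⟧F : ∀ {n} → Form n → Vec ℕ n → Set
  ⟦ a :≤ b ⟧F ρ = ⟦ a ⟧ ρ ≤ ⟦ b ⟧ ρ
  ⟦ a :≡ b ⟧F ρ = ⟦ a ⟧ ρ ≡ ⟦ b ⟧ ρ
  ⟦ :⊥ ⟧F ρ     = ⊥

  ⟦_⟧P : ∀ {n} → Problem n → Vec ℕ n → Set
  ⟦ ⊢ g ⟧P ρ    = ⟦ g ⟧F ρ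
  ⟦ h ⟹ p ⟧P ρ = ⟦ h ⟧F ρ → ⟦ p ⟧P ρ

  -- Linear forms are coefficient vectors; the constant term is the coefficient of a leading 1.

  dot : ∀ {n} → Vec ℕ n → Vec ℕ n → ℕ
  dot []       []       = 0
  dot (a ∷ as) (x ∷ xs) = a * x + dot as xs

  dot-+ : ∀ {n} (u v ρ : Vec ℕ n) → dot (zipWith _+_ u v) ρ ≡ dot u ρ + dot v ρ
  dot-+ [] [] [] = refl
  dot-+ (a ∷ u) (b ∷ v) (x ∷ ρ) rewrite dot-+ u v ρ = shuffle a b x (dot u ρ) (dot v ρ)
    where
    shuffle : ∀ a b x p q → (a + b) * x + (p + q) ≡ a * x + p + (b * x + q)
    shuffle = solve-∀

  dot-0 : ∀ {n} (ρ : Vec ℕ n) → dot (Vec.replicate n 0) ρ ≡ 0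
  dot-0 []      = refl
  dot-0 (x ∷ ρ) = dot-0 ρ

  unit : ∀ {n} → Fin n → Vec ℕ n
  unit zero    = 1 ∷ Vec.replicate _ 0
  unit (suc i) = 0 ∷ unit i

  dot-unit : ∀ {n} (i : Fin n) (ρ : Vec ℕ n) → dot (unit i) ρ ≡ Vec.lookup ρ i
  dot-unit zero    (x ∷ ρ) rewrite dot-0 ρ = trans (+-identityʳ _) (+-identityʳ x)
  dot-unit (suc i) (x ∷ ρ) = dot-unit i ρ

  dot-scale : ∀ {n} c (u ρ : Vec ℕ n) → dot (Vec.map (c *_) u) ρ ≡ c * dot u ρ
  dot-scale c [] [] = sym (*-zeroʳ c)
  dot-scale c (a ∷ u) (x ∷ ρ) rewrite dot-scale c u ρ = shuffle c a x (dot u ρ)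
    where
    shuffle : ∀ c a x p → c * a * x + c * p ≡ c * (a * x + p)
    shuffle = solve-∀

  normal : ∀ {n} → Exp n → Vec ℕ (suc n)
  normal (var i)  = 0 ∷ unit i
  normal (# k)    = k ∷ Vec.replicate _ 0
  normal (a :+ b) = zipWith _+_ (normal a) (normal b)

  normal-sound : ∀ {n} (e : Exp n) ρ → dot (normal e) (1 ∷ ρ) ≡ ⟦ e ⟧ ρ
  normal-sound (var i)  ρ = dot-unit i ρ
  normal-sound (# k)    ρ rewrite dot-0 ρ = trans (+-identityʳ _) (*-identityʳ k)
  normal-sound (a :+ b) ρ = trans (dot-+ (normal a) (normal b) (1 ∷ ρ))
                                  (cong₂ _+_ (normal-sound a ρ) (normal-sound b ρ))

  Ineq : ℕ → Set
  Ineq n = Exp n × Exp n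

  Holds : ∀ {n} → List (Ineq n) → Vec ℕ n → Set
  Holds []             ρ = ⊤
  Holds ((a , b) ∷ is) ρ = ⟦ a ⟧ ρ ≤ ⟦ b ⟧ ρ × Holds is ρ

  Holds-++ : ∀ {n} (is js : List (Ineq n)) ρ → Holds is ρ → Holds js ρ → Holds (is ++ js) ρ
  Holds-++ []       js ρ _        q = q
  Holds-++ (i ∷ is) js ρ (p , ps) q = p , Holds-++ is js ρ ps q

  weigh : ∀ {n} → (Ineq n → Exp n) → List ℕ → List (Ineq n) → Vec ℕ (suc n)
  weigh side (c ∷ cs) (i ∷ is) = zipWith _+_ (Vec.map (c *_) (normal (side i))) (weigh side cs is)
  weigh side _        _        = Vec.replicate _ 0

  weigh-sound : ∀ {n} cs (is : List (Ineq n)) ρ → Holds is ρ →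
                dot (weigh proj₁ cs is) (1 ∷ ρ) ≤ dot (weigh proj₂ cs is) (1 ∷ ρ)
  weigh-sound []       is       ρ _ = ≤-refl
  weigh-sound (c ∷ cs) []       ρ _ = ≤-refl
  weigh-sound (c ∷ cs) ((a , b) ∷ is) ρ (p , ps)
    rewrite dot-+ (Vec.map (c *_) (normal a)) (weigh proj₁ cs is) (1 ∷ ρ)
          | dot-+ (Vec.map (c *_) (normal b)) (weigh proj₂ cs is) (1 ∷ ρ)
          | dot-scale c (normal a) (1 ∷ ρ) | dot-scale c (normal b) (1 ∷ ρ)
          | normal-sound a ρ | normal-sound b ρ
    = +-mono-≤ (*-monoʳ-≤ c p) (weigh-sound cs is ρ ps)

  -- Comparing coefficients is enough because the variables range over naturals; this is where their
  -- nonnegativity enters the check of a certificate.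
  dominates : ∀ {n} → Vec ℕ n → Vec ℕ n → Bool
  dominates []      []      = true
  dominates (a ∷ u) (b ∷ v) = ⌊ b ≤? a ⌋ ∧ dominates u v

  dominates-sound : ∀ {n} (u v ρ : Vec ℕ n) → T (dominates u v) → dot v ρ ≤ dot u ρ
  dominates-sound [] [] [] _ = z≤n
  dominates-sound (a ∷ u) (b ∷ v) (x ∷ ρ) t with b ≤? a
  ... | yes b≤a = +-mono-≤ (*-monoˡ-≤ x b≤a) (dominates-sound u v ρ t)

  -- The `suc` at the constant term makes the weighted left side exceed the right side by at least 1
  -- under every valuation, against the weighted sum of the hypotheses.
  contradicts : ∀ {n} → Vec ℕ (suc n) → Vec ℕ (suc n) → Bool
  contradicts u (b ∷ v) = dominates u (suc b ∷ v)

  refutes : ∀ {n} → List ℕ → List (Ineq n) → Bool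
  refutes cs is = contradicts (weigh proj₁ cs is) (weigh proj₂ cs is)

  refutes-sound : ∀ {n} cs (is : List (Ineq n)) ρ → T (refutes cs is) → Holds is ρ → ⊥
  refutes-sound cs is ρ t h
    with weigh proj₁ cs is | weigh proj₂ cs is | weigh-sound cs is ρ h
  ... | u | b ∷ v | le = <-irrefl refl (≤-trans (dominates-sound u (suc b ∷ v) (1 ∷ ρ) t) le)

  -- Fourier–Motzkin elimination looks for the multipliers; it needs no proof of its own, since
  -- `refutes` checks its answer.

  Row : Set
  Row = List ℤ × List ℕ

  addRow : ℕ → ℕ → Row → Row → Row
  addRow p q (as , cs) (bs , ds) =
    List.zipWith (λ a b → (+ p) ℤ.* a ℤ.+ (+ q) ℤ.* b) as bs ,
    List.zipWith (λ c d → p * c + q * d) cs ds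

  -- Opposite inequalities are kept together as an equation, to be used as a pivot.
  System : Set
  System = List (Row × Row) × List Row

  reduceBy : ℕ → Row → Row → Row → Row
  reduceBy q pos neg (+ suc a  ∷ as , cs) = addRow q (suc a) (as , cs) neg
  reduceBy q pos neg (-[1+ a ] ∷ as , cs) = addRow q (suc a) (as , cs) pos
  reduceBy q pos neg (as , cs)            = List.drop 1 as , cs

  tailRow : Row → Row
  tailRow (as , cs) = List.drop 1 as , cs

  eliminate : System → System
  eliminate (eqs , rows) = pivot eqs []
    where
    combine : List Row → List (ℕ × Row) → List (ℕ × Row) → List Row → List Row
    combine [] ps ns zs =
      concatMap (λ (p , r) → List.map (λ (q , s) → addRow q p r s) ns) ps ++ zs
    combine ((+ suc a  ∷ as , cs) ∷ rs) ps ns zs = combine rs ((suc a , as , cs) ∷ ps) ns zs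
    combine ((-[1+ a ] ∷ as , cs) ∷ rs) ps ns zs = combine rs ps ((suc a , as , cs) ∷ ns) zs
    combine (r ∷ rs)                    ps ns zs = combine rs ps ns (tailRow r ∷ zs)
    solveFor : ℕ → Row → Row → List (Row × Row) → System
    solveFor q pos neg eqs′ =
      List.map (λ (r , s) → reduceBy q pos neg r , reduceBy q pos neg s) eqs′ ,
      List.map (reduceBy q pos neg) rows
    pivot : List (Row × Row) → List (Row × Row) → System
    pivot [] done = List.map (λ (r , s) → tailRow r , tailRow s) done , combine rows [] [] []
    pivot ((r@(+ suc a ∷ _ , _)  , s) ∷ es) done = solveFor (suc a) (tailRow r) (tailRow s) (es ++ done)
    pivot ((r@(-[1+ a ] ∷ _ , _) , s) ∷ es) done = solveFor (suc a) (tailRow s) (tailRow r) (es ++ done)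
    pivot (e ∷ es) done = pivot es (e ∷ done)

  opposite : List ℤ → List ℤ → Bool
  opposite (a ∷ as) (b ∷ bs) = ⌊ a ℤ.+ b ℤ.≟ + 0 ⌋ ∧ opposite as bs
  opposite _        _        = true

  -- `ineqs` turns an equation into two adjacent opposite inequalities, so comparing neighbouring
  -- rows recovers it.
  pairUp : List Row → System → System
  pairUp []         sys          = sys
  pairUp (r ∷ rows) (eqs , rows′) = go r rows eqs rows′
    where
    go : Row → List Row → List (Row × Row) → List Row → System
    go r []              eqs zs = eqs , r ∷ zs
    go r (s ∷ [])        eqs zs =
      if opposite (proj₁ r) (proj₁ s) then ((r , s) ∷ eqs , zs) else (eqs , r ∷ s ∷ zs)
    go r (s ∷ t ∷ rows) eqs zs =
      if opposite (proj₁ r) (proj₁ s) then go t rows ((r , s) ∷ eqs) zs else go s (t ∷ rows) eqs (r ∷ zs)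

  -- Once all variables are eliminated, a row asserts that its constant is nonnegative; a negative
  -- constant exhibits the multipliers of a refutation.
  findNegative : List Row → List ℕ
  findNegative []                           = []
  findNegative ((-[1+ _ ] ∷ _ , cs) ∷ _)    = cs
  findNegative (_ ∷ rs)                     = findNegative rs

  ineqRows : ∀ {n} → List (Ineq n) → List Row
  ineqRows is = go is (List.map (λ _ → 0) is) []
    where
    diff : ∀ {n} → Vec ℕ (suc n) → Vec ℕ (suc n) → List ℤ
    -- The constant term moves from the head to the end, since elimination consumes the variables
    -- from the head.
    diff (a ∷ u) (b ∷ v) = Vec.toList (zipWith (λ x y → (+ y) ℤ.- (+ x)) u v) ++ ((+ b) ℤ.- (+ a)) ∷ []
    go : ∀ {n} → List (Ineq n) → List ℕ → List ℕ → List Row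
    go (i ∷ is) (_ ∷ cs) done =
      (diff (normal (proj₁ i)) (normal (proj₂ i)) , done ++ 1 ∷ cs) ∷ go is cs (0 ∷ done)
    go _ _ _ = []

  -- These rows guide the elimination but carry zero multipliers: their share of the certificate is
  -- supplied by `dominates`.
  nonNegRows : ℕ → ℕ → List Row
  nonNegRows n k = List.map row (List.allFin n)
    where
    row : Fin n → Row
    row i = Vec.toList (Vec.map +_ (unit i)) ++ (+ 0) ∷ [] , List.replicate k 0

  eliminateAll : ℕ → System → List Row
  eliminateAll zero    (eqs , rows) = concatMap (λ (r , s) → r ∷ s ∷ []) eqs ++ rows
  eliminateAll (suc n) sys          = eliminateAll n (eliminate sys)

  multipliers : ∀ {n} → List (Ineq n) → List ℕ
  multipliers {n} is =
    findNegative (eliminateAll n (pairUp (ineqRows is) ([] , nonNegRows n (List.length is))))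

  unsat : ∀ {n} → List (Ineq n) → Bool
  unsat is = refutes (multipliers is) is

  ineqs : ∀ {n} → Form n → List (Ineq n)
  ineqs (a :≤ b) = (a , b) ∷ []
  ineqs (a :≡ b) = (a , b) ∷ (b , a) ∷ []
  ineqs :⊥       = (# 1 , # 0) ∷ []

  ineqs-sound : ∀ {n} (f : Form n) ρ → ⟦ f ⟧F ρ → Holds (ineqs f) ρ
  ineqs-sound (a :≤ b) ρ p = p , tt
  ineqs-sound (a :≡ b) ρ p = ≤-reflexive p , ≤-reflexive (sym p) , tt

  check : ∀ {n} → List (Ineq n) → Form n → Bool
  check is (a :≤ b) = unsat ((# 1 :+ b , a) ∷ is)
  check is (a :≡ b) = check is (a :≤ b) ∧ check is (b :≤ a)
  check is :⊥       = unsat is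

  check-sound : ∀ {n} (is : List (Ineq n)) g ρ → T (check is g) → Holds is ρ → ⟦ g ⟧F ρ
  check-sound is (a :≤ b) ρ t h =
    ≮⇒≥ λ b<a → let js = (# 1 :+ b , a) ∷ is in refutes-sound (multipliers js) js ρ t (b<a , h)
  check-sound is (a :≡ b) ρ t h =
    let (t₁ , t₂) = Equivalence.to T-∧ t
    in ≤-antisym (check-sound is (a :≤ b) ρ t₁ h) (check-sound is (b :≤ a) ρ t₂ h)
  check-sound is :⊥ ρ t h = refutes-sound (multipliers is) is ρ t h

  entails : ∀ {n} → List (Ineq n) → Problem n → Bool
  entails is (⊢ g)    = check is g
  entails is (h ⟹ p) = entails (ineqs h ++ is) p

  entails-sound : ∀ {n} (is : List (Ineq n)) p ρ → T (entails is p) → Holds is ρ → ⟦ p ⟧P ρ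
  entails-sound is (⊢ g)    ρ t hs   = check-sound is g ρ t hs
  entails-sound is (h ⟹ p) ρ t hs q =
    entails-sound (ineqs h ++ is) p ρ t (Holds-++ (ineqs h) is ρ (ineqs-sound h ρ q) hs)

  Fun : ℕ → Set → Set → Set
  Fun zero    A B = B
  Fun (suc n) A B = A → Fun n A B

  _$$_ : ∀ {n} {A B : Set} → Fun n A B → Vec A n → B
  f $$ []       = f
  f $$ (x ∷ xs) = f x $$ xs


  abstract
    -- `f` writes the curried implication with bound variables for the terms listed in `ρ`. The
    -- implicit argument runs the search during type checking and is filled in when the answer is
    -- `true`.
    lin : ∀ {n} (ρ : Vec ℕ n) (f : Fun n (Exp n) (Problem n)) →
          let p = f $$ Vec.tabulate var in {T (entails [] p)} → ⟦ p ⟧P ρ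
    lin ρ f {t} = entails-sound [] (f $$ Vec.tabulate var) ρ t tt

open Linear using (lin; #_; _:+_; _:≤_; _:<_; _:≡_; :⊥; ⊢_; _⟹_)

-- Least witnesses, and finite subsets as lists without repetition

least-below : ∀ {P : ℕ → Set} → (∀ k → Dec (P k)) → ∀ k →
              (∃ λ m → P m × ∀ j → j < m → ¬ P j) ⊎ (∀ j → j < k → ¬ P j)
least-below P? zero    = inj₂ λ _ ()
least-below P? (suc k) with least-below P? k
... | inj₁ r = inj₁ r
... | inj₂ none with P? k
...   | yes p = inj₁ (k , p , none)
...   | no ¬p = inj₂ λ j j<1+k → case m<1+n⇒m<n∨m≡n j<1+k of λ
        { (inj₁ j<k) → none j j<k ; (inj₂ refl) → ¬p }

least : ∀ {P : ℕ → Set} → (∀ k → Dec (P k)) → ∀ k → P k → ∃ λ m → P m × ∀ j → j < m → ¬ P j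
least P? k p with least-below P? (suc k)
... | inj₁ r    = r
... | inj₂ none = contradiction p (none k ≤-refl)

bounded : ∀ {n} (f : Fin n → ℕ) → ∃ λ b → ∀ i → f i ≤ b
bounded {zero}  f = 0 , λ ()
bounded {suc n} f with bounded (f ∘ suc)
... | b , f≤b = f zero ⊔ b , λ
  { zero → m≤m⊔n _ _ ; (suc i) → ≤-trans (f≤b i) (m≤n⊔m (f zero) b) }

elements : ∀ {n} → Subset n → List (Fin n)
elements []            = []
elements (inside ∷ X)  = zero ∷ map suc (elements X)
elements (outside ∷ X) = map suc (elements X)

length-elements : ∀ {n} (X : Subset n) → length (elements X) ≡ ∣ X ∣
length-elements []            = refl
length-elements (inside ∷ X)  = cong suc (trans (length-map Fin.suc (elements X)) (length-elements X))
length-elements (outside ∷ X) = trans (length-map Fin.suc (elements X)) (length-elements X)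

elements-unique : ∀ {n} (X : Subset n) → Unique (elements X)
elements-unique []            = []
elements-unique (inside ∷ X)  =
  All.map⁺ (All.universal (λ _ ()) _) ∷ Unique.map⁺ (λ { refl → refl }) (elements-unique X)
elements-unique (outside ∷ X) = Unique.map⁺ (λ { refl → refl }) (elements-unique X)

∈-elements⁻ : ∀ {n} (X : Subset n) {x} → x ∈ elements X → x ∈ₛ X
∈-elements⁻ (inside ∷ X) (here refl) = here
∈-elements⁻ (inside ∷ X) (there p) with ∈-map⁻ suc p
... | _ , q , refl = there (∈-elements⁻ X q)
∈-elements⁻ (outside ∷ X) p with ∈-map⁻ suc p
... | _ , q , refl = there (∈-elements⁻ X q)

∈-elements⁺ : ∀ {n} (X : Subset n) {x} → x ∈ₛ X → x ∈ elements X
∈-elements⁺ (inside ∷ X)  here      = here refl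
∈-elements⁺ (inside ∷ X)  (there p) = there (∈-map⁺ suc (∈-elements⁺ X p))
∈-elements⁺ (outside ∷ X) (there p) = ∈-map⁺ suc (∈-elements⁺ X p)

length≤∣∣ : ∀ {n} {xs : List (Fin n)} {X : Subset n} → Unique xs → All (_∈ₛ X) xs → length xs ≤ ∣ X ∣
length≤∣∣ []       []       = z≤n
length≤∣∣ (x∉ ∷ u) (x∈ ∷ p) = ≤-<-trans
  (length≤∣∣ u (All.zipWith (λ (x≢y , y∈) → x∈p∧x≢y⇒x∈p-y y∈ (x≢y ∘ sym)) (x∉ , p)))
  (x∈p⇒∣p-x∣<∣p∣ x∈)

map-unique : ∀ {A B : Set} (f : A → B) {xs : List A} →
             (∀ {x y} → x ∈ xs → y ∈ xs → f x ≡ f y → x ≡ y) → Unique xs → Unique (map f xs)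
map-unique f inj []       = []
map-unique f inj (x∉ ∷ u) =
  All.map⁺ (All.tabulate λ y∈ fx≡fy → All.lookup x∉ y∈ (inj (here refl) (there y∈) fx≡fy))
  ∷ map-unique f (λ x∈ y∈ → inj (there x∈) (there y∈)) u

fromList : ∀ {n} → List (Fin n) → Subset n
fromList = foldr (λ x X → ⁅ x ⁆ ∪ X) ∅

∈-fromList⁺ : ∀ {n} {xs : List (Fin n)} {x} → x ∈ xs → x ∈ₛ fromList xs
∈-fromList⁺ (here refl) = x∈p∪q⁺ (inj₁ (x∈⁅x⁆ _))
∈-fromList⁺ (there p)   = x∈p∪q⁺ (inj₂ (∈-fromList⁺ p))

∈-fromList⁻ : ∀ {n} (xs : List (Fin n)) {x} → x ∈ₛ fromList xs → x ∈ xs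
∈-fromList⁻ []       p = contradiction p ∉⊥
∈-fromList⁻ (y ∷ xs) p with x∈p∪q⁻ ⁅ y ⁆ (fromList xs) p
... | inj₁ q = here (x∈⁅y⁆⇒x≡y y q)
... | inj₂ q = there (∈-fromList⁻ xs q)

∣fromList∣ : ∀ {n} {xs : List (Fin n)} → Unique xs → length xs ≤ ∣ fromList xs ∣
∣fromList∣ u = length≤∣∣ u (All.tabulate ∈-fromList⁺)

-- Walks, distances and criteria for visibility

module Walks (G : Graph) where
  open Graph G public using (n)

  V : Set
  V = Fin n

  edge-sym : ∀ {x y} → Edge G x y → Edge G y x
  edge-sym {x} {y} e = trans (Graph.sym G y x) e

  edge-irrefl : ∀ {x y} → Edge G x y → x ≢ y
  edge-irrefl {x} e refl = case trans (sym e) (Graph.irrefl G x) of λ ()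

  edge? : ∀ x y → Dec (Edge G x y)
  edge? x y = Graph.adj G x y Bool.≟ true

  infixr 5 _++ʷ_
  _++ʷ_ : ∀ {x y z} → Walk G x y → Walk G y z → Walk G x z
  nil _    ++ʷ w = w
  cons e v ++ʷ w = cons e (v ++ʷ w)

  len-++ʷ : ∀ {x y z} (v : Walk G x y) (w : Walk G y z) → len G (v ++ʷ w) ≡ len G v + len G w
  len-++ʷ (nil _)    w = refl
  len-++ʷ (cons e v) w = cong suc (len-++ʷ v w)

  verts-++ʷ : ∀ {P : V → Set} {x y z} (v : Walk G x y) (w : Walk G y z) →
              All P (verts G v) → All P (verts G w) → All P (verts G (v ++ʷ w))
  verts-++ʷ (nil _)    w _        q = q
  verts-++ʷ (cons e v) w (p ∷ ps) q = p ∷ verts-++ʷ v w ps q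

  start-in-verts : ∀ {x y} (w : Walk G x y) → x ∈ verts G w
  start-in-verts (nil _)    = here refl
  start-in-verts (cons _ w) = here refl

  edgeʷ : ∀ {x y} → Edge G x y → Walk G x y
  edgeʷ e = cons e (nil _)

  revʷ : ∀ {x y} → Walk G x y → Walk G y x
  revʷ (nil x)    = nil x
  revʷ (cons e w) = revʷ w ++ʷ edgeʷ (edge-sym e)

  len-revʷ : ∀ {x y} (w : Walk G x y) → len G (revʷ w) ≡ len G w
  len-revʷ (nil _)    = refl
  len-revʷ (cons e w) = trans (len-++ʷ (revʷ w) _) (trans (+-comm _ 1) (cong suc (len-revʷ w)))

  verts-revʷ : ∀ {P : V → Set} {x y} (w : Walk G x y) → All P (verts G w) → All P (verts G (revʷ w))
  verts-revʷ (nil _)    ps       = ps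
  verts-revʷ (cons e w) (p ∷ ps) =
    verts-++ʷ (revʷ w) _ (verts-revʷ w ps) (All.lookup ps (start-in-verts w) ∷ p ∷ [])

  Reach : ℕ → V → V → Set
  Reach k x y = Σ (Walk G x y) λ w → len G w ≡ k

  reach? : ∀ k x y → Dec (Reach k x y)
  reach? zero x y = map′ (λ { refl → nil x , refl }) (λ { (nil _ , _) → refl }) (x ≟ y)
  reach? (suc k) x y = map′
    (λ { (_ , e , w , refl) → cons e w , refl })
    (λ { (cons e w , refl) → _ , e , w , refl })
    (any? λ z → edge? x z ×-dec reach? k z y)

record Distance (G : Graph) : Set where
  field
    d     : Fin (Graph.n G) → Fin (Graph.n G) → ℕ
    geo   : ∀ x y → Σ (Walk G x y) λ w → len G w ≡ d x y
    d-min : ∀ {x y} (w : Walk G x y) → d x y ≤ len G w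

distance : ∀ G → Connected G → Distance G
distance G conn = record
  { d     = λ x y → proj₁ (shortest x y)
  ; geo   = λ x y → proj₁ (proj₂ (shortest x y))
  ; d-min = λ {x} {y} w → ≮⇒≥ λ lt → proj₂ (proj₂ (shortest x y)) _ lt (w , refl)
  }
  where
  open Walks G
  shortest : ∀ x y → ∃ λ m → Reach m x y × ∀ j → j < m → ¬ Reach j x y
  shortest x y = least (λ k → reach? k x y) (len G (conn x y)) (conn x y , refl)

module Metric (G : Graph) (D : Distance G) where
  open Walks G public
  open Distance D public

  d-refl : ∀ x → d x x ≡ 0
  d-refl x = n≤0⇒n≡0 (d-min (nil x))

  d-sym-≤ : ∀ x y → d x y ≤ d y x
  d-sym-≤ x y = let (w , eq) = geo y x in subst (d x y ≤_) (trans (len-revʷ w) eq) (d-min (revʷ w))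

  d-sym : ∀ x y → d x y ≡ d y x
  d-sym x y = ≤-antisym (d-sym-≤ x y) (d-sym-≤ y x)

  d-tri : ∀ x y z → d x z ≤ d x y + d y z
  d-tri x y z =
    let (v , p) = geo x y ; (w , q) = geo y z
    in subst (d x z ≤_) (trans (len-++ʷ v w) (cong₂ _+_ p q)) (d-min (v ++ʷ w))

  d≡0 : ∀ {x y} → d x y ≡ 0 → x ≡ y
  d≡0 {x} {y} eq with geo x y
  ... | nil _ , _ = refl
  ... | cons _ _ , p = case trans p eq of λ ()

  d>0 : ∀ {x y} → x ≢ y → 1 ≤ d x y
  d>0 x≢y = n≢0⇒n>0 (x≢y ∘ d≡0)

  d-edge : ∀ {x y} → Edge G x y → d x y ≡ 1
  d-edge e = ≤-antisym (d-min (edgeʷ e)) (d>0 (edge-irrefl e))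

  d≡1 : ∀ {x y} → d x y ≡ 1 → Edge G x y
  d≡1 {x} {y} eq with geo x y
  ... | cons e (nil _) , _ = e
  ... | nil _ , p = case trans p eq of λ ()
  ... | cons _ (cons _ _) , p = case trans p eq of λ ()

  d-step : ∀ x {y z} → Edge G y z → d x z ≤ suc (d x y)
  d-step x {y} {z} e = ≤-trans (d-tri x y z) (≤-reflexive (trans (cong (d x y +_) (d-edge e)) (+-comm _ 1)))

  d-stepˡ : ∀ {x y} z → Edge G x y → d x z ≤ suc (d y z)
  d-stepˡ {x} {y} z e = subst₂ (λ a b → a ≤ suc b) (d-sym z x) (d-sym z y) (d-step z (edge-sym e))

  stepToward : ∀ x y {k} → d x y ≡ suc k → ∃ λ a → Edge G x a × d a y ≡ k
  stepToward x y {k} eq with geo x y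
  ... | nil _ , p = case trans p eq of λ ()
  ... | cons {y = a} e w , p = a , e , ≤-antisym
    (≤-trans (d-min w) (≤-reflexive (suc-injective (trans p eq))))
    (≤-pred (≤-trans (≤-reflexive (sym eq)) (d-stepˡ y e)))

  predecessor : ∀ x y {k} → d x y ≡ suc k → ∃ λ a → Edge G a y × d x a ≡ k
  predecessor x y eq =
    let (a , e , p) = stepToward y x (trans (d-sym y x) eq)
    in a , edge-sym e , trans (d-sym x a) p

  on-walk : ∀ {x y} (w : Walk G x y) → All (λ v → d x v + d v y ≤ len G w) (verts G w)
  on-walk (nil x) = ≤-reflexive (cong₂ _+_ (d-refl x) (d-refl x)) ∷ []
  on-walk {x} {y} (cons e w) =
    subst (λ t → t + d x y ≤ suc (len G w)) (sym (d-refl x)) (d-min (cons e w)) ∷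
    All.map (λ le → ≤-trans (+-monoˡ-≤ _ (d-stepˡ _ e)) (s≤s le)) (on-walk w)

  -- If the start recurred on the tail of the walk, `d x y` would be at most the length of that
  -- tail, which is one less than the length of the walk.
  shortest-path : ∀ {x y} (w : Walk G x y) → len G w ≤ d x y → IsPath G w
  shortest-path (nil x) _ = [] ∷ []
  shortest-path {x} {y} (cons {y = x'} e w) le =
    All.map (λ {v} on → λ { refl → <-irrefl refl (≤-trans le (≤-trans (m≤n+m _ _) on)) }) (on-walk w)
    ∷ shortest-path w (≤-pred (≤-trans le (d-stepˡ y e)))

  d-bound : ∃ λ b → ∀ x y → d x y ≤ b
  d-bound =
    let (b , p) = bounded (λ x → proj₁ (bounded (d x)))
    in b , λ x y → ≤-trans (proj₂ (bounded (d x)) y) (p x)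

  -- Visibility with the possible blockers listed: `ps` holds the remaining members of the set,
  -- which frees the construction of a sight line from case distinctions about its ends. `sees`
  -- translates back.
  Clear : V → V → List V → Set
  Clear x y ps = Σ (Walk G x y) λ w → len G w ≤ d x y × All (λ v → All (v ≢_) ps) (verts G w)

  clear-sym : ∀ {x y ps} → Clear x y ps → Clear y x ps
  clear-sym {x} {y} (w , le , av) =
    revʷ w , ≤-trans (≤-reflexive (len-revʷ w)) (≤-trans le (d-sym-≤ x y)) , verts-revʷ w av

  -- The strict inequalities put every `p` off all geodesics from `x` to `y`, so an arbitrary one
  -- serves.
  clear-off-geodesics : ∀ x y {ps} → All (λ p → d x y < d x p + d p y) ps → Clear x y ps
  clear-off-geodesics x y off =
    let (w , eq) = geo x y
    in w , ≤-reflexive eq , All.map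
         (λ {v} on → All.map (λ {p} lt → λ { refl → <⇒≱ lt (subst (d x p + d p y ≤_) eq on) }) off)
         (on-walk w)

  Sees : List V → V → V → Set
  Sees xs x y = Σ (Walk G x y) λ w → len G w ≤ d x y × All (λ v → v ∈ xs → v ≡ x ⊎ v ≡ y) (verts G w)

  sees : ∀ xs {x y ps} → (∀ {v} → v ∈ xs → (v ≡ x ⊎ v ≡ y) ⊎ v ∈ ps) → Clear x y ps → Sees xs x y
  sees xs xs⊆ (w , le , av) =
    w , le , All.map (λ off v∈ → [ (λ p → p) , (λ q → contradiction refl (All.lookup off q)) ]′ (xs⊆ v∈)) av

  list-visible : ∀ {xs} → AllPairs (Sees xs) xs → MutualVisibilitySet G (fromList xs)
  list-visible {xs} pairs x y x∈ y∈ =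
    visible (lookup pairs (∈-fromList⁻ xs x∈) (∈-fromList⁻ xs y∈))
    where
    visible : ∀ {x y} → Sees xs x y → Visible G (fromList xs) x y
    visible (w , le , ok) = w , (shortest-path w le , λ w' → ≤-trans le (d-min w')) ,
                            All.map (λ p v∈ → p (∈-fromList⁻ xs v∈)) ok
    sees-sym : ∀ {x y} → Sees xs x y → Sees xs y x
    sees-sym {x} {y} (w , le , ok) =
      revʷ w , ≤-trans (≤-reflexive (len-revʷ w)) (≤-trans le (d-sym-≤ x y)) ,
      verts-revʷ w (All.map (λ p v∈ → [ inj₂ , inj₁ ]′ (p v∈)) ok)
    lookup : ∀ {ys x y} → AllPairs (Sees xs) ys → x ∈ ys → y ∈ ys → Sees xs x y
    lookup (ps ∷ _) (here refl) (here refl) = nil _ , z≤n , (λ _ → inj₁ refl) ∷ []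
    lookup (ps ∷ _) (here refl) (there q)   = All.lookup ps q
    lookup (ps ∷ _) (there p)   (here refl) = sees-sym (All.lookup ps p)
    lookup (_ ∷ qs) (there p)   (there q)   = lookup qs p q

  pattern 1st p = here p
  pattern 2nd p = there (here p)
  pattern 3rd p = there (there (here p))
  pattern 4th p = there (there (there (here p)))

  three-visible : ∀ {a b c} → Clear a b (c ∷ []) → Clear a c (b ∷ []) → Clear b c (a ∷ []) →
                  MutualVisibilitySet G (fromList (a ∷ b ∷ c ∷ []))
  three-visible {a} {b} {c} ab ac bc = list-visible
    ( (sees (a ∷ b ∷ c ∷ [])
        (λ { (1st p) → inj₁ (inj₁ p) ; (2nd p) → inj₁ (inj₂ p) ; (3rd p) → inj₂ (1st p) }) ab
     ∷ sees (a ∷ b ∷ c ∷ [])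
         (λ { (1st p) → inj₁ (inj₁ p) ; (2nd p) → inj₂ (1st p) ; (3rd p) → inj₁ (inj₂ p) }) ac ∷ [])
    ∷ (sees (a ∷ b ∷ c ∷ [])
        (λ { (1st p) → inj₂ (1st p) ; (2nd p) → inj₁ (inj₁ p) ; (3rd p) → inj₁ (inj₂ p) }) bc ∷ [])
    ∷ [] ∷ [] )

  four-visible : ∀ {a b c e} →
    Clear a b (c ∷ e ∷ []) → Clear a c (b ∷ e ∷ []) → Clear a e (b ∷ c ∷ []) →
    Clear b c (a ∷ e ∷ []) → Clear b e (a ∷ c ∷ []) → Clear c e (a ∷ b ∷ []) →
    MutualVisibilitySet G (fromList (a ∷ b ∷ c ∷ e ∷ []))
  four-visible {a} {b} {c} {e} ab ac ae bc be ce = list-visible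
    ( (sees (a ∷ b ∷ c ∷ e ∷ [])
        (λ { (1st p) → inj₁ (inj₁ p) ; (2nd p) → inj₁ (inj₂ p) ; (3rd p) → inj₂ (1st p) ; (4th p) →
        inj₂ (2nd p) }) ab
     ∷ sees (a ∷ b ∷ c ∷ e ∷ [])
         (λ { (1st p) → inj₁ (inj₁ p) ; (2nd p) → inj₂ (1st p) ; (3rd p) → inj₁ (inj₂ p) ; (4th p) →
         inj₂ (2nd p) }) ac
     ∷ sees (a ∷ b ∷ c ∷ e ∷ [])
         (λ { (1st p) → inj₁ (inj₁ p) ; (2nd p) → inj₂ (1st p) ; (3rd p) → inj₂ (2nd p) ; (4th p) →
         inj₁ (inj₂ p) }) ae ∷ [])
    ∷ (sees (a ∷ b ∷ c ∷ e ∷ [])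
        (λ { (1st p) → inj₂ (1st p) ; (2nd p) → inj₁ (inj₁ p) ; (3rd p) → inj₁ (inj₂ p) ; (4th p) →
        inj₂ (2nd p) }) bc
     ∷ sees (a ∷ b ∷ c ∷ e ∷ [])
         (λ { (1st p) → inj₂ (1st p) ; (2nd p) → inj₁ (inj₁ p) ; (3rd p) → inj₂ (2nd p) ; (4th p) →
         inj₁ (inj₂ p) }) be ∷ [])
    ∷ (sees (a ∷ b ∷ c ∷ e ∷ [])
        (λ { (1st p) → inj₂ (1st p) ; (2nd p) → inj₂ (2nd p) ; (3rd p) → inj₁ (inj₁ p) ; (4th p) →
        inj₁ (inj₂ p) }) ce ∷ [])
    ∷ [] ∷ [] )

-- Bigons, non-backtracking walks and isometric cycles

mod-suc : ∀ i g .{{_ : NonZero g}} → suc i % g ≡ suc (i % g) % g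
mod-suc i g = trans (%-distribˡ-+ 1 i g) (trans (cong (λ r → (1 % g + r) % g) (sym (m%n%n≡m%n i g)))
                (sym (%-distribˡ-+ 1 (i % g) g)))

mod-step : ∀ i g .{{_ : NonZero g}} →
           (suc (i % g) < g × suc i % g ≡ suc (i % g)) ⊎ (suc (i % g) ≡ g × suc i % g ≡ 0)
mod-step i g with m≤n⇒m<n∨m≡n (m%n<n i g)
... | inj₁ lt = inj₁ (lt , trans (mod-suc i g) (m<n⇒m%n≡m lt))
... | inj₂ eq = inj₂ (eq , trans (mod-suc i g) (trans (cong (_% g) eq) (n%n≡0 g)))

module Bigons (G : Graph) (D : Distance G) where
  open Metric G D

  -- Together with a geodesic from y back to v, the walk v … a x y closes up to length g.
  IsBigon : ℕ → V → V → V → V → Set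
  IsBigon g v a x y = Edge G a x × Edge G x y × a ≢ y × d v x ≡ suc (d v a) × d v y ≤ d v x ×
                      suc (d v x + d v y) ≡ g

  Bigon : ℕ → Set
  Bigon g = ∃ λ v → ∃ λ a → ∃ λ x → ∃ λ y → IsBigon g v a x y

  NoBigon : Set
  NoBigon = ∀ g → ¬ Bigon g

  bigon? : ∀ g → Dec (Bigon g)
  bigon? g = any? λ v → any? λ a → any? λ x → any? λ y →
    edge? a x ×-dec edge? x y ×-dec ¬? (a ≟ y) ×-dec (d v x ℕ.≟ suc (d v a)) ×-dec
    (d v y ≤? d v x) ×-dec (suc (d v x + d v y) ℕ.≟ g)

  no-bigon-or-least : NoBigon ⊎ ∃ λ g → Bigon g × ∀ j → j < g → ¬ Bigon j
  no-bigon-or-least with d-bound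
  -- If all distances are at most `b`, a bigon has size at most 1 + 2b, so the sizes below 2 + 2b
  -- are all there are.
  ... | b , d≤b with least-below bigon? (2 + (b + b))
  ...   | inj₁ found = inj₂ found
  ...   | inj₂ none  = inj₁ λ { g big@(v , a , x , y , _ , _ , _ , _ , _ , refl) →
            none g (s≤s (s≤s (+-mono-≤ (d≤b v x) (d≤b v y)))) big }

  -- Only the one bigon that a failure to rise would create is forbidden, at its exact size. The
  -- same statement thus serves in graphs without bigons and below the least bigon.
  straight-on : ∀ {v a x y k} → Edge G a x → Edge G x y → a ≢ y → d v a ≡ k → d v x ≡ suc k →
                (d v y ≤ suc k → ¬ Bigon (suc (suc k + d v y))) → d v y ≡ 2 + k
  straight-on {v} {a} {x} {y} ax xy a≢y da dx none = ≤-antisym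
    (≤-trans (d-step v xy) (s≤s (≤-reflexive dx)))
    (≰⇒> λ le → none le (v , a , x , y , ax , xy , a≢y , trans dx (cong suc (sym da)) ,
                         ≤-trans le (≤-reflexive (sym dx)) , cong (λ t → suc (t + d v y)) dx))

  -- The induction goes back two steps, because `straight-on` judges an edge by the distances of the
  -- two vertices before its new end.
  non-backtracking-geodesic : (s : ℕ → V) → ∀ ℓ →
    (∀ i → i < ℓ → Edge G (s i) (s (suc i))) →
    (∀ i → suc i < ℓ → s i ≢ s (2 + i)) →
    (∀ i → i < ℓ → d (s 0) (s (suc i)) ≤ i → ¬ Bigon (suc (i + d (s 0) (s (suc i))))) →
    d (s 0) (s ℓ) ≡ ℓ
  non-backtracking-geodesic s zero          edge turn none = d-refl (s 0)
  non-backtracking-geodesic s (suc zero)    edge turn none = d-edge (edge 0 ≤-refl)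
  non-backtracking-geodesic s (suc (suc k)) edge turn none =
    straight-on (edge k (n≤1+n _)) (edge (suc k) ≤-refl) (turn k ≤-refl)
      (non-backtracking-geodesic s k (λ i p → edge i (up (up p))) (λ i p → turn i (up (up p)))
          (λ i p → none i (up (up p))))
      (non-backtracking-geodesic s (suc k) (λ i p → edge i (up p)) (λ i p → turn i (up p))
          (λ i p → none i (up p)))
      (none (suc k) ≤-refl)
    where
    up : ∀ {i j} → i < j → i < suc j
    up = m<n⇒m<1+n

  -- Otherwise the walk would be a geodesic of positive length between equal ends. The forbidden
  -- sizes stop at `ℓ` because the rest of the walk bounds the distance back to the start. `turn`
  -- speaks of inner positions only: at the base point the walk may turn back.
  closed-non-backtracking : (s : ℕ → V) → ∀ ℓ → 1 ≤ ℓ →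
    (∀ i → i < ℓ → Edge G (s i) (s (suc i))) → (∀ i → suc i < ℓ → s i ≢ s (2 + i)) → s ℓ ≡ s 0 →
    ¬ (∀ j → j ≤ ℓ → ¬ Bigon j)
  closed-non-backtracking s ℓ 1≤ℓ edge turn closed none =
    <⇒≢ 1≤ℓ (trans (sym (d-refl (s 0))) (trans (cong (d (s 0)) (sym closed))
      (non-backtracking-geodesic s ℓ edge turn λ i i<ℓ _ → none _ (short i i<ℓ))))
    where
    remaining : ∀ k i → k + i ≡ ℓ → d (s i) (s ℓ) ≤ k
    remaining zero    i refl = ≤-reflexive (d-refl (s i))
    remaining (suc k) i eq   =
      ≤-trans (d-stepˡ (s ℓ) (edge i (subst (i <_) eq (s≤s (m≤n+m i k)))))
              (s≤s (remaining k (suc i) (trans (+-suc k i) eq)))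
    short : ∀ i → i < ℓ → suc (i + d (s 0) (s (suc i))) ≤ ℓ
    short i i<ℓ = subst (suc (i + d (s 0) (s (suc i))) ≤_) (m+[n∸m]≡n i<ℓ)
      (s≤s (+-monoʳ-≤ i (subst (_≤ ℓ ∸ suc i) (trans (cong (d (s (suc i))) closed) (d-sym _ _))
        (remaining (ℓ ∸ suc i) (suc i) (m∸n+n≡m i<ℓ)))))

  at : ∀ {x y} → Walk G x y → ℕ → V
  at (nil x)            _       = x
  at (cons {x = x} _ _) zero    = x
  at (cons _ w)         (suc i) = at w i

  at-start : ∀ {x y} (w : Walk G x y) → at w 0 ≡ x
  at-start (nil _)    = refl
  at-start (cons _ _) = refl

  at-end : ∀ {x y} (w : Walk G x y) → at w (len G w) ≡ y
  at-end (nil _)    = refl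
  at-end (cons _ w) = at-end w

  at-edge : ∀ {x y} (w : Walk G x y) i → i < len G w → Edge G (at w i) (at w (suc i))
  at-edge (cons {x = x} e w) zero    _       = subst (Edge G x) (sym (at-start w)) e
  at-edge (cons _ w)         (suc i) (s≤s p) = at-edge w i p

  at-∈ : ∀ {x y} (w : Walk G x y) i → at w i ∈ verts G w
  at-∈ (nil x)    i       = here refl
  at-∈ (cons _ w) zero    = here refl
  at-∈ (cons _ w) (suc i) = there (at-∈ w i)

  NonBacktracking : ∀ {x y} → Walk G x y → Set
  NonBacktracking w = ∀ i → 2 + i ≤ len G w → at w i ≢ at w (2 + i)

  nb-cons : ∀ {x y z} (e : Edge G x y) (w : Walk G y z) → (1 ≤ len G w → x ≢ at w 1) →
            NonBacktracking w → NonBacktracking (cons e w)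
  nb-cons e w x≢ nb zero    (s≤s p) = x≢ p
  nb-cons e w x≢ nb (suc i) (s≤s p) = nb i p

  geodesic-nb : ∀ {x y} (w : Walk G x y) → len G w ≤ d x y → NonBacktracking w
  geodesic-nb (nil _) _ = λ _ ()
  geodesic-nb {x} {y} (cons e w) le =
      nb-cons e w (x≢ w le) (geodesic-nb w (≤-pred (≤-trans le (d-stepˡ y e))))
    where
    x≢ : ∀ {z} (w : Walk G z y) → suc (len G w) ≤ d x y → 1 ≤ len G w → x ≢ at w 1
    x≢ (cons e' w') le _ refl rewrite at-start w' =
      <⇒≱ (m<n⇒m<1+n ≤-refl) (≤-trans le (d-min w'))

  rises-twice : ∀ {m n k : ℕ} → suc m ≡ n → n ≡ k → m ≡ suc k → ⊥
  rises-twice refl refl ()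

  -- Each prepended vertex is nearer to `v`, while the vertex left two steps later is farther, so
  -- turning back is possible only where the new part meets `w`; `ok` excludes it there.
  extend-back : ∀ {v} k {x} (w : Walk G x v) → d v x ≡ k → NonBacktracking w →
    (∀ p → suc (d v p) ≡ d v x → p ≢ at w 1) → ∃ λ (W : Walk G v v) →
        NonBacktracking W × len G W ≡ k + len G w
  extend-back zero w eq nb _ with d≡0 eq
  ... | refl = w , nb , refl
  extend-back {v} (suc k) {x} w eq nb ok with predecessor v x eq
  ... | p , e , dp with extend-back k (cons e w) dp
      (nb-cons e w (λ _ → ok p (trans (cong suc dp) (sym eq))) nb)
                          (λ q dq q≡x → rises-twice
                              (subst (λ t → suc (d v t) ≡ d v p) (trans q≡x (at-start w)) dq) dp eq)
  ...   | W , nbW , lenW = W , nbW , trans lenW (+-suc k _)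

  -- The second vertex of a geodesic from `y` to `v` is nearer to `v` than `y` is, whereas `x` is
  -- not.
  off-geodesic : ∀ {x y v} (w : Walk G y v) → len G w ≡ d y v → d v y ≤ d v x → 1 ≤ len G w → x ≢ at w 1
  off-geodesic {v = v} (cons {x = y} {y = z} _ w) lw dy _ refl rewrite at-start w =
    <⇒≱ (≤-trans (s≤s (≤-trans (d-sym-≤ v z) (d-min w))) (≤-trans (≤-reflexive lw) (d-sym-≤ y v))) dy

  bigon-walk : ∀ {g v a x y} → IsBigon g v a x y → ∃ λ (W : Walk G v v) → NonBacktracking W × len G W ≡ g
  bigon-walk {g} {v} {a} {x} {y} (ax , xy , a≢y , dx , dy , size) with geo y v
  ... | w , lw with extend-back (d v a) (cons ax (cons xy w)) refl
                      (nb-cons ax (cons xy w) (λ _ a≡ → a≢y (trans a≡ (at-start w)))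
                        (nb-cons xy w (off-geodesic w lw dy) (geodesic-nb w (≤-reflexive lw))))
                      (λ { p dp refl → m≢1+n+m (d v a) {1} (trans (sym dp) (cong suc dx)) })
  ...   | W , nb , lW = W , nb , trans lW (lin (d v a ∷ d v x ∷ d v y ∷ len G w ∷ g ∷ [])
            (λ a x y w g → x :≡ # 1 :+ a ⟹ w :≡ y ⟹ # 1 :+ (x :+ y) :≡ g ⟹ ⊢ a :+ (# 2 :+ w) :≡ g)
            dx (trans lw (d-sym y v)) size)

  -- A periodic sequence on all naturals keeps reductions modulo `g` out of the distance arguments.
  -- Distinctness of the vertices is derived later, in `distinct`, from the absence of smaller
  -- bigons.
  record Cycle (g : ℕ) : Set where
    field
      c      : ℕ → V
      g>0    : 1 ≤ g
      period : ∀ i → c (g + i) ≡ c i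
      step   : ∀ i → Edge G (c i) (c (suc i))
      turn   : ∀ i → c i ≢ c (2 + i)

    g≥3 : 3 ≤ g
    g≥3 = go g>0 (period 0)
      where
      go : ∀ {g} → 1 ≤ g → c (g + 0) ≡ c 0 → 3 ≤ g
      go {suc zero}          _ eq = contradiction (sym eq) (edge-irrefl (step 0))
      go {suc (suc zero)}    _ eq = contradiction (sym eq) (turn 0)
      go {suc (suc (suc _))} _ eq = s≤s (s≤s (s≤s z≤n))

  rotate : ∀ {g} → Cycle g → ℕ → Cycle g
  rotate {g} C k = record
    { c = λ i → c (i + k) ; g>0 = g>0 ; step = λ i → step (i + k) ; turn = λ i → turn (i + k)
    ; period = λ i → trans (cong c (+-assoc g i k)) (period (i + k)) }
    where open Cycle C

  -- The only place left where the closed walk could turn back is its base point, and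
  -- there turning back would leave a shorter closed walk.
  least-bigon-cycle : ∀ {g} → Bigon g → (∀ j → j < g → ¬ Bigon j) → Cycle g
  least-bigon-cycle {g} (v , a , x , y , big@(ax , xy , a≢y , dx , dy , refl)) none with bigon-walk big
  ... | W , nb , lW = record
    { c      = λ i → at W (i % g)
    ; g>0    = s≤s z≤n
    ; period = λ i → cong (at W) (trans (cong (_% g) (+-comm g i)) ([m+n]%n≡m%n i g))
    ; step   = step
    ; turn   = turn
    }
    where
    end : at W g ≡ at W 0
    end = trans (cong (at W) (sym lW)) (trans (at-end W) (sym (at-start W)))
    edge : ∀ i → i < g → Edge G (at W i) (at W (suc i))
    edge i i<g = at-edge W i (≤-trans i<g (≤-reflexive (sym lW)))
    nb' : ∀ i → 2 + i ≤ g → at W i ≢ at W (2 + i)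
    nb' i le = nb i (≤-trans le (≤-reflexive (sym lW)))
    g≥3 : 3 ≤ g
    -- If `y` is `v` itself, then `a` is not, and `x` has distance at least 2 from `v`.
    g≥3 with d v y in eq
    ... | suc _ = s≤s (subst (λ t → 2 ≤ t + _) (sym dx) (s≤s (≤-trans (s≤s z≤n) (m≤n+m _ (d v a)))))
    ... | zero with d v a in eq'
    ...   | zero  = contradiction (trans (sym (d≡0 eq')) (d≡0 eq)) a≢y
    ...   | suc _ = s≤s (≤-trans (subst (2 ≤_) (sym dx) (s≤s (s≤s z≤n))) (m≤m+n _ 0))
    wrap : ∀ r → suc r ≡ g → at W r ≢ at W 1
    wrap r refl eq = closed-non-backtracking (λ i → at W (suc i)) (r ∸ 1)
      (∸-monoˡ-≤ 1 (≤-pred g≥3))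
      (λ i lt → edge (suc i) (s≤s (≤-trans lt (m∸n≤m r 1))))
      (λ i lt → nb' (suc i) (s≤s (≤-trans lt (m∸n≤m r 1))))
      (trans (cong (at W) (m+[n∸m]≡n (≤-trans (s≤s z≤n) (≤-pred g≥3)))) eq)
      (λ j le → none j (s≤s (≤-trans le (m∸n≤m r 1))))
    step : ∀ i → Edge G (at W (i % g)) (at W (suc i % g))
    step i with mod-step i g
    ... | inj₁ (lt , eq) rewrite eq = edge (i % g) (<⇒≤ lt)
    ... | inj₂ (last , eq) rewrite eq = subst (Edge G _) (trans (cong (at W) last) end)
        (edge (i % g) (≤-reflexive last))
    turn : ∀ i → at W (i % g) ≢ at W ((2 + i) % g)
    turn i with mod-step i g | mod-step (suc i) g
    ... | inj₁ (lt , eq) | inj₁ (lt' , eq') = subst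
        (λ t → at W (i % g) ≢ at W t) (sym (trans eq' (cong suc eq))) (nb' (i % g) lt)
    ... | inj₁ (lt , eq) | inj₂ (last , eq') =
      subst (λ t → at W (i % g) ≢ t)
          (trans (cong (at W) (trans (cong suc (sym eq)) last)) (trans end (cong (at W) (sym eq'))))
          (nb' (i % g) lt)
    ... | inj₂ (last , eq) | inj₁ (_ , eq') = subst
        (λ t → at W (i % g) ≢ at W t) (sym (trans eq' (cong suc eq))) (wrap (i % g) last)
    ... | inj₂ (_ , eq) | inj₂ (last , _) = contradiction (trans (sym last) (cong suc eq))
        (λ g≡1 → <⇒≢ (<-trans (s≤s (s≤s z≤n)) g≥3) (sym g≡1))

  module Isometric {g} (C : Cycle g) (none : ∀ j → j < g → ¬ Bigon j) where
    open Cycle C public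

    -- A failing step would produce a bigon of size at most 2ℓ - 1, which is less than `g`.
    d-forward : ∀ ℓ i → ℓ + ℓ ≤ g → d (c i) (c (ℓ + i)) ≡ ℓ
    d-forward ℓ i 2ℓ≤g = non-backtracking-geodesic (λ k → c (k + i)) ℓ (λ k _ → step (k + i))
        (λ k _ → turn (k + i))
      λ k k<ℓ le → none _ (≤-trans (lin (k ∷ d (c i) (c (suc k + i)) ∷ ℓ ∷ [])
        (λ k x ℓ → k :< ℓ ⟹ x :≤ k ⟹ ⊢ # 2 :+ (k :+ x) :≤ ℓ :+ ℓ) k<ℓ le) 2ℓ≤g)

    d-backward : ∀ j ℓ i → j + ℓ ≡ g → ℓ + ℓ ≤ g → d (c i) (c (j + i)) ≡ ℓ
    d-backward j ℓ i j+ℓ≡g 2ℓ≤g =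
        trans (d-sym _ _) (trans (cong (d (c (j + i))) (sym back)) (d-forward ℓ (j + i) 2ℓ≤g))
      where
      back : c (ℓ + (j + i)) ≡ c i
      back = trans (cong c (trans (sym (+-assoc ℓ j i)) (cong (_+ i) (trans (+-comm ℓ j) j+ℓ≡g))))
          (period i)

    distinct : ∀ j i → 1 ≤ j → j < g → c i ≢ c (j + i)
    distinct j i 1≤j j<g eq with ≤-total (j + j) g
    ... | inj₁ le = <⇒≢ 1≤j (trans (sym (d-refl (c i))) (trans (cong (d (c i)) eq) (d-forward j i le)))
    ... | inj₂ ge = <⇒≢ (m<n⇒0<n∸m j<g) (trans (sym (d-refl (c i))) (trans (cong (d (c i)) eq)
          (d-backward j (g ∸ j) i (m+[n∸m]≡n (<⇒≤ j<g)) (lin (g ∷ j ∷ g ∸ j ∷ [])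
            (λ g j r → g :≤ j :+ j ⟹ j :+ r :≡ g ⟹ ⊢ r :+ r :≤ g) ge (m+[n∸m]≡n (<⇒≤ j<g))))))

    c-distinct : ∀ {i j} → i < j → j < g → c i ≢ c j
    c-distinct {i} {j} i<j j<g = subst (λ t → c i ≢ c t) (m∸n+n≡m (<⇒≤ i<j))
      (distinct (j ∸ i) i (m<n⇒0<n∸m i<j) (≤-<-trans (m∸n≤m j i) j<g))

    arc : ∀ k {i j} → k + i ≡ j → Walk G (c i) (c j)
    arc zero    refl = nil _
    arc (suc k) eq   = cons (step _) (arc k (trans (+-suc k _) eq))

    len-arc : ∀ k {i j} (eq : k + i ≡ j) → len G (arc k eq) ≡ k
    len-arc zero    refl = refl
    len-arc (suc k) eq   = cong suc (len-arc k _)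

    verts-arc : ∀ k {i j} (eq : k + i ≡ j) → All (λ v → ∃ λ t → t ≤ k × v ≡ c (t + i)) (verts G (arc k eq))
    verts-arc zero    refl = (0 , z≤n , refl) ∷ []
    verts-arc (suc k) {i} eq = (0 , z≤n , refl) ∷
      All.map (λ { (t , t≤k , v≡) → suc t , s≤s t≤k , trans v≡ (cong c (+-suc t i)) }) (verts-arc k _)

    arc-unique : ∀ k {i j} (eq : k + i ≡ j) → k < g → Unique (verts G (arc k eq))
    arc-unique zero    refl _ = [] ∷ []
    arc-unique (suc k) {i} eq k<g =
      All.map (λ { (t , t≤k , v≡) c≡v → distinct (suc t) i (s≤s z≤n) (≤-<-trans (s≤s t≤k) k<g)
                 (trans c≡v (trans v≡ (cong c (+-suc t i)))) }) (verts-arc k _)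
      ∷ arc-unique k _ (<-trans ≤-refl k<g)

  acyclic⇒no-bigon : Acyclic G → NoBigon
  acyclic⇒no-bigon acyclic with no-bigon-or-least
  ... | inj₁ free = free
  ... | inj₂ (g , big , none) = ⊥-elim (go g g≥3 (period 0) (λ k → arc-unique k _))
    where
    open Isometric (least-bigon-cycle big none) none
    closed : ∀ {x y} → y ≡ x → (W : Walk G x y) → 3 ≤ len G W → Unique (tailVerts G W) → ⊥
    closed refl W = acyclic _ W
    go : ∀ h → 3 ≤ h → c (h + 0) ≡ c 0 →
        (∀ k {i j} {eq : k + i ≡ j} → k < h → Unique (verts G (arc k eq))) → ⊥
    -- Without its initial vertex the closed walk is an arc with g - 1 edges, short enough for its
    -- vertices to be distinct.
    go (suc k) 3≤h eq uniq = closed (trans (cong c (trans (+-suc k 0) refl)) eq)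
        (cons (step 0) (arc k refl))
      (subst (3 ≤_) (cong suc (sym (len-arc k {1} refl))) 3≤h) (uniq k ≤-refl)

  unique-at : ∀ {x y} (w : Walk G x y) → Unique (verts G w) → ∀ {i j} → i < j → j ≤ len G w →
      at w i ≢ at w j
  unique-at (cons _ w) (x∉ ∷ u) {zero}  {suc j} _       _       eq = All.lookup x∉ (at-∈ w j) eq
  unique-at (cons _ w) (x∉ ∷ u) {suc i} {suc j} (s≤s p) (s≤s q) eq = unique-at w u p q eq

  no-bigon⇒acyclic : NoBigon → Acyclic G
  no-bigon⇒acyclic free x W@(cons _ w) 3≤len uniq = closed-non-backtracking (at W) (len G W) (s≤s z≤n)
    (at-edge W) turn (at-end W) (λ j _ → free j)
    where
    turn : ∀ i → suc i < len G W → at W i ≢ at W (2 + i)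
    -- The base point is also the last vertex of `w`, so a turn here would repeat a vertex inside
    -- `w`.
    turn zero    _       eq = unique-at w uniq (≤-pred 3≤len) ≤-refl (trans (sym eq) (sym (at-end W)))
    turn (suc i) (s≤s p)    = unique-at w uniq (m<n⇒m<1+n ≤-refl) p

-- The lengths of the two arcs between antipodal vertices of a `g`-cycle; `h≡g/2` matches `h` with
-- the place of the second leg in `FrogBase`.
record Halves (g : ℕ) : Set where
  field
    h h'   : ℕ
    h+h'   : h + h' ≡ g
    h≤h'   : h ≤ h'
    h'≤1+h : h' ≤ suc h
    h≡g/2  : h ≡ g / 2

halve : ∀ g → Halves g
halve g = record { h = g / 2 ; h' = g % 2 + g / 2 ; h≤h' = m≤n+m _ (g % 2) ; h≡g/2 = refl
                 ; h'≤1+h = +-monoˡ-≤ (g / 2) (≤-pred (m%n<n g 2)) ; h+h' = h+h' }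
  where
  h+h' : g / 2 + (g % 2 + g / 2) ≡ g
  h+h' = lin (g / 2 ∷ g % 2 ∷ g ∷ []) (λ h r g → g :≡ r :+ (h :+ (h :+ # 0)) ⟹ ⊢ h :+ (r :+ h) :≡ g)
           (trans (m≡m%n+[m/n]*n g 2) (cong (g % 2 +_) (*-comm (g / 2) 2)))

-- Leaves, and mutual visibility in trees

∈-tabulate⁻ : ∀ {n} (f : Fin n → Bool) {x} → x ∈ₛ tabulate f → f x ≡ true
∈-tabulate⁻ f {x} p = trans (sym (lookup∘tabulate f x)) ([]=⇒lookup p)

∈-tabulate⁺ : ∀ {n} (f : Fin n → Bool) {x} → f x ≡ true → x ∈ₛ tabulate f
∈-tabulate⁺ f {x} p = lookup⇒[]= x (tabulate f) (trans (lookup∘tabulate f x) p)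

module Leaves (G : Graph) where
  open Walks G

  leaves : Subset n
  leaves = tabulate (isLeafᵇ G)

  ∈-leaves⁻ : ∀ {v} → v ∈ₛ leaves → degree G v ≡ 1
  ∈-leaves⁻ {v} p = ≡ᵇ⇒≡ (degree G v) 1 (Equivalence.from T-≡ (∈-tabulate⁻ (isLeafᵇ G) p))

  ∈-leaves⁺ : ∀ {v} → degree G v ≡ 1 → v ∈ₛ leaves
  ∈-leaves⁺ {v} eq = ∈-tabulate⁺ (isLeafᵇ G) (Equivalence.to T-≡ (≡⇒≡ᵇ (degree G v) 1 eq))

  leaf-neighbour : ∀ {v a b} → degree G v ≡ 1 → Edge G v a → Edge G v b → a ≡ b
  leaf-neighbour {v} {a} {b} leaf va vb with a ≟ b
  ... | yes eq = eq
  ... | no a≢b = contradiction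
    (≤-trans (length≤∣∣ ((a≢b ∷ []) ∷ [] ∷ [])
      (∈-tabulate⁺ (Graph.adj G v) va ∷ ∈-tabulate⁺ (Graph.adj G v) vb ∷ [])) (≤-reflexive leaf))
    λ { (s≤s ()) }

  unique-neighbour-leaf : ∀ {v a} → Edge G v a → (∀ b → Edge G v b → b ≡ a) → degree G v ≡ 1
  unique-neighbour-leaf {v} {a} va only with elements N | length-elements N | elements-unique N | (λ {x} →
      ∈-elements⁻ N {x}) | (λ {x} → ∈-elements⁺ N {x})
    where N = tabulate (Graph.adj G v)
  ... | []        | _  | _ | _ | ⁺ = case ⁺ (∈-tabulate⁺ (Graph.adj G v) va) of λ ()
  ... | x ∷ []    | eq | _ | _ | _ = sym eq
  ... | x ∷ y ∷ _ | _  | (x≢y ∷ _) ∷ _ | ⁻ | _ =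
    contradiction (trans (isA (here refl)) (sym (isA (there (here refl))))) x≢y
    where
    isA : ∀ {b} → b ∈ x ∷ y ∷ _ → b ≡ a
    isA p = only _ (∈-tabulate⁻ (Graph.adj G v) (⁻ p))

module Trees (G : Graph) (D : Distance G) where
  open Metric G D
  open Bigons G D
  open Leaves G

  -- The predecessor and the successor of an inner leaf on a geodesic would both be its only
  -- neighbour, and skipping the leaf would shorten the geodesic by 2.
  leaf-not-between : ∀ {x y v} → degree G v ≡ 1 → d x v + d v y ≤ d x y → v ≡ x ⊎ v ≡ y
  leaf-not-between {x} {y} {v} leaf le with d x v in dx | d v y in dy
  ... | zero  | _     = inj₁ (sym (d≡0 dx))
  ... | suc _ | zero  = inj₂ (d≡0 dy)
  ... | suc k | suc m with predecessor x v dx | stepToward v y dy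
  ...   | a , av , da | b , vb , db with leaf-neighbour leaf (edge-sym av) vb
  ...     | refl = ⊥-elim (lin (k ∷ m ∷ d x a ∷ d a y ∷ d x y ∷ [])
            (λ k m xa ay xy → (# 1 :+ k) :+ (# 1 :+ m) :≤ xy ⟹ xa :≡ k ⟹ ay :≡ m ⟹ xy :≤ xa :+ ay ⟹ ⊢ :⊥)
            le da db (d-tri x a y))

  leaves-visible : MutualVisibilitySet G leaves
  leaves-visible x y _ _ =
    let (w , lw) = geo x y
    in w , (shortest-path w (≤-reflexive lw) , λ w' → ≤-trans (≤-reflexive lw) (d-min w')) ,
       All.map (λ on v∈ → leaf-not-between (∈-leaves⁻ v∈) (subst (_ ≤_) lw on)) (on-walk w)

  module _ (no-bigon : NoBigon) where

    tree-step : ∀ {v a x y} → Edge G a x → Edge G x y → a ≢ y → d v x ≡ suc (d v a) → d v y ≡ suc (d v x)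
    tree-step ax xy a≢y dx = trans (straight-on ax xy a≢y refl dx (λ _ → no-bigon _)) (cong suc (sym dx))

    -- At a vertex that is not a leaf, any neighbour other than the predecessor lies farther from
    -- `y` by `tree-step`. The bound `b` on all distances makes this stop, with `k` counting what is
    -- left of it.
    extend-to-leaf : ∀ y x → y ≢ x → ∃ λ z → degree G z ≡ 1 × d y z ≡ d y x + d x z
    extend-to-leaf y x y≢x = go b x (m≤n+m b _) (sym (trans (cong (d y x +_) (d-refl x)) (+-identityʳ _)))
      where
      b = proj₁ d-bound
      go : ∀ k z → b ≤ d y z + k → d y z ≡ d y x + d x z → ∃ λ z → degree G z ≡ 1 × d y z ≡ d y x + d x z
      go k z fuel btw with d y z in dz
      ... | zero = contradiction (d≡0 (m+n≡0⇒m≡0 (d y x) (sym btw))) y≢x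
      ... | suc l with predecessor y z dz
      ...   | a , az , da with any? (λ t → edge? z t ×-dec ¬? (t ≟ a))
      ...     | no none = z , unique-neighbour-leaf (edge-sym az) only , trans dz btw
        where
        only : ∀ t → Edge G z t → t ≡ a
        only t zt with t ≟ a
        ... | yes eq = eq
        ... | no t≢a = contradiction (t , zt , t≢a) none
      ...     | yes (t , zt , t≢a) = further k fuel
        where
        dt : d y t ≡ 2 + l
        dt = trans (tree-step az zt (t≢a ∘ sym) (trans dz (cong suc (sym da)))) (cong suc dz)
        beyond : d y t ≡ d y x + d x t
        beyond = lin (d y t ∷ l ∷ d y x ∷ d x z ∷ d x t ∷ [])
          (λ yt l yx xz xt → yt :≡ # 2 :+ l ⟹ # 1 :+ l :≡ yx :+ xz ⟹ xt :≤ # 1 :+ xz ⟹ yt :≤ yx :+ xt ⟹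
              ⊢ yt :≡ yx :+ xt)
          dt btw (d-step x zt) (d-tri y x t)
        further : ∀ k → b ≤ suc l + k → ∃ λ z → degree G z ≡ 1 × d y z ≡ d y x + d x z
        further zero    fuel =
            ⊥-elim (lin (d y t ∷ l ∷ b ∷ [])
            (λ yt l b → yt :≡ # 2 :+ l ⟹ b :≤ # 1 :+ l :+ # 0 ⟹ yt :≤ b ⟹ ⊢ :⊥)
                                  dt fuel (proj₂ d-bound y t))
        further (suc k) fuel =
            go k t (subst (λ q → b ≤ q + k) (sym dt) (≤-trans fuel (≤-reflexive (+-suc (suc l) k)))) beyond

    -- A geodesic whose first edge leads away from `y` keeps doing so: `tree-step` hands the rise on
    -- from each edge to the next.
    rise : ∀ k {y p q z} → Edge G p q → d y q ≡ suc (d y p) → d p z ≡ suc k → d q z ≡ k →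
        d y z ≡ d y p + suc k
    rise zero {y} {p} pq dq _ qz with d≡0 qz
    ... | refl = trans dq (+-comm 1 (d y p))
    rise (suc k) {y} {p} {q} {z} pq dq pz qz with stepToward q z qz
    ... | r , qr , rz = trans (rise k qr (tree-step pq qr p≢r dq) qz rz)
        (trans (cong (_+ suc k) dq) (sym (+-suc (d y p) (suc k))))
      where
      p≢r : p ≢ r
      p≢r refl = m≢1+n+m k {1} (trans (sym rz) pz)

    Toward : V → V → V → Set
    Toward x y a = Edge G x a × d x y ≡ suc (d a y)

    toward : ∀ {x y} → x ≢ y → ∃ (Toward x y)
    toward {x} {y} x≢y with d x y in eq
    ... | zero  = contradiction (d≡0 eq) x≢y
    ... | suc k with stepToward x y eq
    ...   | a , xa , da = a , xa , cong suc (sym da)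

    rises-off : ∀ {x y a b} → Toward x y a → Edge G x b → a ≢ b → d y b ≡ suc (d y x)
    rises-off {x} {y} {a} (xa , dx) xb a≢b =
      tree-step (edge-sym xa) xb a≢b (trans (d-sym y x) (trans dx (cong suc (d-sym a y))))

    toward-unique : ∀ {x y a b} → Toward x y a → Toward x y b → a ≡ b
    toward-unique {x} {y} {a} {b} ta (xb , dx) with a ≟ b
    ... | yes eq = eq
    ... | no a≢b = contradiction
      (trans (trans (d-sym b y) (rises-off ta xb a≢b)) (cong suc (trans (d-sym y x) dx)))
          (m≢1+n+m (d b y) {1})

    edge-rises : ∀ {x y z} → x ≢ y → Edge G y z → d x z ≡ suc (d x y) ⊎ d x y ≡ suc (d x z)
    edge-rises {x} {y} {z} x≢y yz with toward (x≢y ∘ sym)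
    ... | a , ya , dy with a ≟ z
    ...   | yes refl = inj₂ (trans (d-sym x y) (trans dy (cong suc (d-sym z x))))
    ...   | no a≢z   = inj₁ (rises-off (ya , dy) yz a≢z)

    toward-up : ∀ {x y z a} → Edge G y z → d x z ≡ suc (d x y) → Toward x y a → Toward x z a
    toward-up {x} {y} {z} {a} yz up (xa , dx) = xa , ≤-antisym (d-stepˡ z xa)
      (≤-trans (s≤s (d-step a yz)) (≤-reflexive (trans (cong suc (sym dx)) (sym up))))

    -- A walk that avoids `x` stays in one branch at `x`. Each of its edges leads straight away from
    -- `x` or straight towards it, and neither changes the neighbour of `x` through which its
    -- vertices are reached.
    toward-along : ∀ {x y z a} (w : Walk G y z) → All (x ≢_) (verts G w) → Toward x y a → Toward x z a
    toward-along (nil _) _ t = t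
    toward-along {x} {a = a} (cons {y} {y'} e w) (x≢y ∷ av) t = toward-along w av next
      where
      x≢y' : x ≢ y'
      x≢y' = All.lookup av (start-in-verts w)
      next : Toward x y' a
      next with edge-rises x≢y e
      ... | inj₁ up = toward-up e up t
      ... | inj₂ down with toward x≢y'
      ...   | b , tb = subst (Toward x y') (toward-unique (toward-up (edge-sym e) down tb) t) tb

    module _ {X : Subset n} (mv : MutualVisibilitySet G X) where

      -- The sight line between `y` and `z` avoids `x`, so all other members of `X` lie in a single
      -- branch at `x`.
      same-side : ∀ {x y z a} → x ∈ₛ X → y ∈ₛ X → z ∈ₛ X → x ≢ y → x ≢ z → Toward x y a → Toward x z a
      same-side {x} {y} {z} x∈ y∈ z∈ x≢y x≢z t with mv y z y∈ z∈
      ... | w , _ , av = toward-along w (All.map (λ ok → λ { refl → [ x≢y , x≢z ]′ (ok x∈) }) av) t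

      -- A vertex `ℓ` behind `x` lies in another branch at `x` than `y`, hence by `same-side` in
      -- another branch than `z`.
      behind : ∀ {x y z ℓ} → x ∈ₛ X → y ∈ₛ X → z ∈ₛ X → x ≢ y → x ≢ z →
               d y ℓ ≡ d y x + d x ℓ → d z ℓ ≡ d z x + d x ℓ
      behind {x} {y} {z} {ℓ} x∈ y∈ z∈ x≢y x≢z btw with d x ℓ in dx
      ... | zero with d≡0 dx
      ...   | refl = sym (+-identityʳ _)
      behind {x} {y} {z} {ℓ} x∈ y∈ z∈ x≢y x≢z btw | suc k with stepToward x ℓ dx | toward x≢y
      ... | b , xb , db | a , ta = rise k xb (rises-off (same-side x∈ y∈ z∈ x≢y x≢z ta) xb a≢b) dx db
        where
        a≢b : a ≢ b
        a≢b refl = lin (d y ℓ ∷ d y x ∷ d b y ∷ d b ℓ ∷ k ∷ [])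
          (λ yℓ yx by bℓ k → yℓ :≡ yx :+ (# 1 :+ k) ⟹ bℓ :≡ k ⟹ yx :≡ # 1 :+ by ⟹ yℓ :≤ by :+ bℓ ⟹ ⊢ :⊥)
          btw db (trans (d-sym y x) (proj₂ ta)) (subst (λ t → d y ℓ ≤ t + d b ℓ) (d-sym y b) (d-tri y b ℓ))

      tree-bound : 2 ≤ ∣ X ∣ → ∣ X ∣ ≤ numLeaves G
      tree-bound 2≤ with elements X in els | length-elements X
      ... | []         | len = contradiction (subst (2 ≤_) (sym len) 2≤) λ ()
      ... | _ ∷ []     | len = contradiction (subst (2 ≤_) (sym len) 2≤) λ { (s≤s ()) }
      ... | p ∷ q ∷ ps | len =
          subst (_≤ numLeaves G) (trans (length-map leaf (elements X)) (length-elements X))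
          (length≤∣∣ (map-unique leaf leaf-inj (elements-unique X))
            (All.map⁺ (All.universal (λ x → ∈-leaves⁺ (proj₁ (proj₂ (far x)))) (elements X))))
        where
        p≢q : p ≢ q
        p≢q with subst Unique els (elements-unique X)
        ... | (ne ∷ _) ∷ _ = ne
        other : ∀ x → ∃ λ y → y ∈ₛ X × x ≢ y
        other x with x ≟ p
        ... | yes refl = q , ∈-elements⁻ X (subst (q ∈_) (sym els) (there (here refl))) , p≢q
        ... | no x≢p   = p , ∈-elements⁻ X (subst (p ∈_) (sym els) (here refl)) , x≢p
        far : ∀ x → ∃ λ z → degree G z ≡ 1 × d (proj₁ (other x)) z ≡ d (proj₁ (other x)) x + d x z
        far x = extend-to-leaf (proj₁ (other x)) x (proj₂ (proj₂ (other x)) ∘ sym)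
        leaf : V → V
        leaf x = proj₁ (far x)
        beyond : ∀ {x z} → x ∈ elements X → z ∈ elements X → x ≢ z → d z (leaf x) ≡ d z x + d x (leaf x)
        beyond {x} x∈ z∈ x≢z = let (y , y∈ , x≢y) = other x in
          behind (∈-elements⁻ X x∈) y∈ (∈-elements⁻ X z∈) x≢y x≢z (proj₂ (proj₂ (far x)))
        -- If `x` and `z` led to the same leaf, each would lie between the other and that leaf;
        -- adding the two equations makes `d x z` vanish.
        leaf-inj : ∀ {x z} → x ∈ elements X → z ∈ elements X → leaf x ≡ leaf z → x ≡ z
        leaf-inj {x} {z} x∈ z∈ eq with x ≟ z
        ... | yes x≡z = x≡z
        ... | no x≢z = d≡0 (lin (d x z ∷ d z x ∷ d x (leaf x) ∷ d z (leaf x) ∷ [])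
          (λ xz zx xℓ zℓ → xz :≡ zx ⟹ zℓ :≡ zx :+ xℓ ⟹ xℓ :≡ xz :+ zℓ ⟹ ⊢ xz :≡ # 0)
          (d-sym x z) (beyond x∈ z∈ x≢z)
          (subst (λ ℓ → d x ℓ ≡ d x z + d z ℓ) (sym eq) (beyond z∈ x∈ (x≢z ∘ sym))))

-- What μ ≤ 3 enforces on and around the least cycle

module Small (G : Graph) (D : Distance G) (triangle-free : TriangleFree G)
             (small : ∀ X → MutualVisibilitySet G X → ∣ X ∣ ≤ 3) where
  open Metric G D
  open Bigons G D

  no-four : ∀ {a b c e} → Unique (a ∷ b ∷ c ∷ e ∷ []) →
    Clear a b (c ∷ e ∷ []) → Clear a c (b ∷ e ∷ []) → Clear a e (b ∷ c ∷ []) →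
    Clear b c (a ∷ e ∷ []) → Clear b e (a ∷ c ∷ []) → Clear c e (a ∷ b ∷ []) → ⊥
  no-four u ab ac ae bc be ce =
    <⇒≱ (∣fromList∣ u) (small _ (four-visible ab ac ae bc be ce))

  two-apart : ∀ {v a b} → Edge G v a → Edge G v b → a ≢ b → 2 ≤ d a b
  two-apart {v} {a} {b} va vb a≢b with d a b in eq
  ... | zero        = contradiction (d≡0 eq) a≢b
  ... | suc zero    = ⊥-elim (triangle-free v a b va (d≡1 eq) vb)
  ... | suc (suc _) = s≤s (s≤s z≤n)

  clear-via : ∀ {v a b ps} → Edge G v a → Edge G v b → a ≢ b →
              All (a ≢_) ps → All (v ≢_) ps → All (b ≢_) ps → Clear a b ps
  clear-via va vb a≢b a∉ v∉ b∉ =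
    cons (edge-sym va) (edgeʷ vb) , two-apart va vb a≢b , a∉ ∷ v∉ ∷ b∉ ∷ []

  -- Two neighbours a, b of v can lie on a common geodesic to z only if their distances to z differ by 2.
  balanced : ∀ {v a b e z} → Edge G v a → Edge G v b → Edge G v e → a ≢ b → a ≢ e → b ≢ e →
    v ≢ z → a ≢ z → b ≢ z → e ≢ z →
    d a z ≤ suc (d b z) → d b z ≤ suc (d a z) → d a z ≤ suc (d e z) → d e z ≤ suc (d a z) →
    d b z ≤ suc (d e z) → d e z ≤ suc (d b z) → ⊥
  balanced {v} {a} {b} {e} {z} va vb ve a≢b a≢e b≢e v≢z a≢z b≢z e≢z ab ba ae ea be eb =
    no-four ((a≢b ∷ a≢e ∷ a≢z ∷ []) ∷ (b≢e ∷ b≢z ∷ []) ∷ (e≢z ∷ []) ∷ [] ∷ [])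
      (clear-via va vb a≢b (a≢e ∷ a≢z ∷ []) (edge-irrefl ve ∷ v≢z ∷ []) (b≢e ∷ b≢z ∷ []))
      (clear-via va ve a≢e (a≢b ∷ a≢z ∷ []) (edge-irrefl vb ∷ v≢z ∷ []) (b≢e ∘ sym ∷ e≢z ∷ []))
      (clear-off-geodesics a z (off va vb a≢b ab ∷ off va ve a≢e ae ∷ []))
      (clear-via vb ve b≢e (a≢b ∘ sym ∷ b≢z ∷ []) (edge-irrefl va ∷ v≢z ∷ []) (a≢e ∘ sym ∷ e≢z ∷ []))
      (clear-off-geodesics b z (off vb va (a≢b ∘ sym) ba ∷ off vb ve b≢e be ∷ []))
      (clear-off-geodesics e z (off ve va (a≢e ∘ sym) ea ∷ off ve vb (b≢e ∘ sym) eb ∷ []))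
    where
    off : ∀ {x y} → Edge G v x → Edge G v y → x ≢ y → d x z ≤ suc (d y z) → d x z < d x y + d y z
    off {x} {y} vx vy x≢y le = ≤-trans (s≤s le) (+-monoˡ-≤ (d y z) (two-apart vx vy x≢y))

  period* : ∀ {g} (C : Cycle g) k i → Cycle.c C (k * g + i) ≡ Cycle.c C i
  period* C zero i = refl
  period* {g} C (suc k) i = trans (cong (Cycle.c C) (+-assoc g (k * g) i))
      (trans (Cycle.period C (k * g + i)) (period* C k i))

  -- Modulo `suc p` the factor `p` is -1, so multiplying positions by it runs the cycle backwards
  -- without leaving the naturals.
  reverse : ∀ {p} → Cycle (suc p) → Cycle (suc p)
  reverse {p} C = record
    { c      = λ i → c (p * i)
    ; g>0    = s≤s z≤n
    ; period = λ i → trans (cong c (shift p i)) (period* C p (p * i))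
    ; step   = λ i → edge-sym
        (subst₂ (Edge G) (cong c (sym (*-suc p i))) (period (p * i)) (step (p + p * i)))
    ; turn   = λ i eq → turn (p + (p + p * i)) (trans (cong c (twice p i)) (trans (sym eq) (back i)))
    }
    where
    open Cycle C
    shift : ∀ p i → p * (suc p + i) ≡ p * suc p + p * i
    shift = solve-∀
    twice : ∀ p i → p + (p + p * i) ≡ p * (2 + i)
    twice = solve-∀
    around : ∀ p i → suc p + (suc p + p * i) ≡ 2 + (p + (p + p * i))
    around = solve-∀
    back : ∀ i → c (p * i) ≡ c (2 + (p + (p + p * i)))
    back i = trans (sym (trans (period (suc p + p * i)) (period (p * i)))) (cong c (around p i))

  cycle≥4 : ∀ {g} → Cycle g → 4 ≤ g
  cycle≥4 {g} C with m≤n⇒m<n∨m≡n (Cycle.g≥3 C)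
  ... | inj₁ lt   = lt
  ... | inj₂ refl = ⊥-elim (triangle-free (c 0) (c 1) (c 2) (step 0) (step 1)
                      (edge-sym (subst (Edge G (c 2)) (period 0) (step 2))))
    where open Cycle C

  -- A cycle of length g = 1 + p through positions 0, …, p; h and h' are the two distances around it
  -- between antipodal vertices.
  module OnCycle (p h h' : ℕ) (h+h' : h + h' ≡ suc p) (h≤h' : h ≤ h') (h'≤ : h' ≤ suc h) (h≥2 : 2 ≤ h)
                 (none : ∀ j → j < suc p → ¬ Bigon j) where

    Attached : Cycle (suc p) → ℕ → V → Set
    Attached C i u = Edge G (Cycle.c C i) u × ∀ j → u ≢ Cycle.c C j

    twice≤ : ∀ {ℓ} → ℓ ≤ h → ℓ + ℓ ≤ suc p
    twice≤ {ℓ} = lin (ℓ ∷ h ∷ h' ∷ p ∷ [])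
        (λ ℓ h h' p → h :+ h' :≡ # 1 :+ p ⟹ h :≤ h' ⟹ ℓ :≤ h ⟹ ⊢ ℓ :+ ℓ :≤ # 1 :+ p) h+h' h≤h'

    module _ (C : Cycle (suc p)) where
      open Isometric C none

      prev-edge : ∀ i → Edge G (c i) (c (p + i))
      prev-edge i = edge-sym (subst (Edge G (c (p + i))) (period i) (step (p + i)))

      p≥3 : 3 ≤ p
      p≥3 = ≤-pred (cycle≥4 C)

      prev≢next : ∀ i → c (suc i) ≢ c (p + i)
      prev≢next i eq = distinct (p ∸ 1) (suc i) (∸-monoˡ-≤ 1 (≤-trans (n≤1+n 2) p≥3)) (s≤s (m∸n≤m p 1))
        (trans eq (cong c (trans (cong (_+ i) (sym (m∸n+n≡m (≤-trans (s≤s z≤n) p≥3))))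
            (+-assoc (p ∸ 1) 1 i))))

      next-to-antipode : d (c 1) (c h) ≡ h ∸ 1
      next-to-antipode = trans (cong (λ t → d (c 1) (c t)) (sym (m∸n+n≡m (≤-trans (n≤1+n 1) h≥2))))
        (d-forward (h ∸ 1) 1 (twice≤ (m∸n≤m h 1)))

      prev-to-antipode : d (c p) (c h) ≡ h' ∸ 1
      prev-to-antipode = trans (d-sym _ _) (trans (cong (λ t → d (c h) (c t)) p≡)
        (d-forward (h' ∸ 1) h (twice≤ (∸-monoˡ-≤ 1 h'≤))))
        where
        p≡ : p ≡ h' ∸ 1 + h
        p≡ = lin (p ∷ h' ∸ 1 ∷ h ∷ h' ∷ [])
            (λ p q h h' → h :+ h' :≡ # 1 :+ p ⟹ # 1 :+ q :≡ h' ⟹ ⊢ p :≡ q :+ h)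
               h+h' (m+[n∸m]≡n (≤-trans (n≤1+n 1) (≤-trans h≥2 h≤h')))

      module _ {u} (att : Attached C 0 u) where

        private
          out : ∀ j → u ≢ c j
          out = proj₂ att
          s : ℕ → V
          s zero    = u
          s (suc k) = c k
          s-step : ∀ i → Edge G (s i) (s (suc i))
          s-step zero    = edge-sym (proj₁ att)
          s-step (suc i) = step i
          s-turn : ∀ i → s i ≢ s (2 + i)
          s-turn zero    = out 1
          s-turn (suc i) = turn i

        -- The argument of `d-forward` with `u` put in front. The extra edge requires 2(ℓ + 1) ≤ g,
        -- which is why `ℓ` stops short of `h`.
        near-attachment : ∀ ℓ → ℓ < h → d u (c ℓ) ≡ suc ℓ
        near-attachment ℓ ℓ<h = non-backtracking-geodesic s (suc ℓ) (λ i _ → s-step i) (λ i _ → s-turn i)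
          λ i i≤ℓ le → none _ (≤-trans (lin (i ∷ ℓ ∷ d u (c i) ∷ [])
            (λ i ℓ x → i :< # 1 :+ ℓ ⟹ x :≤ i ⟹ ⊢ # 2 :+ (i :+ x) :≤ (# 1 :+ ℓ) :+ (# 1 :+ ℓ)) i≤ℓ le)
                (twice≤ ℓ<h))

        -- Here the exclusion of smaller bigons no longer suffices. If the distance were at most
        -- `h`, then `c 1`, `c p` and `u`, all neighbours of `c 0`, would have distances h - 1 or h
        -- to `c h`, against `balanced`.
        antipode-of-attachment : d u (c h) ≡ suc h
        antipode-of-attachment = ≤-antisym
          (≤-trans (d-stepˡ (c h) (edge-sym (proj₁ att))) (s≤s (≤-reflexive (from0 h ≤-refl))))
          (≰⇒> contra)
          where
          from0 : ∀ ℓ → ℓ ≤ h → d (c 0) (c ℓ) ≡ ℓ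
          from0 ℓ le = trans (cong (λ t → d (c 0) (c t)) (sym (+-identityʳ ℓ))) (d-forward ℓ 0 (twice≤ le))
          h₁ = h ∸ 1
          h₁' = h' ∸ 1
          sh₁ : suc h₁ ≡ h
          sh₁ = m+[n∸m]≡n (≤-trans (n≤1+n 1) h≥2)
          da = next-to-antipode
          db = prev-to-antipode
          contra : ¬ d u (c h) ≤ h
          contra le = balanced (step 0) (subst (λ t → Edge G (c 0) (c t)) (+-identityʳ p) (prev-edge 0))
              (proj₁ att)
            (subst (λ t → c 1 ≢ c t) (+-identityʳ p) (prev≢next 0)) (out 1 ∘ sym) (out p ∘ sym)
            (λ eq → differ (≤-trans (s≤s z≤n) h≥2) (from0 h ≤-refl) eq)
            (differ (∸-monoˡ-≤ 1 h≥2) da) (differ (∸-monoˡ-≤ 1 (≤-trans h≥2 h≤h')) db) (out h)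
            (subst₂ _≤_ (sym da) (cong suc (sym db)) (≤-trans h₁≤ (n≤1+n _)))
            (subst₂ _≤_ (sym db) (cong suc (sym da)) h₁'≤)
            (subst (_≤ suc du) (sym da) (≤-trans low (n≤1+n _)))
            (subst (du ≤_) (cong suc (sym da)) (≤-trans le (≤-reflexive (sym sh₁))))
            (subst (_≤ suc du) (sym db) (≤-trans h₁'≤ (s≤s low)))
            (subst (du ≤_) (cong suc (sym db)) (≤-trans le (≤-trans (≤-reflexive (sym sh₁)) (s≤s h₁≤))))
            where
            du = d u (c h)
            differ : ∀ {x y k} → 1 ≤ k → d x y ≡ k → x ≢ y
            differ {x} 1≤k eq refl = <⇒≢ 1≤k (trans (sym (d-refl x)) eq)
            h₁≤ : h₁ ≤ h₁'
            h₁≤ = ∸-monoˡ-≤ 1 h≤h'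
            h₁'≤ : h₁' ≤ suc h₁
            h₁'≤ = ≤-trans (∸-monoˡ-≤ 1 h'≤) (≤-reflexive (sym sh₁))
            low : h₁ ≤ du
            low = ≤-pred (≤-trans (≤-reflexive (trans (sym (near-attachment h₁ (≤-reflexive sh₁))) refl))
                    (subst (λ t → d u (c h₁) ≤ suc (d u (c t))) sh₁ (d-step u (edge-sym (step h₁)))))

        d-attachment : ∀ ℓ → ℓ ≤ h → d u (c ℓ) ≡ suc ℓ
        d-attachment ℓ ℓ≤h with m≤n⇒m<n∨m≡n ℓ≤h
        ... | inj₁ lt   = near-attachment ℓ lt
        ... | inj₂ refl = antipode-of-attachment

    attached-forward : ∀ C {u} i ℓ → Attached C i u → ℓ ≤ h → d u (Cycle.c C (ℓ + i)) ≡ suc ℓ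
    attached-forward C i ℓ (e , out) = d-attachment (rotate C i) (e , λ j → out (j + i)) ℓ

    attached-backward : ∀ C {u} i k ℓ → Attached C i u → k + ℓ ≡ suc p → ℓ ≤ h →
        d u (Cycle.c C (k + i)) ≡ suc ℓ
    attached-backward C {u} i k ℓ (e , out) k+ℓ ℓ≤h =
      trans (cong (d u) (sym same)) (d-attachment (reverse (rotate C i))
        (subst (λ t → Edge G (c t) u) (cong (_+ i) (sym (*-zeroʳ p))) e , λ j → out (p * j + i)) ℓ ℓ≤h)
      where
      open Cycle C
      around : ∀ p ℓ i → suc p + (p * ℓ + i) ≡ (p * ℓ + suc p) + i
      around = solve-∀
      regroup : ∀ p k ℓ i → (p * ℓ + (k + ℓ)) + i ≡ ℓ * suc p + (k + i)
      regroup = solve-∀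
      same : c (p * ℓ + i) ≡ c (k + i)
      same = trans (sym (period (p * ℓ + i))) (trans (cong c (trans (around p ℓ i)
        (trans (cong (λ t → p * ℓ + t + i) (sym k+ℓ)) (regroup p k ℓ i)))) (period* C ℓ (k + i)))

    -- With x before the first attachment and y after the second, {u, w, x, y} would be visible.
    attachments-apart : ∀ C {u w} j → Attached C 0 u → Attached C j w → 1 ≤ j → j < h → ⊥
    attachments-apart C {u} {w} j au@(eu , outu) aw@(ew , outw) 1≤j j<h = no-four
      ((u≢w ∷ outu p ∷ outu (suc j) ∷ []) ∷ (outw p ∷ outw (suc j) ∷ []) ∷ (x≢y ∷ []) ∷ [] ∷ [])
      (clear-off-geodesics u w
        ( (lin (d u w ∷ d u x ∷ d x w ∷ j ∷ [])
            (λ uw ux xw j → uw :≤ # 2 :+ j ⟹ ux :≡ # 2 ⟹ xw :≡ # 2 :+ j ⟹ ⊢ uw :< ux :+ xw) uw≤ ux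
            (trans (d-sym x w) wx))
        ∷ (lin (d u w ∷ d u y ∷ d y w ∷ j ∷ [])
            (λ uw uy yw j → uw :≤ # 2 :+ j ⟹ uy :≡ # 2 :+ j ⟹ yw :≡ # 2 ⟹ ⊢ uw :< uy :+ yw) uw≤ uy
            (trans (d-sym y w) wy)) ∷ []))
      (clear-off-geodesics u x (short ux (d>0 u≢w) wx ∷ short' ux uy (d>0 (x≢y ∘ sym)) ∷ []))
      -- The pairs u, y and w, x are joined along the cycle between the two attachments; for the
      -- four other pairs the distances alone keep the blockers off.
      (cons (edge-sym eu) (arc (suc j) (+-identityʳ (suc j))) ,
        ≤-reflexive (trans (cong suc (len-arc (suc j) _)) (sym uy)) ,
        (u≢w ∷ outu p ∷ []) ∷ All.map (λ { (t , t≤ , refl) → (outw _ ∘ sym) ∷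
          (subst (λ s → c s ≢ x) (sym (+-identityʳ t)) (c-distinct (≤-<-trans t≤ 1+j<p) ≤-refl)) ∷ [] })
              (verts-arc (suc j) _))
      (cons (edge-sym ew) (revʷ (arc j (+-identityʳ j)) ++ʷ edgeʷ c0x) ,
        ≤-reflexive (trans (cong suc
            (trans (len-++ʷ (revʷ (arc j _)) _)
            (trans (cong (_+ 1) (trans (len-revʷ (arc j _)) (len-arc j _))) (+-comm j 1)))) (sym wx)) ,
        (u≢w ∘ sym ∷ outw (suc j) ∷ []) ∷ verts-++ʷ (revʷ (arc j _)) (edgeʷ c0x) (verts-revʷ (arc j _)
          (All.map (λ { (t , t≤ , refl) →
              ((outu _ ∘ sym) ∷ (subst (λ s → c s ≢ y) (sym (+-identityʳ t)) (c-distinct (s≤s t≤) 1+j<g)) ∷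
              []) }) (verts-arc j _)))
          ((outu 0 ∘ sym ∷ c-distinct (s≤s z≤n) 1+j<g ∷ []) ∷ (outu p ∘ sym ∷ x≢y ∷ []) ∷ []))
      (clear-off-geodesics w y (short wy (d>0 (u≢w ∘ sym)) uy ∷ short' wy wx (d>0 x≢y) ∷ []))
      (clear-off-geodesics x y
        ( (lin (d x y ∷ d x u ∷ d u y ∷ j ∷ [])
            (λ xy xu uy j → xy :≤ # 2 :+ j ⟹ xu :≡ # 2 ⟹ uy :≡ # 2 :+ j ⟹ ⊢ xy :< xu :+ uy) xy≤
            (trans (d-sym x u) ux) uy)
        ∷ (lin (d x y ∷ d x w ∷ d w y ∷ j ∷ [])
            (λ xy xw wy j → xy :≤ # 2 :+ j ⟹ xw :≡ # 2 :+ j ⟹ wy :≡ # 2 ⟹ ⊢ xy :< xw :+ wy) xy≤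
            (trans (d-sym x w) wx) wy) ∷ []))
      where
      open Isometric C none
      x = c p
      y = c (suc j)
      1+j<p : suc j < p
      1+j<p = lin (j ∷ p ∷ h ∷ h' ∷ [])
          (λ j p h h' → j :< h ⟹ h :≤ h' ⟹ # 2 :≤ h ⟹ h :+ h' :≡ # 1 :+ p ⟹ # 3 :≤ p ⟹
          ⊢ # 2 :+ j :≤ p) j<h h≤h' h≥2 h+h' (p≥3 C)
      1+j<g : suc j < suc p
      1+j<g = m<n⇒m<1+n 1+j<p
      x≢y : x ≢ y
      x≢y = c-distinct 1+j<p ≤-refl ∘ sym
      c0x : Edge G (c 0) x
      c0x = subst (λ t → Edge G (c 0) (c t)) (+-identityʳ p) (prev-edge C 0)
      ux : d u x ≡ 2
      ux = subst (λ t → d u (c t) ≡ 2) (+-identityʳ p)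
          (attached-backward C 0 p 1 au (+-comm p 1) (≤-trans (n≤1+n 1) h≥2))
      uy : d u y ≡ 2 + j
      uy = d-attachment C au (suc j) j<h
      wy : d w y ≡ 2
      wy = attached-forward C j 1 aw (≤-trans (n≤1+n 1) h≥2)
      wx : d w x ≡ 2 + j
      wx = subst (λ t → d w (c t) ≡ 2 + j) (m∸n+n≡m j≤p)
          (attached-backward C j (p ∸ j) (suc j) aw (trans (+-suc (p ∸ j) j) (cong suc (m∸n+n≡m j≤p))) j<h)
        where
        j≤p : j ≤ p
        j≤p = <⇒≤ (<-trans ≤-refl 1+j<p)
      u≢w : u ≢ w
      u≢w refl = <⇒≢ (s≤s 1≤j)
          (trans (sym (trans (d-sym u (c j)) (d-edge ew))) (d-attachment C au j (<⇒≤ j<h)))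
      d0 : ∀ i → i ≤ h → d (c 0) (c i) ≡ i
      d0 i le = subst (λ t → d (c 0) (c t) ≡ i) (+-identityʳ i) (d-forward i 0 (twice≤ le))
      uw≤ : d u w ≤ 2 + j
      uw≤ = ≤-trans (d-stepˡ w (edge-sym eu))
          (s≤s (≤-trans (d-step (c 0) ew) (s≤s (≤-reflexive (d0 j (<⇒≤ j<h))))))
      xy≤ : d x y ≤ 2 + j
      xy≤ = ≤-trans (d-stepˡ y (edge-sym c0x)) (s≤s (≤-reflexive (d0 (suc j) j<h)))
      short : ∀ {a e f} → a ≡ 2 → 1 ≤ e → f ≡ 2 + j → a < e + f
      short refl 1≤e refl = +-mono-≤ 1≤e (s≤s (s≤s z≤n))
      short' : ∀ {a e f} → a ≡ 2 → f ≡ 2 + j → 1 ≤ e → a < f + e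
      short' refl refl 1≤e = ≤-trans (≤-reflexive (+-comm 1 2)) (+-mono-≤ (s≤s (s≤s (z≤n {j}))) 1≤e)

    -- A branch hanging from the cycle at `c i`. That it is a path is not part of the definition but
    -- a consequence of visibility, by `siblings`.
    record Leg (C : Cycle (suc p)) (i : ℕ) (T : V → Set) : Set where
      field
        member? : ∀ z → Dec (T z)
        off-cycle : ∀ {z} → T z → ∀ j → z ≢ Cycle.c C j
        closed  : ∀ {z y} → T z → Edge G z y → T y ⊎ y ≡ Cycle.c C i

    module LegPath (C : Cycle (suc p)) {i : ℕ} {T : V → Set} (L : Leg C i T) where
      open Isometric C none
      open Leg L

      gate-≤ : ∀ {z y} (w : Walk G z y) → T z → ∀ j → y ≡ c j → d z (c i) + d (c i) y ≤ len G w
      gate-≤ (nil _) t j eq = contradiction eq (off-cycle t j)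
      gate-≤ (cons e w) t j eq with closed t e
      ... | inj₁ t'   = ≤-trans (+-monoˡ-≤ _ (d-stepˡ (c i) e)) (s≤s (gate-≤ w t' j eq))
      ... | inj₂ refl = +-mono-≤ (≤-reflexive (d-edge e)) (d-min w)

      gate : ∀ {z} j → T z → d z (c j) ≡ d z (c i) + d (c i) (c j)
      gate {z} j t = let (w , lw) = geo z (c j) in
        ≤-antisym (d-tri z (c i) (c j)) (≤-trans (gate-≤ w t j refl) (≤-reflexive lw))

      depth : ∀ {z} → T z → ∃ λ k → d z (c i) ≡ suc k
      depth {z} t with d z (c i) in eq
      ... | zero  = contradiction (d≡0 eq) (off-cycle t i)
      ... | suc k = k , refl

      inner : ∀ {z k} → T z → d z (c i) ≡ suc k → ∃ λ y → Edge G z y × d y (c i) ≡ k × (T y ⊎ y ≡ c i)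
      inner {z} t dz with stepToward z (c i) dz
      ... | y , zy , dy = y , zy , dy , closed t zy

      inner-member : ∀ {z k} → T z → d z (c i) ≡ 2 + k → ∃ λ y → Edge G z y × d y (c i) ≡ suc k × T y
      inner-member t dz with inner t dz
      ... | y , zy , dy , inj₁ ty   = y , zy , dy , ty
      ... | y , zy , dy , inj₂ refl = case trans (sym (d-refl (c i))) dy of λ ()

      -- Two vertices at the same depth would be visible together with the cycle neighbours of c i.
      siblings : ∀ {y z z' k} → T y ⊎ y ≡ c i → Edge G y z → Edge G y z' → T z → T z' →
                 d z (c i) ≡ suc k → d z' (c i) ≡ suc k → z ≢ z' → ⊥
      siblings {y} {z} {z'} {k} ty yz yz' tz tz' dz dz' z≢z' = no-four
        ((z≢z' ∷ off-cycle tz _ ∷ off-cycle tz _ ∷ []) ∷ (off-cycle tz' _ ∷ off-cycle tz' _ ∷ []) ∷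
            (prev≢next C i ∷ []) ∷ [] ∷ [])
        (clear-via yz yz' z≢z' (off-cycle tz _ ∷ off-cycle tz _ ∷ [])
            (y≢ ty (step i) ∷ y≢ ty (prev-edge C i) ∷ []) (off-cycle tz' _ ∷ off-cycle tz' _ ∷ []))
        (away tz dz tz' dz' z≢z' (step i) (prev-edge C i) (prev≢next C i ∘ sym))
        (away tz dz tz' dz' z≢z' (prev-edge C i) (step i) (prev≢next C i))
        (away tz' dz' tz dz (z≢z' ∘ sym) (step i) (prev-edge C i) (prev≢next C i ∘ sym))
        (away tz' dz' tz dz (z≢z' ∘ sym) (prev-edge C i) (step i) (prev≢next C i))
        (clear-via (step i) (prev-edge C i) (prev≢next C i) (out tz ∷ out tz' ∷ []) (out tz ∷ out tz' ∷ [])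
            (out tz ∷ out tz' ∷ []))
        where
        out : ∀ {z j} → T z → c j ≢ z
        out t eq = off-cycle t _ (sym eq)
        y≢ : ∀ {y j} → T y ⊎ y ≡ c i → Edge G (c i) (c j) → y ≢ c j
        y≢ (inj₁ t)    _ = off-cycle t _
        y≢ (inj₂ refl) e = edge-irrefl e
        away : ∀ {z z' j j'} → T z → d z (c i) ≡ suc k → T z' → d z' (c i) ≡ suc k → z ≢ z' →
               Edge G (c i) (c j) → Edge G (c i) (c j') → c j' ≢ c j → Clear z (c j) (z' ∷ c j' ∷ [])
        away {z} {z'} {j} {j'} tz dz tz' dz' z≢z' e e' ne = clear-off-geodesics z (c j)
          ( subst₂ (λ a b → a < d z z' + b) (sym (to tz dz e)) (sym (to tz' dz' e))
              (+-monoˡ-≤ (2 + k) (d>0 z≢z'))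
          ∷ subst₂ (λ a b → a < b + d (c j') (c j)) (sym (to tz dz e)) (sym (to tz dz e'))
              (subst (_≤ 2 + k + d (c j') (c j)) (+-comm (2 + k) 1) (+-monoʳ-≤ (2 + k) (d>0 ne))) ∷ [])
          where
          to : ∀ {z j} → T z → d z (c i) ≡ suc k → Edge G (c i) (c j) → d z (c j) ≡ 2 + k
          to {j = j} t dz e = trans (gate j t) (trans (cong₂ _+_ dz (d-edge e)) (+-comm (suc k) 1))

      -- Induction on the depth: the next vertices towards `c i` coincide, so two vertices of equal
      -- depth would be siblings.
      depth-unique : ∀ k {z z'} → T z → T z' → d z (c i) ≡ suc k → d z' (c i) ≡ suc k → z ≡ z'
      depth-unique k {z} {z'} t t' dz dz' with z ≟ z'
      ... | yes eq = eq
      depth-unique zero {z} {z'} t t' dz dz' | no z≢z' =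
        ⊥-elim (siblings (inj₂ refl) (edge-sym (d≡1 dz)) (edge-sym (d≡1 dz')) t t' dz dz' z≢z')
      depth-unique (suc k) {z} {z'} t t' dz dz' | no z≢z' with inner-member t dz | inner-member t' dz'
      ... | y , zy , dy , ty | y' , zy' , dy' , ty' with depth-unique k ty ty' dy dy'
      ...   | refl = ⊥-elim (siblings (inj₁ ty) (edge-sym zy) (edge-sym zy') t t' dz dz' z≢z')

      AtDepth : ℕ → Set
      AtDepth k = ∃ λ z → T z × d z (c i) ≡ suc k

      atDepth? : ∀ k → Dec (AtDepth k)
      atDepth? k = any? λ z → member? z ×-dec (d z (c i) ℕ.≟ suc k)

      abstract
        -- No depth exceeds the bound on all distances, so some depth is unoccupied; the least such
        -- depth is the number of vertices of the leg.
        leg-length : ∃ λ r → ¬ AtDepth r × ∀ k → k < r → ¬ ¬ AtDepth k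
        leg-length = least (λ k → ¬? (atDepth? k)) (proj₁ d-bound)
          λ { (z , _ , dz) → <⇒≱ (≤-reflexive (sym dz)) (proj₂ d-bound z (c i)) }

      r : ℕ
      r = proj₁ leg-length

      abstract
        vertex : (a : Fin r) → AtDepth (toℕ a)
        vertex a = decidable-stable (atDepth? (toℕ a)) (proj₂ (proj₂ leg-length) (toℕ a) (toℕ<n a))

      leg : Fin r → V
      leg a = proj₁ (vertex a)

      leg-member : ∀ a → T (leg a)
      leg-member a = proj₁ (proj₂ (vertex a))

      leg-depth : ∀ a → d (leg a) (c i) ≡ suc (toℕ a)
      leg-depth a = proj₂ (proj₂ (vertex a))

      -- Moving inwards from a deeper vertex would pass through depth `r`, which is unoccupied.
      depth<r : ∀ {z k} → T z → d z (c i) ≡ suc k → k < r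
      depth<r {z} {k} t dz = ≰⇒> λ r≤k → descend (k ∸ r) t (trans dz (cong suc (sym (m∸n+n≡m r≤k))))
        where
        descend : ∀ m {z} → T z → d z (c i) ≡ suc (m + r) → ⊥
        descend zero    t dz = proj₁ (proj₂ leg-length) (_ , t , dz)
        descend (suc m) t dz = let (_ , _ , dy , ty) = inner-member t dz in descend m ty dy

      leg-onto : ∀ {z k} → T z → d z (c i) ≡ suc k → ∃ λ a → leg a ≡ z × toℕ a ≡ k
      leg-onto {z} {k} t dz = a ,
          depth-unique k (leg-member a) t (trans (leg-depth a) (cong suc (toℕ-fromℕ< k<r))) dz ,
          toℕ-fromℕ< k<r
        where
        k<r = depth<r t dz
        a = fromℕ< k<r

      leg-injective : ∀ {a b} → leg a ≡ leg b → a ≡ b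
      leg-injective {a} {b} eq = toℕ-injective (suc-injective
        (trans (sym (leg-depth a)) (trans (cong (λ v → d v (c i)) eq) (leg-depth b))))

      leg-attached : ∀ a → toℕ a ≡ 0 → Edge G (c i) (leg a)
      leg-attached a a≡0 = edge-sym (d≡1 (trans (leg-depth a) (cong suc a≡0)))

      leg-step : ∀ a b → suc (toℕ a) ≡ toℕ b → Edge G (leg a) (leg b)
      leg-step a b eq with inner-member (leg-member b) (trans (leg-depth b) (cong suc (sym eq)))
      ... | y , by , dy , ty with depth-unique (toℕ a) ty (leg-member a) dy (leg-depth a)
      ...   | refl = edge-sym by

      attachment : ∀ {j z} → Edge G (c j) z → T z → c j ≡ c i × ∃ λ a → leg a ≡ z × toℕ a ≡ 0
      attachment {j} jz t with closed t (edge-sym jz)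
      ... | inj₁ t'   = contradiction refl (off-cycle t' j)
      ... | inj₂ j≡i  = j≡i , leg-onto t (trans (cong (d _) (sym j≡i)) (d-edge (edge-sym jz)))

      leg-neighbour : ∀ a {z} → Edge G (leg a) z →
        (∃ λ b → leg b ≡ z × (suc (toℕ a) ≡ toℕ b ⊎ suc (toℕ b) ≡ toℕ a)) ⊎ (z ≡ c i × toℕ a ≡ 0)
      leg-neighbour a {z} e with closed (leg-member a) e
      ... | inj₂ refl = inj₂ (refl , suc-injective (trans (sym (leg-depth a)) (d-edge e)))
      ... | inj₁ t with depth t
      ...   | k , dz with leg-onto t dz
      ...     | b , refl , _ = inj₁ (b , refl , compare)
        where
        da = leg-depth a
        db = leg-depth b
        compare : suc (toℕ a) ≡ toℕ b ⊎ suc (toℕ b) ≡ toℕ a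
        compare with <-cmp (toℕ a) (toℕ b)
        ... | tri< a<b _ _ = inj₁
            (≤-antisym a<b (≤-pred (subst₂ (λ s t → s ≤ suc t) db da (d-stepˡ (c i) (edge-sym e)))))
        ... | tri> _ _ b<a = inj₂
            (≤-antisym b<a (≤-pred (subst₂ (λ s t → s ≤ suc t) da db (d-stepˡ (c i) e))))
        ... | tri≈ _ a≡b _ = contradiction (cong leg (toℕ-injective a≡b)) (edge-irrefl e)

-- Recognising the graph as a frog

-- By `nbr` the image of `f` is closed under adjacency, so connectedness makes it the whole graph
-- and `f` a bijection.
frog-from-embedding : ∀ G → Connected G → ∀ k r s (f : FrogV k r s → Fin (Graph.n G)) →
  (∀ {a b} → f a ≡ f b → a ≡ b) →
  (∀ {a b} → FrogBase k r s a b → Edge G (f a) (f b)) →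
  (∀ a {z} → Edge G (f a) z → ∃ λ b → FrogAdj k r s a b × f b ≡ z) → IsFrog G
frog-from-embedding G conn k r s f inj hom nbr =
  k , r , s , mk↔ₛ′ to f (λ a → inj (f-to (f a))) f-to , λ u v → mk⇔ (forth u v) (back u v)
  where
  open Walks G
  reach : ∀ {x z} → Walk G x z → ∀ a → f a ≡ x → ∃ λ b → f b ≡ z
  reach (nil _)    a eq = a , eq
  reach (cons e w) a refl = let (b , _ , eq) = nbr a e in reach w b eq
  preimage : ∀ z → ∃ λ b → f b ≡ z
  preimage z = reach (conn (f (inj₁ zero)) z) (inj₁ zero) refl
  to : V → FrogV k r s
  to z = proj₁ (preimage z)
  f-to : ∀ z → f (to z) ≡ z
  f-to z = proj₂ (preimage z)
  forth : ∀ u v → Edge G u v → FrogAdj k r s (to u) (to v)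
  forth u v e with nbr (to u) (subst (λ t → Edge G t v) (sym (f-to u)) e)
  ... | b , adj , fb = subst (FrogAdj k r s (to u)) (inj (trans fb (sym (f-to v)))) adj
  back : ∀ u v → FrogAdj k r s (to u) (to v) → Edge G u v
  back u v adj = subst₂ (Edge G) (f-to u) (f-to v) ([ hom , edge-sym ∘ hom ]′ adj)

module Assemble (G : Graph) (D : Distance G) (conn : Connected G) (triangle-free : TriangleFree G)
             (small : ∀ X → MutualVisibilitySet G X → ∣ X ∣ ≤ 3)
             (k : ℕ) (h h' : ℕ) (h+h' : h + h' ≡ 3 + k) (h≤h' : h ≤ h') (h'≤ : h' ≤ suc h) (h≥2 : 2 ≤ h)
             (h≡g/2 : h ≡ (3 + k) / 2) where
  open Metric G D
  open Bigons G D
  open Small G D triangle-free small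

  module _ (none : ∀ j → j < 3 + k → ¬ Bigon j) (C : Cycle (3 + k)) where
    open OnCycle (2 + k) h h' h+h' h≤h' h'≤ h≥2 none
    open Isometric C none

    h<g : h < 3 + k
    h<g = lin (h ∷ h' ∷ k ∷ [])
        (λ h h' k → h :+ h' :≡ # 3 :+ k ⟹ h :≤ h' ⟹ # 2 :≤ h ⟹ ⊢ h :< # 3 :+ k) h+h' h≤h' h≥2

    c-mod : ∀ i → c i ≡ c (i % (3 + k))
    c-mod i = trans (cong c (trans (m≡m%n+[m/n]*n i (3 + k)) (+-comm (i % (3 + k)) _)))
        (period* C (i / (3 + k)) (i % (3 + k)))

    position-injective : ∀ {i j} → i < 3 + k → j < 3 + k → c i ≡ c j → i ≡ j
    position-injective {i} {j} i<g j<g eq with <-cmp i j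
    ... | tri< i<j _ _ = contradiction eq (c-distinct i<j j<g)
    ... | tri≈ _ i≡j _ = i≡j
    ... | tri> _ _ j<i = contradiction (sym eq) (c-distinct j<i i<g)

    -- The shorter of the two arcs between the positions is a geodesic, so it has length 1: the
    -- positions are consecutive, or they are 0 and g - 1.
    adjacent-positions : ∀ {i j} → i < j → j < 3 + k → Edge G (c i) (c j) →
        suc i % (3 + k) ≡ j ⊎ suc j % (3 + k) ≡ i
    adjacent-positions {i} {j} i<j j<g e with ≤-total (ℓ + ℓ) (3 + k)
      where ℓ = j ∸ i
    ... | inj₁ le = inj₁ (trans (m<n⇒m%n≡m (≤-<-trans i<j j<g))
        (trans (cong (_+ i) 1≡ℓ) (m∸n+n≡m (<⇒≤ i<j))))
      where
      1≡ℓ : 1 ≡ j ∸ i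
      1≡ℓ = trans (sym (d-edge e))
          (trans (cong (λ t → d (c i) (c t)) (sym (m∸n+n≡m (<⇒≤ i<j)))) (d-forward (j ∸ i) i le))
    ... | inj₂ ge = inj₂ (trans (cong (_% (3 + k)) (cong suc j≡)) (trans (n%n≡0 (3 + k)) (sym i≡0)))
      where
      ℓ = j ∸ i
      ℓ' = 3 + k ∸ ℓ
      ℓ+ℓ' : ℓ + ℓ' ≡ 3 + k
      ℓ+ℓ' = m+[n∸m]≡n (≤-trans (m∸n≤m j i) (<⇒≤ j<g))
      ℓ'≡1 : 1 ≡ ℓ'
      ℓ'≡1 = trans (sym (d-edge e)) (trans (cong (λ t → d (c i) (c t)) (sym (m∸n+n≡m (<⇒≤ i<j))))
        (d-backward ℓ ℓ' i ℓ+ℓ'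
            (lin (ℓ ∷ ℓ' ∷ k ∷ [])
            (λ ℓ ℓ' k → # 3 :+ k :≤ ℓ :+ ℓ ⟹ ℓ :+ ℓ' :≡ # 3 :+ k ⟹ ⊢ ℓ' :+ ℓ' :≤ # 3 :+ k) ge ℓ+ℓ')))
      i≡0 : i ≡ 0
      i≡0 = lin (i ∷ j ∷ ℓ ∷ ℓ' ∷ k ∷ [])
          (λ i j ℓ ℓ' k → # 1 :≡ ℓ' ⟹ ℓ :+ ℓ' :≡ # 3 :+ k ⟹ ℓ :+ i :≡ j ⟹ j :< # 3 :+ k ⟹ ⊢ i :≡ # 0)
              ℓ'≡1 ℓ+ℓ' (m∸n+n≡m (<⇒≤ i<j)) j<g
      j≡ : j ≡ 2 + k
      j≡ = lin (i ∷ j ∷ ℓ ∷ ℓ' ∷ k ∷ [])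
          (λ i j ℓ ℓ' k → # 1 :≡ ℓ' ⟹ ℓ :+ ℓ' :≡ # 3 :+ k ⟹ ℓ :+ i :≡ j ⟹ i :≡ # 0 ⟹ ⊢ j :≡ # 2 :+ k)
              ℓ'≡1 ℓ+ℓ' (m∸n+n≡m (<⇒≤ i<j)) i≡0

    cycle-neighbour : ∀ {i j} → i < 3 + k → j < 3 + k → Edge G (c i) (c j) →
        suc i % (3 + k) ≡ j ⊎ suc j % (3 + k) ≡ i
    cycle-neighbour {i} {j} i<g j<g e with <-cmp i j
    ... | tri< i<j _ _ = adjacent-positions i<j j<g e
    ... | tri≈ _ refl _ = contradiction refl (edge-irrefl e)
    ... | tri> _ _ j<i = [ inj₂ , inj₁ ]′ (adjacent-positions j<i i<g (edge-sym e))

    assemble : ∀ {T₁ T₂ : V → Set} → Leg C 0 T₁ → Leg C h T₂ → (∀ {z} → T₁ z → T₂ z → ⊥) →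
               (∀ z → (∃ λ j → j < 3 + k × z ≡ c j) ⊎ T₁ z ⊎ T₂ z) → IsFrog G
    assemble {T₁} {T₂} L₁ L₂ disjoint cover = frog-from-embedding G conn k R.r S.r f inj hom nbr
      where
      module R = LegPath C L₁
      module S = LegPath C L₂
      open Leg
      f : FrogV k R.r S.r → V
      f (inj₁ i)        = c (toℕ i)
      f (inj₂ (inj₁ a)) = R.leg a
      f (inj₂ (inj₂ b)) = S.leg b
      inj : ∀ {a b} → f a ≡ f b → a ≡ b
      inj {inj₁ i} {inj₁ j} eq = cong inj₁ (toℕ-injective (position-injective (toℕ<n i) (toℕ<n j) eq))
      inj {inj₁ i} {inj₂ (inj₁ a)} eq = contradiction (sym eq) (off-cycle L₁ (R.leg-member a) _)
      inj {inj₁ i} {inj₂ (inj₂ b)} eq = contradiction (sym eq) (off-cycle L₂ (S.leg-member b) _)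
      inj {inj₂ (inj₁ a)} {inj₁ i} eq = contradiction eq (off-cycle L₁ (R.leg-member a) _)
      inj {inj₂ (inj₂ b)} {inj₁ i} eq = contradiction eq (off-cycle L₂ (S.leg-member b) _)
      inj {inj₂ (inj₁ a)} {inj₂ (inj₁ b)} eq = cong (inj₂ ∘ inj₁) (R.leg-injective eq)
      inj {inj₂ (inj₂ a)} {inj₂ (inj₂ b)} eq = cong (inj₂ ∘ inj₂) (S.leg-injective eq)
      inj {inj₂ (inj₁ a)} {inj₂ (inj₂ b)} eq =
          ⊥-elim (disjoint (R.leg-member a) (subst T₂ (sym eq) (S.leg-member b)))
      inj {inj₂ (inj₂ a)} {inj₂ (inj₁ b)} eq =
          ⊥-elim (disjoint (R.leg-member b) (subst T₂ eq (S.leg-member a)))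
      hom : ∀ {a b} → FrogBase k R.r S.r a b → Edge G (f a) (f b)
      hom (cyc i j eq) = subst (Edge G (c (toℕ i))) (trans (c-mod (suc (toℕ i))) (cong c eq)) (step (toℕ i))
      hom (attR i a i≡0 a≡0) = subst (λ t → Edge G (c t) (R.leg a)) (sym i≡0) (R.leg-attached a a≡0)
      hom (pathR a b eq) = R.leg-step a b eq
      hom (attS i b i≡h b≡0) = subst
          (λ t → Edge G (c t) (S.leg b)) (trans h≡g/2 (sym i≡h)) (S.leg-attached b b≡0)
      hom (pathS a b eq) = S.leg-step a b eq
      nbr : ∀ a {z} → Edge G (f a) z → ∃ λ b → FrogAdj k R.r S.r a b × f b ≡ z
      nbr (inj₁ i) {z} e with cover z
      ... | inj₁ (j , j<g , refl) = inj₁ (fromℕ< j<g) , adj , cong c (toℕ-fromℕ< j<g)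
        where
        adj : FrogAdj k R.r S.r (inj₁ i) (inj₁ (fromℕ< j<g))
        adj with cycle-neighbour (toℕ<n i) j<g e
        ... | inj₁ eq = inj₁ (cyc i _ (trans eq (sym (toℕ-fromℕ< j<g))))
        ... | inj₂ eq = inj₂ (cyc _ i (trans (cong (λ t → suc t % (3 + k)) (toℕ-fromℕ< j<g)) eq))
      ... | inj₂ (inj₁ t) with R.attachment e t
      ...   | i≡ , a , refl , a≡0 = inj₂ (inj₁ a) ,
          inj₁ (attR i a (position-injective (toℕ<n i) (s≤s z≤n) i≡) a≡0) , refl
      nbr (inj₁ i) {z} e | inj₂ (inj₂ t) with S.attachment e t
      ...   | i≡ , a , refl , a≡0 = inj₂ (inj₂ a) ,
          inj₁ (attS i a (trans (position-injective (toℕ<n i) h<g i≡) h≡g/2) a≡0) , refl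
      nbr (inj₂ (inj₁ a)) e with R.leg-neighbour a e
      ... | inj₁ (b , refl , inj₁ eq) = inj₂ (inj₁ b) , inj₁ (pathR a b eq) , refl
      ... | inj₁ (b , refl , inj₂ eq) = inj₂ (inj₁ b) , inj₂ (pathR b a eq) , refl
      ... | inj₂ (refl , a≡0) = inj₁ zero , inj₂ (attR zero a refl a≡0) , refl
      nbr (inj₂ (inj₂ a)) e with S.leg-neighbour a e
      ... | inj₁ (b , refl , inj₁ eq) = inj₂ (inj₂ b) , inj₁ (pathS a b eq) , refl
      ... | inj₁ (b , refl , inj₂ eq) = inj₂ (inj₂ b) , inj₂ (pathS b a eq) , refl
      ... | inj₂ (refl , a≡0) = inj₁ (fromℕ< h<g) , inj₂ (attS _ a (trans (toℕ-fromℕ< h<g) h≡g/2) a≡0) ,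
          cong c (toℕ-fromℕ< h<g)

  module _ (none : ∀ j → j < 3 + k → ¬ Bigon j) where
    open OnCycle (2 + k) h h' h+h' h≤h' h'≤ h≥2 none

    Outside : Cycle (3 + k) → V → Set
    Outside C z = ∀ j → z ≢ Cycle.c C j

    on-or-off : ∀ C z → (∃ λ j → j < 3 + k × z ≡ Cycle.c C j) ⊎ Outside C z
    on-or-off C z with any? (λ j → z ≟ Cycle.c C (toℕ j))
    ... | yes (j , eq) = inj₁ (toℕ j , toℕ<n j , eq)
    ... | no off = inj₂ λ j eq → off (fromℕ< (m%n<n j (3 + k)) ,
      trans eq (trans (c-mod none C j) (cong (Cycle.c C) (sym (toℕ-fromℕ< (m%n<n j (3 + k)))))))

    outside? : ∀ C z → Dec (Outside C z)
    outside? C z with on-or-off C z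
    ... | inj₁ (j , _ , eq) = no λ off → off j eq
    ... | inj₂ off          = yes off

    AttachedAt : Cycle (3 + k) → Fin (3 + k) → Set
    AttachedAt C i = ∃ λ u → Attached C (toℕ i) u

    attachedAt? : ∀ C i → Dec (AttachedAt C i)
    attachedAt? C i = any? λ u → edge? (Cycle.c C (toℕ i)) u ×-dec outside? C u

    attached-rotate : ∀ C i j {u} → Attached C (j + i) u → Attached (rotate C i) j u
    attached-rotate C i j (e , off) = e , λ t → off (t + i)

    attached-mod : ∀ C j {u} → Attached C j u → AttachedAt C (fromℕ< (m%n<n j (3 + k)))
    attached-mod C j {u} (e , off) =
      u , subst (λ v → Edge G v u) (trans (c-mod none C j) (cong (Cycle.c C) (sym (toℕ-fromℕ< _)))) e , off

    exit : ∀ C {x z} (w : Walk G x z) i → x ≡ Cycle.c C i → Outside C z → ∃ (AttachedAt C)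
    exit C (nil _)    i eq off = contradiction eq (off i)
    exit C (cons {y = y} e w) i refl off with on-or-off C y
    ... | inj₁ (j , _ , eq) = exit C w j eq off
    ... | inj₂ off-y        = _ , attached-mod C i (e , off-y)

    -- The upper bound is the lower one seen from the other attachment: after rotating by `j`, the
    -- first attachment sits at position g - j.
    attached-positions : ∀ C {u w} j → Attached C 0 u → Attached C j w → 1 ≤ j → j < 3 + k → h ≤ j × j ≤ h'
    attached-positions C {u} {w} j au aw 1≤j j<g =
      ≮⇒≥ (λ j<h → attachments-apart C j au aw 1≤j j<h) ,
      ≮⇒≥ (λ h'<j → attachments-apart (rotate C j) (3 + k ∸ j) (attached-rotate C j 0 aw)
        (attached-rotate C j (3 + k ∸ j)
            (subst (λ v → Edge G v u)
            (sym (trans (cong c (trans (m∸n+n≡m (<⇒≤ j<g)) (sym (+-identityʳ _)))) (period 0))) (proj₁ au) ,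
            proj₂ au))
        (m<n⇒0<n∸m j<g) (lin (3 + k ∸ j ∷ j ∷ h ∷ h' ∷ k ∷ [])
          (λ r j h h' k → r :+ j :≡ # 3 :+ k ⟹ h' :< j ⟹ h :+ h' :≡ # 3 :+ k ⟹ ⊢ r :< h)
              (m∸n+n≡m (<⇒≤ j<g)) h'<j h+h'))
      where open Cycle C

    empty-leg : ∀ C i → Leg C i (λ _ → ⊥)
    empty-leg C i = record { member? = λ _ → no λ () ; off-cycle = λ () ; closed = λ () }

    no-legs : ∀ C → ¬ ∃ (AttachedAt C) → IsFrog G
    no-legs C bare = assemble none C (empty-leg C 0) (empty-leg C h) (λ ()) cover
      where
      cover : ∀ z → (∃ λ j → j < 3 + k × z ≡ Cycle.c C j) ⊎ ⊥ ⊎ ⊥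
      cover z with on-or-off C z
      ... | inj₁ on  = inj₁ on
      ... | inj₂ off = contradiction (exit C (conn (Cycle.c C 0) z) 0 refl off) bare

    one-leg : ∀ C → (∀ j {z} → 1 ≤ j → j < 3 + k → ¬ Attached C j z) → IsFrog G
    one-leg C only = assemble none C leg (empty-leg C h) (λ _ ()) cover
      where
      leg : Leg C 0 (Outside C)
      leg = record { member? = outside? C ; off-cycle = λ off → off ; closed = closed }
        where
        closed : ∀ {z y} → Outside C z → Edge G z y → Outside C y ⊎ y ≡ Cycle.c C 0
        closed {z} {y} off e with on-or-off C y
        ... | inj₂ off-y               = inj₁ off-y
        ... | inj₁ (zero , _ , eq)     = inj₂ eq
        ... | inj₁ (suc j , j<g , refl) = ⊥-elim (only (suc j) (s≤s z≤n) j<g (edge-sym e , off))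
      cover : ∀ z → (∃ λ j → j < 3 + k × z ≡ Cycle.c C j) ⊎ Outside C z ⊎ ⊥
      cover z with on-or-off C z
      ... | inj₁ on  = inj₁ on
      ... | inj₂ off = inj₂ (inj₁ off)

    module TwoLegs (C : Cycle (3 + k)) {u w} (au : Attached C 0 u) (aw : Attached C h w) where
      open Isometric C none
      private p = 2 + k

      only : ∀ t {z} → t < 3 + k → Attached C t z → t ≡ 0 ⊎ t ≡ h
      only zero    _   _  = inj₁ refl
      only (suc t) {z} t<g az = inj₂ (≤-antisym (≮⇒≥ not-beyond) h≤t)
        where
        h≤t : h ≤ suc t
        h≤t = proj₁ (attached-positions C (suc t) au az (s≤s z≤n) t<g)
        not-beyond : ¬ h < suc t
        not-beyond h<t = beyond
            (≤-antisym (≤-trans (proj₂ (attached-positions C (suc t) au az (s≤s z≤n) t<g)) h'≤) h<t)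
          where
          -- An attachment at h + 1 would be only one position after the one at `h`, and 1 < h.
          beyond : suc t ≢ suc h
          beyond eq = attachments-apart (rotate C h) 1 (attached-rotate C h 0 aw)
            (attached-rotate C h 1 (subst (λ t → Attached C t z) eq az)) ≤-refl h≥2

      entry : ∀ {z y} (v : Walk G z y) j → y ≡ c j → Outside C z →
              d z (c 0) + d (c 0) y ≤ len G v ⊎ d z (c h) + d (c h) y ≤ len G v
      entry (nil _) j eq off = contradiction eq (off j)
      entry (cons {y = z'} e v) j eq off with on-or-off C z'
      ... | inj₂ off' with entry v j eq off'
      ...   | inj₁ le = inj₁ (≤-trans (+-monoˡ-≤ _ (d-stepˡ (c 0) e)) (s≤s le))
      ...   | inj₂ le = inj₂ (≤-trans (+-monoˡ-≤ _ (d-stepˡ (c h) e)) (s≤s le))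
      entry (cons {y = z'} e v) j eq off | inj₁ (t , t<g , refl) with only t t<g (edge-sym e , off)
      ...   | inj₁ refl = inj₁ (+-mono-≤ (≤-reflexive (d-edge e)) (d-min v))
      ...   | inj₂ refl = inj₂ (+-mono-≤ (≤-reflexive (d-edge e)) (d-min v))

      c0p : Edge G (c 0) (c p)
      c0p = subst (λ t → Edge G (c 0) (c t)) (+-identityʳ p) (prev-edge C 0)

      hn : d (c h) (c 1) ≡ h ∸ 1
      hn = trans (d-sym _ _) (next-to-antipode C)

      hp : d (c h) (c p) ≡ h' ∸ 1
      hp = trans (d-sym _ _) (prev-to-antipode C)

      -- A geodesic from `z` to `c 1` enters the cycle at `c 0` or `c h`. Redirecting it there to
      -- `c p` adds at most 1: `c 0` is adjacent to both ends, and from `c h` they are at distances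
      -- h - 1 and h' - 1.
      prev≤next : ∀ {z} → Outside C z → d (c p) z ≤ suc (d (c 1) z)
      prev≤next {z} off with geo z (c 1)
      ... | v , lv with entry v 1 refl off
      ...   | inj₁ le = lin
          (d (c p) z ∷ d (c 1) z ∷ len G v ∷ d z (c 1) ∷ d z (c 0) ∷ d (c 0) (c 1) ∷ d (c 0) z ∷ [])
                (λ B' B l B₁ D d1 D₁ → D :+ d1 :≤ l ⟹ l :≡ B₁ ⟹ B₁ :≡ B ⟹ d1 :≡ # 1 ⟹ D :≡ D₁ ⟹
                    B' :≤ # 1 :+ D₁ ⟹ ⊢ B' :≤ # 1 :+ B)
                le lv (d-sym _ _) (d-edge (step 0)) (d-sym _ _) (d-stepˡ z (edge-sym c0p))
      ...   | inj₂ le = lin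
          (d (c p) z ∷ d (c 1) z ∷ len G v ∷ d z (c 1) ∷ d z (c h) ∷ d (c h) (c 1) ∷ d (c h) (c p) ∷
          d z (c p) ∷ h ∸ 1 ∷ h' ∸ 1 ∷ [])
                (λ B' B l B₁ D d1 dp B'₁ q q' → D :+ d1 :≤ l ⟹ l :≡ B₁ ⟹ B₁ :≡ B ⟹ d1 :≡ q ⟹ dp :≡ q' ⟹
                    q' :≤ # 1 :+ q ⟹ B'₁ :≤ D :+ dp ⟹ B'₁ :≡ B' ⟹ ⊢ B' :≤ # 1 :+ B)
                le lv (d-sym _ _) hn hp
                    (≤-trans (∸-monoˡ-≤ 1 h'≤) (≤-reflexive (sym (m+[n∸m]≡n (≤-trans (n≤1+n 1) h≥2)))))
                    (d-tri z (c h) (c p)) (d-sym _ _)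

      next≤prev : ∀ {z} → Outside C z → d (c 1) z ≤ d (c p) z
      next≤prev {z} off with geo z (c p)
      ... | v , lv with entry v p refl off
      ...   | inj₁ le = lin
          (d (c 1) z ∷ d (c p) z ∷ len G v ∷ d z (c p) ∷ d z (c 0) ∷ d (c 0) (c p) ∷ d (c 0) z ∷ [])
                (λ B B' l B'₁ D dp D₁ → D :+ dp :≤ l ⟹ l :≡ B'₁ ⟹ B'₁ :≡ B' ⟹ dp :≡ # 1 ⟹ D :≡ D₁ ⟹
                    B :≤ # 1 :+ D₁ ⟹ ⊢ B :≤ B')
                le lv (d-sym _ _) (d-edge c0p) (d-sym _ _) (d-stepˡ z (edge-sym (step 0)))
      ...   | inj₂ le = lin
          (d (c 1) z ∷ d (c p) z ∷ len G v ∷ d z (c p) ∷ d z (c h) ∷ d (c h) (c 1) ∷ d (c h) (c p) ∷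
          d z (c 1) ∷ h ∸ 1 ∷ h' ∸ 1 ∷ [])
                (λ B B' l B'₁ D d1 dp B₁ q q' → D :+ dp :≤ l ⟹ l :≡ B'₁ ⟹ B'₁ :≡ B' ⟹ d1 :≡ q ⟹ dp :≡ q' ⟹
                    q :≤ q' ⟹ B₁ :≤ D :+ d1 ⟹ B₁ :≡ B ⟹ ⊢ B :≤ B')
                le lv (d-sym _ _) hn hp (∸-monoˡ-≤ 1 h≤h') (d-tri z (c h) (c 1)) (d-sym _ _)

      -- The sides of `c 0` and of `c h`, told apart by distances alone. The choice of `c p` in one
      -- and `c 1` in the other is deliberate: with `next≤prev` and `prev≤next`, the two negations
      -- then give all six inequalities of `balanced`.
      Near0 Nearh : V → Set
      Near0 z = Outside C z × 2 + d u z ≤ d (c p) z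
      Nearh z = Outside C z × 2 + d (c 1) z ≤ d u z

      near0-or-nearh : ∀ z → Outside C z → Near0 z ⊎ Nearh z
      near0-or-nearh z off with u ≟ z | 2 + d u z ≤? d (c p) z | 2 + d (c 1) z ≤? d u z
      ... | _ | yes le | _ = inj₁ (off , le)
      ... | _ | _ | yes le = inj₂ (off , le)
      ... | yes refl | no ¬0 | _ =
          contradiction (≤-trans (s≤s (s≤s (≤-reflexive (d-refl u))))
          (two-apart c0p (proj₁ au) (off p ∘ sym))) ¬0
      ... | no u≢z | no ¬0 | no ¬h = ⊥-elim (balanced (step 0) c0p (proj₁ au)
              (subst (λ t → c 1 ≢ c t) (+-identityʳ p) (prev≢next C 0)) (proj₂ au 1 ∘ sym)
                  (proj₂ au p ∘ sym)
              (off 0 ∘ sym) (off 1 ∘ sym) (off p ∘ sym) u≢z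
              (≤-trans (next≤prev off) (n≤1+n _)) (prev≤next off)
              (≤-trans (next≤prev off) below) above
              below (≤-trans above (s≤s (next≤prev off))))
        where
        below : d (c p) z ≤ suc (d u z)
        below = ≤-pred (≰⇒> ¬0)
        above : d u z ≤ suc (d (c 1) z)
        above = ≤-pred (≰⇒> ¬h)

      -- Across an edge the distances from `u` and from `c p` change by at most 1 each, and at `y`
      -- those from `c p` and `c 1` are within 1 of each other; two gaps of 2 leave no room for
      -- this.
      not-adjacent : ∀ {z y} → Near0 z → Nearh y → Edge G z y → ⊥
      not-adjacent {z} {y} (_ , near0) (off , nearh) e =
          lin (d u z ∷ d (c p) z ∷ d (c 1) y ∷ d u y ∷ d (c p) y ∷ [])
        (λ uz pz 1y uy py → # 2 :+ uz :≤ pz ⟹ # 2 :+ 1y :≤ uy ⟹ uy :≤ # 1 :+ uz ⟹ pz :≤ # 1 :+ py ⟹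
            py :≤ # 1 :+ 1y ⟹ ⊢ :⊥)
        near0 nearh (d-step u e) (d-step (c p) (edge-sym e)) (prev≤next off)

      leg0 : Leg C 0 Near0
      leg0 = record { member? = λ z → outside? C z ×-dec (2 + d u z ≤? d (c p) z) ; off-cycle =
          proj₁ ; closed = closed }
        where
        closed : ∀ {z y} → Near0 z → Edge G z y → Near0 y ⊎ y ≡ c 0
        closed {z} {y} nz@(off , near0) e with on-or-off C y
        ... | inj₂ off-y with near0-or-nearh y off-y
        ...   | inj₁ ny = inj₁ ny
        ...   | inj₂ ny = ⊥-elim (not-adjacent nz ny e)
        closed {z} {y} nz@(off , near0) e | inj₁ (t , t<g , refl) with only t t<g (edge-sym e , off)
        ...   | inj₁ refl = inj₂ refl
        -- A vertex attached at `c h` has distance h + 1 from `c 0`, hence at least `h` from `u`,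
        -- but at most h' ≤ h + 1 from `c p`.
        ...   | inj₂ refl = ⊥-elim
            (lin (d u z ∷ d (c p) z ∷ d z (c p) ∷ d z (c h) ∷ d (c h) (c p) ∷ h ∷ h' ∷ d z (c 0) ∷ h' ∸ 1 ∷
            d (c 0) z ∷ [])
                  (λ uz pz zp zh hp h h' z0 q 0z → # 2 :+ uz :≤ pz ⟹ zp :≡ pz ⟹ zp :≤ zh :+ hp ⟹ zh :≡ # 1 ⟹
                      hp :≡ q ⟹ # 1 :+ q :≡ h' ⟹
                     h' :≤ # 1 :+ h ⟹ z0 :≡ # 1 :+ h ⟹ z0 :≡ 0z ⟹ 0z :≤ # 1 :+ uz ⟹ ⊢ :⊥)
                  near0 (d-sym _ _) (d-tri z (c h) (c p)) (d-edge e) hp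
                      (m+[n∸m]≡n (≤-trans (n≤1+n 1) (≤-trans h≥2 h≤h'))) h'≤
                  back (d-sym _ _) (d-stepˡ z (proj₁ au)))
          where
          back : d z (c 0) ≡ suc h
          back = trans (cong (d z)
              (sym (trans (cong c (trans (trans (+-comm h' h) h+h') (sym (+-identityʳ _)))) (period 0))))
                   (attached-backward C h h' h (edge-sym e , off) (trans (+-comm h' h) h+h') ≤-refl)

      legh : Leg C h Nearh
      legh = record { member? = λ z → outside? C z ×-dec (2 + d (c 1) z ≤? d u z) ; off-cycle =
          proj₁ ; closed = closed }
        where
        closed : ∀ {z y} → Nearh z → Edge G z y → Nearh y ⊎ y ≡ c h
        closed {z} {y} nz@(off , nearh) e with on-or-off C y
        ... | inj₂ off-y with near0-or-nearh y off-y
        ...   | inj₁ ny = ⊥-elim (not-adjacent ny nz (edge-sym e))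
        ...   | inj₂ ny = inj₁ ny
        closed {z} {y} nz@(off , nearh) e | inj₁ (t , t<g , refl) with only t t<g (edge-sym e , off)
        ...   | inj₂ refl = inj₂ refl
        -- A vertex attached at `c 0` is within 2 of `u` and at least 1 from `c 1`, too close for
        -- the gap in `nearh`.
        ...   | inj₁ refl = ⊥-elim (<⇒≱ (+-monoʳ-≤ 2 (d>0 (off 1 ∘ sym)))
                  (≤-trans nearh (≤-trans (d-stepˡ z (edge-sym (proj₁ au)))
                      (s≤s (≤-reflexive (d-edge (edge-sym e)))))))

      two-legs : IsFrog G
      two-legs = assemble none C leg0 legh
        (λ (off , near0) (_ , nearh) → lin (d u _ ∷ d (c p) _ ∷ d (c 1) _ ∷ [])
          (λ uz pz 1z → # 2 :+ uz :≤ pz ⟹ # 2 :+ 1z :≤ uz ⟹ pz :≤ # 1 :+ 1z ⟹ ⊢ :⊥) near0 nearh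
              (prev≤next off))
        cover
        where
        cover : ∀ z → (∃ λ j → j < 3 + k × z ≡ c j) ⊎ Near0 z ⊎ Nearh z
        cover z with on-or-off C z
        ... | inj₁ on  = inj₁ on
        ... | inj₂ off = inj₂ (near0-or-nearh z off)

    attached-at-0 : ∀ C {u} → Attached C 0 u → IsFrog G
    attached-at-0 C {u} au with any? (λ j → (1 ≤? toℕ j) ×-dec attachedAt? C j)
    ... | no alone = one-leg C λ j {z} 1≤j j<g az → alone (fromℕ< j<g ,
            subst (1 ≤_) (sym (toℕ-fromℕ< j<g)) 1≤j , z , subst
                (λ t → Attached C t z) (sym (toℕ-fromℕ< j<g)) az)
    ... | yes (j , 1≤j , w , aw) = second (attached-positions C (toℕ j) au aw 1≤j (toℕ<n j))
      where
      open Cycle C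
      second : h ≤ toℕ j × toℕ j ≤ h' → IsFrog G
      second (h≤j , j≤h') with m≤n⇒m<n∨m≡n h≤j
      ... | inj₂ h≡j = TwoLegs.two-legs C au (subst (λ t → Attached C t w) (sym h≡j) aw)
      -- An odd cycle with the second leg at h' = h + 1: count from that leg instead.
      ... | inj₁ h<j = TwoLegs.two-legs (rotate C (toℕ j)) (attached-rotate C (toℕ j) 0 aw)
              (attached-rotate C (toℕ j) h (subst (λ v → Edge G v u) (sym c≡) (proj₁ au) , proj₂ au))
        where
        c≡ : c (h + toℕ j) ≡ c 0
        c≡ = trans (cong c (trans (cong (h +_) (≤-antisym j≤h' (≤-trans h'≤ h<j)))
            (trans h+h' (sym (+-identityʳ _))))) (period 0)

    cycle⇒frog : Cycle (3 + k) → IsFrog G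
    cycle⇒frog C with any? (attachedAt? C)
    ... | no bare          = no-legs C bare
    ... | yes (i , u , au) = attached-at-0 (rotate C (toℕ i)) (attached-rotate C (toℕ i) 0 au)

bigon⇒frog : ∀ G (D : Distance G) → Connected G → TriangleFree G →
    (∀ X → MutualVisibilitySet G X → ∣ X ∣ ≤ 3) →
  ∀ {g} → Bigons.Bigon G D g → (∀ j → j < g → ¬ Bigons.Bigon G D j) → IsFrog G
bigon⇒frog G D conn triangle-free small {g} big none = go g C (Small.cycle≥4 G D triangle-free small C) none
  where
  open Bigons G D
  C = least-bigon-cycle big none
  go : ∀ g → Cycle g → 4 ≤ g → (∀ j → j < g → ¬ Bigon j) → IsFrog G
  go (suc zero) _ (s≤s ())
  go (suc (suc zero)) _ (s≤s (s≤s ()))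
  go (suc (suc (suc k))) C 4≤g none =
    Assemble.cycle⇒frog G D conn triangle-free small k h h' h+h' h≤h' h'≤1+h h≥2 h≡g/2 none C
    where
    open Halves (halve (3 + k))
    h≥2 : 2 ≤ h
    h≥2 = lin (h ∷ h' ∷ k ∷ [])
        (λ h h' k → h :+ h' :≡ # 3 :+ k ⟹ h' :≤ # 1 :+ h ⟹ # 4 :≤ # 3 :+ k ⟹ ⊢ # 2 :≤ h) h+h' h'≤1+h 4≤g

-- Coordinates on a frog and their symmetries

-- R and S count along the two legs from the cycle vertex they are attached to (R 0 and S 0);
-- U and L count along the two sides of the cycle, of lengths a and b, from R 0 to S 0.
data Pos : Set where
  R S U L : ℕ → Pos

data Step (a b : ℕ) : Pos → Pos → Set where
  r-r : ∀ t → Step a b (R t) (R (suc t))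
  s-s : ∀ t → Step a b (S t) (S (suc t))
  r-u : Step a b (R 0) (U 1)
  r-l : Step a b (R 0) (L 1)
  u-u : ∀ i → 1 ≤ i → suc i < a → Step a b (U i) (U (suc i))
  l-l : ∀ i → 1 ≤ i → suc i < b → Step a b (L i) (L (suc i))
  u-s : ∀ i → suc i ≡ a → Step a b (U i) (S 0)
  l-s : ∀ i → suc i ≡ b → Step a b (L i) (S 0)

-- The metric enters through upper bounds only, which limit the length of sight lines. The fields
-- are stable under exchanging the sides (`mirror`) and the legs (`flip`), so obstructions are
-- proved for `R` and `U` and transported; this is also why `a` and `b` bound each other
-- symmetrically.
record Coordinates (G : Graph) (D : Distance G) (a b : ℕ) : Set where
  open Metric G D
  field
    pos      : V → Pos
    pos-inj  : ∀ {x y} → pos x ≡ pos y → x ≡ y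
    pos-edge : ∀ {x y} → Edge G x y → Step a b (pos x) (pos y) ⊎ Step a b (pos y) (pos x)
    a≥2 : 2 ≤ a
    b≥2 : 2 ≤ b
    a≤ : a ≤ suc b
    b≤ : b ≤ suc a
    U-range : ∀ {x i} → pos x ≡ U i → 1 ≤ i × i < a
    L-range : ∀ {x i} → pos x ≡ L i → 1 ≤ i × i < b
    d-RU : ∀ {x y t j} → pos x ≡ R t → pos y ≡ U j → d x y ≤ t + j
    d-RL : ∀ {x y t j} → pos x ≡ R t → pos y ≡ L j → d x y ≤ t + j
    d-UU : ∀ {x y i j} → pos x ≡ U i → pos y ≡ U j → i ≤ j → d x y + i ≤ j
    d-LL : ∀ {x y i j} → pos x ≡ L i → pos y ≡ L j → i ≤ j → d x y + i ≤ j
    d-US : ∀ {x y i t} → pos x ≡ U i → pos y ≡ S t → d x y + i ≤ a + t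
    d-LS : ∀ {x y i t} → pos x ≡ L i → pos y ≡ S t → d x y + i ≤ b + t

swap : Pos → Pos
swap (R t) = R t
swap (S t) = S t
swap (U t) = L t
swap (L t) = U t
swap-swap : ∀ p → swap (swap p) ≡ p
swap-swap (R _) = refl
swap-swap (S _) = refl
swap-swap (U _) = refl
swap-swap (L _) = refl
swap-to : ∀ {p q} → swap p ≡ q → p ≡ swap q
swap-to {p} refl = sym (swap-swap p)

mirror : ∀ {G D a b} → Coordinates G D a b → Coordinates G D b a
mirror {G} {D} {a} {b} K = record
  { pos = swap ∘ pos ; pos-inj = λ eq → pos-inj (swap-inj _ _ eq)
  ; pos-edge = λ e → [ inj₁ ∘ swap-step , inj₂ ∘ swap-step ]′ (pos-edge e)
  ; a≥2 = b≥2 ; b≥2 = a≥2 ; a≤ = b≤ ; b≤ = a≤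
  ; U-range = λ p → L-range (swap-to p) ; L-range = λ p → U-range (swap-to p)
  ; d-RU = λ p q → d-RL (swap-to p) (swap-to q) ; d-RL = λ p q → d-RU (swap-to p) (swap-to q)
  ; d-UU = λ p q → d-LL (swap-to p) (swap-to q) ; d-LL = λ p q → d-UU (swap-to p) (swap-to q)
  ; d-US = λ p q → d-LS (swap-to p) (swap-to q) ; d-LS = λ p q → d-US (swap-to p) (swap-to q)
  }
  where
  open Coordinates K
  swap-inj : ∀ p q → swap p ≡ swap q → p ≡ q
  swap-inj p q eq = trans (swap-to eq) (swap-swap q)
  swap-step : ∀ {p q} → Step a b p q → Step b a (swap p) (swap q)
  swap-step (r-r t)    = r-r t
  swap-step (s-s t)    = s-s t
  swap-step r-u        = r-l
  swap-step r-l        = r-u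
  swap-step (u-u i p q) = l-l i p q
  swap-step (l-l i p q) = u-u i p q
  swap-step (u-s i eq) = l-s i eq
  swap-step (l-s i eq) = u-s i eq

turnAround : ℕ → ℕ → Pos → Pos
turnAround a b (R t) = S t
turnAround a b (S t) = R t
turnAround a b (U i) = U (a ∸ i)
turnAround a b (L i) = L (b ∸ i)

-- Counting the sides from the other end exchanges the bounds between a side and `R` with those
-- between the side and `S`.
flip : ∀ {G D a b} → Coordinates G D a b → Coordinates G D a b
flip {G} {D} {a} {b} K = record
  { pos = turn ∘ pos ; pos-inj = λ {x} {y} → turn-inj x y
  ; pos-edge = λ {x} {y} e → [ (λ s → turn-step s) , (λ s → [ inj₂ , inj₁ ]′ (turn-step s)) ]′ (pos-edge e)
  ; a≥2 = a≥2 ; b≥2 = b≥2 ; a≤ = a≤ ; b≤ = b≤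
  ; U-range = λ {x} p → let (i , q , eq) = turn-U (pos x) p in subst (λ j → 1 ≤ j × j < a) eq (range (U-range q))
  ; L-range = λ {x} p → let (i , q , eq) = turn-L (pos x) p in subst (λ j → 1 ≤ j × j < b) eq (range (L-range q))
  ; d-RU = λ {x} {y} {t} p q → let (i , r , eq) = turn-U (pos y) q in
      subst (λ j → d x y ≤ t + j) eq (back (proj₂ (U-range r)) (d-sym x y) (d-US r (turn-R (pos x) p)))
  ; d-RL = λ {x} {y} {t} p q → let (i , r , eq) = turn-L (pos y) q in
      subst (λ j → d x y ≤ t + j) eq (back (proj₂ (L-range r)) (d-sym x y) (d-LS r (turn-R (pos x) p)))
  ; d-UU = λ {x} {y} p q → let (i , r , eq) = turn-U (pos x) p ; (j , r' , eq') = turn-U (pos y) q in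
      between (d-sym x y) eq eq' (proj₂ (U-range r)) (proj₂ (U-range r')) (d-UU r' r)
  ; d-LL = λ {x} {y} p q → let (i , r , eq) = turn-L (pos x) p ; (j , r' , eq') = turn-L (pos y) q in
      between (d-sym x y) eq eq' (proj₂ (L-range r)) (proj₂ (L-range r')) (d-LL r' r)
  ; d-US = λ {x} {y} {_} {t} p q → let (i , r , eq) = turn-U (pos x) p in
      subst (λ j → d x y + j ≤ a + t) eq (forth (proj₂ (U-range r)) (d-sym x y) (d-RU (turn-S (pos y) q) r))
  ; d-LS = λ {x} {y} {_} {t} p q → let (i , r , eq) = turn-L (pos x) p in
      subst (λ j → d x y + j ≤ b + t) eq (forth (proj₂ (L-range r)) (d-sym x y) (d-RL (turn-S (pos y) q) r))
  }
  where
  open Coordinates K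
  open Metric G D
  turn : Pos → Pos
  turn = turnAround a b
  turn-R : ∀ p {t} → turn p ≡ R t → p ≡ S t
  turn-R (S _) refl = refl
  turn-S : ∀ p {t} → turn p ≡ S t → p ≡ R t
  turn-S (R _) refl = refl
  turn-U : ∀ p {j} → turn p ≡ U j → ∃ λ i → p ≡ U i × a ∸ i ≡ j
  turn-U (U i) refl = i , refl , refl
  turn-L : ∀ p {j} → turn p ≡ L j → ∃ λ i → p ≡ L i × b ∸ i ≡ j
  turn-L (L i) refl = i , refl , refl
  U-inj : ∀ {i j} → U i ≡ U j → i ≡ j
  U-inj refl = refl
  L-inj : ∀ {i j} → L i ≡ L j → i ≡ j
  L-inj refl = refl
  turn-inj : ∀ x y → turn (pos x) ≡ turn (pos y) → x ≡ y
  turn-inj x y eq with pos x in px | pos y in py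
  turn-inj x y refl | R t | R _ = pos-inj (trans px (sym py))
  turn-inj x y refl | S t | S _ = pos-inj (trans px (sym py))
  turn-inj x y eq | U i | U j =
      pos-inj (trans px (trans
      (cong U (∸-cancelˡ-≡ (<⇒≤ (proj₂ (U-range px))) (<⇒≤ (proj₂ (U-range py))) (U-inj eq))) (sym py)))
  turn-inj x y eq | L i | L j =
      pos-inj (trans px (trans
      (cong L (∸-cancelˡ-≡ (<⇒≤ (proj₂ (L-range px))) (<⇒≤ (proj₂ (L-range py))) (L-inj eq))) (sym py)))
  ∸-suc : ∀ {a i} → suc i ≤ a → a ∸ i ≡ suc (a ∸ suc i)
  ∸-suc {suc a} {i} (s≤s le) = +-∸-assoc 1 le
  last : ∀ i {a} → suc i ≡ a → a ∸ i ≡ 1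
  last i refl = trans (+-∸-assoc 1 (≤-refl {i})) (cong suc (n∸n≡0 i))
  turn-step : ∀ {p q} → Step a b p q → Step a b (turn p) (turn q) ⊎ Step a b (turn q) (turn p)
  turn-step (r-r t) = inj₁ (s-s t)
  turn-step (s-s t) = inj₁ (r-r t)
  turn-step r-u = inj₂ (u-s (a ∸ 1) (m+[n∸m]≡n (<⇒≤ a≥2)))
  turn-step r-l = inj₂ (l-s (b ∸ 1) (m+[n∸m]≡n (<⇒≤ b≥2)))
  turn-step (u-u i 1≤i lt) = inj₂ (subst (λ k → Step a b (U (a ∸ suc i)) (U k)) (sym (∸-suc (<⇒≤ lt)))
    (u-u (a ∸ suc i) (m<n⇒0<n∸m lt) (subst (_< a) (∸-suc (<⇒≤ lt)) (∸-monoʳ-< 1≤i (<⇒≤ (<⇒≤ lt))))))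
  turn-step (l-l i 1≤i lt) = inj₂ (subst (λ k → Step a b (L (b ∸ suc i)) (L k)) (sym (∸-suc (<⇒≤ lt)))
    (l-l (b ∸ suc i) (m<n⇒0<n∸m lt) (subst (_< b) (∸-suc (<⇒≤ lt)) (∸-monoʳ-< 1≤i (<⇒≤ (<⇒≤ lt))))))
  turn-step (u-s i eq) = inj₂ (subst (λ k → Step a b (R 0) (U k)) (sym (last i eq)) r-u)
  turn-step (l-s i eq) = inj₂ (subst (λ k → Step a b (R 0) (L k)) (sym (last i eq)) r-l)
  range : ∀ {i a} → 1 ≤ i × i < a → 1 ≤ a ∸ i × a ∸ i < a
  range (1≤i , i<a) = m<n⇒0<n∸m i<a , ∸-monoʳ-< 1≤i (<⇒≤ i<a)
  back : ∀ {i a t x y} → i < a → x ≡ y → y + i ≤ a + t → x ≤ t + (a ∸ i)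
  back {i} {a} {t} {x} {y} i<a = lin (i ∷ a ∷ t ∷ x ∷ y ∷ a ∸ i ∷ [])
    (λ i a t x y r → r :+ i :≡ a ⟹ x :≡ y ⟹ y :+ i :≤ a :+ t ⟹ ⊢ x :≤ t :+ r) (m∸n+n≡m (<⇒≤ i<a))
  forth : ∀ {i a t x y} → i < a → x ≡ y → y ≤ t + i → x + (a ∸ i) ≤ a + t
  forth {i} {a} {t} {x} {y} i<a = lin (i ∷ a ∷ t ∷ x ∷ y ∷ a ∸ i ∷ [])
    (λ i a t x y r → r :+ i :≡ a ⟹ x :≡ y ⟹ y :≤ t :+ i ⟹ ⊢ x :+ r :≤ a :+ t) (m∸n+n≡m (<⇒≤ i<a))
  between : ∀ {i j i' j' a x y} → x ≡ y → a ∸ i ≡ i' → a ∸ j ≡ j' → i < a → j < a →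
            (j ≤ i → y + j ≤ i) → i' ≤ j' → x + i' ≤ j'
  between {i} {j} {i'} {j'} {a} {x} {y} x≡y refl refl i<a j<a le i'≤j' =
      lin (i ∷ j ∷ a ∷ x ∷ y ∷ a ∸ i ∷ a ∸ j ∷ [])
    (λ i j a x y r s → r :+ i :≡ a ⟹ s :+ j :≡ a ⟹ x :≡ y ⟹ y :+ j :≤ i ⟹ ⊢ x :+ r :≤ s)
    (m∸n+n≡m (<⇒≤ i<a)) (m∸n+n≡m (<⇒≤ j<a)) x≡y
    (le (lin (i ∷ j ∷ a ∷ a ∸ i ∷ a ∸ j ∷ []) (λ i j a r s → r :+ i :≡ a ⟹ s :+ j :≡ a ⟹ r :≤ s ⟹ ⊢ j :≤ i)
      (m∸n+n≡m (<⇒≤ i<a)) (m∸n+n≡m (<⇒≤ j<a)) i'≤j'))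

-- Obstructions to visibility in a frog

module Obstructions {G D a b} (K : Coordinates G D a b) {X : Subset (Graph.n G)}
    (mv : MutualVisibilitySet G X) where
  open Metric G D
  open Coordinates K

  sight-line : ∀ {x y} → x ∈ₛ X → y ∈ₛ X →
    ∃ λ (w : Walk G x y) → len G w ≤ d x y × All (λ v → v ∈ₛ X → v ≡ x ⊎ v ≡ y) (verts G w)
  sight-line {x} {y} x∈ y∈ =
    let (w , (_ , short) , clear) = mv x y x∈ y∈ ; (v , lv) = geo x y
    in w , ≤-trans (short v) (≤-reflexive lv) , clear

  R-inj : ∀ {s t} → R s ≡ R t → s ≡ t
  R-inj refl = refl

  avoids : ∀ {x y m q} {vs : List V} → pos m ≡ q → m ∈ₛ X → m ≢ x → m ≢ y →
           All (λ v → v ∈ₛ X → v ≡ x ⊎ v ≡ y) vs → All (λ v → pos v ≢ q) vs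
  avoids pm m∈ m≢x m≢y = All.map λ {v} ok pv → case pos-inj (trans pv (sym pm)) of λ
    { refl → [ m≢x , m≢y ]′ (ok m∈) }

  -- The common core of the separation arguments: when the members of `X` are forbidden as inner
  -- vertices, a sight line cannot cross the boundary of `In`.
  propagate : ∀ (Ok In : Pos → Set) →
    (∀ {p q} → Step a b p q → Ok p → Ok q → (In p → In q) × (In q → In p)) →
    ∀ {x y} (w : Walk G x y) → All (λ v → Ok (pos v)) (verts G w) → In (pos x) → In (pos y)
  propagate Ok In closed (nil _) _ p = p
  propagate Ok In closed (cons e w) (ok ∷ oks) p =
    propagate Ok In closed w oks (step (pos-edge e) p)
    where
    ok' = All.lookup oks (start-in-verts w)
    step : _ → _
    step (inj₁ s) = proj₁ (closed s ok ok')
    step (inj₂ s) = proj₂ (closed s ok' ok)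

  data Above (s : ℕ) : Pos → Set where
    above : ∀ {t} → s < t → Above s (R t)

  above? : ∀ s p → Dec (Above s p)
  above? s (R t) = map′ above (λ { (above lt) → lt }) (suc s ≤? t)
  above? s (S _) = no λ ()
  above? s (U _) = no λ ()
  above? s (L _) = no λ ()

  cut-R : ∀ {x y m s} → x ∈ₛ X → y ∈ₛ X → m ∈ₛ X → pos m ≡ R s → Above s (pos x) → ¬ Above s (pos y) →
      m ≢ y → ⊥
  cut-R {x} {y} {m} {s} x∈ y∈ m∈ pm ax ay m≢y =
    let (w , _ , clear) = sight-line x∈ y∈
    in ay (propagate (_≢ R s) (Above s) closed w (avoids pm m∈ m≢x m≢y clear) ax)
    where
    m≢x : m ≢ x
    m≢x refl with subst (Above s) pm ax
    ... | above lt = <-irrefl refl lt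
    closed : ∀ {p q} → Step a b p q → p ≢ R s → q ≢ R s → (Above s p → Above s q) × (Above s q → Above s p)
    closed (r-r t) p≢ q≢ = (λ { (above lt) → above (m<n⇒m<1+n lt) }) ,
      (λ { (above lt) → above (≤∧≢⇒< (≤-pred lt) (p≢ ∘ cong R ∘ sym)) })
    closed r-u _ _ = (λ { (above ()) }) , λ ()
    closed r-l _ _ = (λ { (above ()) }) , λ ()
    closed (s-s _) _ _ = (λ ()) , λ ()
    closed (u-u _ _ _) _ _ = (λ ()) , λ ()
    closed (l-l _ _ _) _ _ = (λ ()) , λ ()
    closed (u-s _ _) _ _ = (λ ()) , λ ()
    closed (l-s _ _) _ _ = (λ ()) , λ ()

  -- Wherever `z` lies, one of the three cuts the other two apart: `y` if `z` is farther out on the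
  -- leg, `z` if it lies between them, and `x` in all other cases.
  R-pair< : ∀ {x y z s t} → x ∈ₛ X → y ∈ₛ X → z ∈ₛ X → pos x ≡ R s → pos y ≡ R t → s < t → x ≢ z → y ≢ z → ⊥
  R-pair< {x} {y} {z} {s} {t} x∈ y∈ z∈ px py s<t x≢z y≢z with above? t (pos z) | above? s (pos z)
  ... | yes az | _ = cut-R z∈ x∈ y∈ py az
      (λ ax → case subst (Above t) px ax of λ { (above lt) → <-asym s<t lt })
                       (λ { refl → <⇒≢ s<t (R-inj (trans (sym px) py)) })
  ... | no _ | no ¬az = cut-R y∈ z∈ x∈ px (subst (Above s) (sym py) (above s<t)) ¬az x≢z
  ... | no ¬az | yes az with pos z in pz
  R-pair< {x} {y} {z} {s} {t} x∈ y∈ z∈ px py s<t x≢z y≢z | no ¬az | yes (above {u} s<u) | R .u =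
    cut-R y∈ x∈ z∈ pz (subst (Above u) (sym py) (above u<t))
      (λ ax → case subst (Above u) px ax of λ { (above lt) → <-asym s<u lt }) (x≢z ∘ sym)
    where
    u<t : u < t
    u<t = ≤∧≢⇒< (≮⇒≥ (¬az ∘ above)) λ { refl → y≢z (pos-inj (trans py (sym pz))) }

  R-pair : ∀ {x y z s t} → x ∈ₛ X → y ∈ₛ X → z ∈ₛ X → pos x ≡ R s → pos y ≡ R t → x ≢ y → x ≢ z → y ≢ z → ⊥
  R-pair {s = s} {t} x∈ y∈ z∈ px py x≢y x≢z y≢z with <-cmp s t
  ... | tri< s<t _ _ = R-pair< x∈ y∈ z∈ px py s<t x≢z y≢z
  ... | tri≈ _ refl _ = x≢y (pos-inj (trans px (sym py)))
  ... | tri> _ _ t<s = R-pair< y∈ x∈ z∈ py px t<s y≢z x≢z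

  -- The part containing the first leg when the positions `U i` and `L l` are deleted.
  data Before (i l : ℕ) : Pos → Set where
    onR : ∀ {t} → Before i l (R t)
    onU : ∀ {t} → t < i → Before i l (U t)
    onL : ∀ {t} → t < l → Before i l (L t)

  separate : ∀ {x y u v i l} → x ∈ₛ X → y ∈ₛ X → u ∈ₛ X → v ∈ₛ X → pos u ≡ U i → pos v ≡ L l →
    Before i l (pos x) → ¬ Before i l (pos y) → u ≢ y → v ≢ y → ⊥
  separate {x} {y} {u} {v} {i} {l} x∈ y∈ u∈ v∈ pu pv bx by u≢y v≢y =
    let (w , _ , clear) = sight-line x∈ y∈
    in by (propagate (λ p → p ≢ U i × p ≢ L l) (Before i l) closed w
            (All.zip (avoids pu u∈ u≢x u≢y clear , avoids pv v∈ v≢x v≢y clear)) bx)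
    where
    u≢x : u ≢ x
    u≢x refl with subst (Before i l) pu bx
    ... | onU lt = <-irrefl refl lt
    v≢x : v ≢ x
    v≢x refl with subst (Before i l) pv bx
    ... | onL lt = <-irrefl refl lt
    closed : ∀ {p q} → Step a b p q → p ≢ U i × p ≢ L l → q ≢ U i × q ≢ L l →
             (Before i l p → Before i l q) × (Before i l q → Before i l p)
    closed (r-r t) _ _ = (λ _ → onR) , λ _ → onR
    closed (s-s t) _ _ = (λ ()) , λ ()
    closed r-u _ (q≢ , _) = (λ _ → onU (≤∧≢⇒< (proj₁ (U-range pu)) (q≢ ∘ cong U))) , λ _ → onR
    closed r-l _ (_ , q≢) = (λ _ → onL (≤∧≢⇒< (proj₁ (L-range pv)) (q≢ ∘ cong L))) , λ _ → onR
    closed (u-u t _ _) _ (q≢ , _) = (λ { (onU lt) → onU (≤∧≢⇒< lt (q≢ ∘ cong U)) }) ,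
        λ { (onU lt) → onU (<⇒≤ lt) }
    closed (l-l t _ _) _ (_ , q≢) = (λ { (onL lt) → onL (≤∧≢⇒< lt (q≢ ∘ cong L)) }) ,
        λ { (onL lt) → onL (<⇒≤ lt) }
    closed (u-s t refl) _ _ = (λ { (onU lt) → ⊥-elim (<⇒≱ lt (≤-pred (proj₂ (U-range pu)))) }) , λ ()
    closed (l-s t refl) _ _ = (λ { (onL lt) → ⊥-elim (<⇒≱ lt (≤-pred (proj₂ (L-range pv)))) }) , λ ()

  -- The length of the detour around the other side of the cycle, for a walk that starts at R t
  -- (or before U i, with t = 0) and must not use U i.
  detour : ℕ → ℕ → Pos → ℕ
  detour t i (R s) = t ∸ s
  detour t i (S _) = t + b
  detour t i (L l) = t + l
  detour t i (U j) with j ≤? i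
  ... | yes _ = t
  ... | no  _ = t + b + (a ∸ j)

  detour-U≤ : ∀ t {i j} → j ≤ i → detour t i (U j) ≡ t
  detour-U≤ t {i} {j} le with j ≤? i
  ... | yes _  = refl
  ... | no ¬le = contradiction le ¬le

  detour-U> : ∀ t {i j} → i < j → detour t i (U j) ≡ t + b + (a ∸ j)
  detour-U> t {i} {j} lt with j ≤? i
  ... | yes le = contradiction le (<⇒≱ lt)
  ... | no _   = refl

  -- Away from `U i` the function `detour` changes by at most 1 per step, so its increase bounds the
  -- length of a walk from below.
  detour-step : ∀ t {i} → 1 ≤ i → i < a → ∀ {p q} → Step a b p q → p ≢ U i → q ≢ U i →
    detour t i q ≤ suc (detour t i p) × detour t i p ≤ suc (detour t i q)
  detour-step t 1≤i i<a (r-r s) _ _ =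
    ≤-trans (∸-monoʳ-≤ t (n≤1+n s)) (n≤1+n _) , ∸-suc-≤ t s
    where
    ∸-suc-≤ : ∀ m n → m ∸ n ≤ suc (m ∸ suc n)
    ∸-suc-≤ zero    n       = subst (_≤ 1) (sym (0∸n≡0 n)) z≤n
    ∸-suc-≤ (suc m) zero    = ≤-refl
    ∸-suc-≤ (suc m) (suc n) = ∸-suc-≤ m n
  detour-step t 1≤i i<a (s-s s) _ _ = n≤1+n _ , n≤1+n _
  detour-step t 1≤i i<a r-u _ _ rewrite detour-U≤ t 1≤i = n≤1+n _ , n≤1+n _
  detour-step t 1≤i i<a r-l _ _ = ≤-reflexive (+-comm t 1) , ≤-trans (m≤m+n t 1) (n≤1+n _)
  detour-step t {i} 1≤i i<a (u-u j _ j<a) p≢ q≢ with <-cmp j i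
  ... | tri≈ _ refl _ = contradiction refl p≢
  ... | tri< j<i _ _ rewrite detour-U≤ t {i} {j} (<⇒≤ j<i) | detour-U≤ t {i} {suc j} j<i = n≤1+n _ , n≤1+n _
  ... | tri> _ _ i<j rewrite detour-U> t {i} {j} i<j | detour-U> t {i} {suc j} (m<n⇒m<1+n i<j) =
    near (m∸n+n≡m (<⇒≤ (<⇒≤ j<a))) (m∸n+n≡m (<⇒≤ j<a))
    where
    near : a ∸ j + j ≡ a → a ∸ suc j + suc j ≡ a → _ × _
    near e e' =
      lin (t ∷ b ∷ a ∷ j ∷ a ∸ j ∷ a ∸ suc j ∷ [])
          (λ t b a j r s → r :+ j :≡ a ⟹ s :+ (# 1 :+ j) :≡ a ⟹
          ⊢ t :+ b :+ s :≤ # 1 :+ (t :+ b :+ r)) e e' ,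
      lin (t ∷ b ∷ a ∷ j ∷ a ∸ j ∷ a ∸ suc j ∷ [])
          (λ t b a j r s → r :+ j :≡ a ⟹ s :+ (# 1 :+ j) :≡ a ⟹ ⊢ t :+ b :+ r :≤ # 1 :+ (t :+ b :+ s)) e e'
  detour-step t 1≤i i<a (l-l j _ _) _ _ = ≤-reflexive (+-suc t j) ,
      ≤-trans (+-monoʳ-≤ t (n≤1+n j)) (n≤1+n _)
  detour-step t {i} 1≤i i<a (u-s j eq) p≢ _ with m≤n⇒m<n∨m≡n (≤-pred (≤-trans i<a (≤-reflexive (sym eq))))
  ... | inj₂ refl = contradiction refl p≢
  ... | inj₁ i<j rewrite detour-U> t {i} {j} i<j = ≤-trans (m≤m+n (t + b) _) (n≤1+n _) ,
    ≤-reflexive (trans (cong (t + b +_)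
        (trans (cong (_∸ j) (sym eq)) (trans (+-∸-assoc 1 (≤-refl {j})) (cong suc (n∸n≡0 j)))))
        (+-comm (t + b) 1))
  detour-step t 1≤i i<a (l-s j refl) _ _ = ≤-reflexive (+-suc t j) ,
      ≤-trans (+-monoʳ-≤ t (n≤1+n j)) (n≤1+n _)

  detour-walk : ∀ t {i} → 1 ≤ i → i < a → ∀ {x y} (w : Walk G x y) → All (λ v → pos v ≢ U i) (verts G w) →
    detour t i (pos y) ≤ detour t i (pos x) + len G w
  detour-walk t 1≤i i<a (nil _) _ = m≤m+n _ 0
  detour-walk t {i} 1≤i i<a {x} (cons {y = x'} e w) (ok ∷ oks) =
    ≤-trans (detour-walk t 1≤i i<a w oks)
        (≤-trans (+-monoˡ-≤ (len G w) (near (pos-edge e))) (≤-reflexive (sym (+-suc _ _))))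
    where
    ok' = All.lookup oks (start-in-verts w)
    near : _ → detour t i (pos x') ≤ suc (detour t i (pos x))
    near (inj₁ s) = proj₁ (detour-step t 1≤i i<a s ok ok')
    near (inj₂ s) = proj₂ (detour-step t 1≤i i<a s ok' ok)

  -- A walk from `x` to `v` that avoids `u` goes round the cycle and has length at least t + b + (a
  -- - j). This exceeds t + j, since j < a ≤ b + 1.
  blocked : ∀ {x u v i j} t → x ∈ₛ X → u ∈ₛ X → v ∈ₛ X → pos u ≡ U i → pos v ≡ U j → i < j → u ≢ x →
            detour t i (pos x) ≡ 0 → d x v ≤ t + j → ⊥
  blocked {x} {u} {v} {i} {j} t x∈ u∈ v∈ pu pv i<j u≢x start near =
    let (w , short , clear) = sight-line x∈ v∈ ; (1≤i , i<a) = U-range pu in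
    lin (t ∷ b ∷ a ∷ j ∷ a ∸ j ∷ len G w ∷ d x v ∷ [])
      (λ t b a j r w xv → t :+ b :+ r :≤ w ⟹ w :≤ xv ⟹ xv :≤ t :+ j ⟹ r :+ j :≡ a ⟹ j :< a ⟹ a :≤ # 1 :+ b ⟹
          ⊢ :⊥)
      (subst₂ (λ p q → p ≤ q + len G w) (trans (cong (detour t i) pv) (detour-U> t i<j)) start
        (detour-walk t 1≤i i<a w (avoids pu u∈ u≢x u≢v clear)))
      short near (m∸n+n≡m (<⇒≤ (proj₂ (U-range pv)))) (proj₂ (U-range pv)) a≤
    where
    u≢v : u ≢ v
    u≢v refl with trans (sym pu) pv
    ... | refl = <-irrefl refl i<j

  U-pair-R : ∀ {x u v t i j} → x ∈ₛ X → u ∈ₛ X → v ∈ₛ X → pos x ≡ R t → pos u ≡ U i → pos v ≡ U j → i < j →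
      ⊥
  U-pair-R {x} {t = t} {i} x∈ u∈ v∈ px pu pv i<j = blocked t x∈ u∈ v∈ pu pv i<j
    (λ { refl → case trans (sym px) pu of λ () })
    (trans (cong (detour t i) px) (n∸n≡0 t)) (d-RU px pv)

  U-triple : ∀ {x u v k i j} → x ∈ₛ X → u ∈ₛ X → v ∈ₛ X → pos x ≡ U k → pos u ≡ U i → pos v ≡ U j → k < i →
      i < j → ⊥
  U-triple {i = i} x∈ u∈ v∈ px pu pv k<i i<j = blocked 0 x∈ u∈ v∈ pu pv i<j
    (λ { refl → case trans (sym px) pu of λ { refl → <-irrefl refl k<i } })
    (trans (cong (detour 0 i) px) (detour-U≤ 0 (<⇒≤ k<i)))
    (≤-trans (m≤m+n _ _) (d-UU px pv (<⇒≤ (<-trans k<i i<j))))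

-- Counting mutually visible vertices of a frog

third : ∀ {n} {e₁ e₂ e₃ : Fin n} {es} → Unique (e₁ ∷ e₂ ∷ e₃ ∷ es) → ∀ x y →
        ∃ λ z → z ∈ e₁ ∷ e₂ ∷ e₃ ∷ es × x ≢ z × y ≢ z
third {e₁ = e₁} {e₂} {e₃} ((12≢ ∷ 13≢ ∷ _) ∷ (23≢ ∷ _) ∷ _) x y with x ≟ e₁ | y ≟ e₁ | x ≟ e₂ | y ≟ e₂
... | no p     | no q     | _        | _        = e₁ , here refl , p , q
... | _        | _        | no p     | no q     = e₂ , there (here refl) , p , q
... | yes refl | _        | yes refl | _        = contradiction refl 12≢
... | _        | yes refl | _        | yes refl = contradiction refl 12≢
... | yes refl | _        | _        | yes refl = e₃ , there (there (here refl)) , 13≢ , 23≢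
... | _        | yes refl | yes refl | _        = e₃ , there (there (here refl)) , 23≢ , 13≢

module _ {A : Set} where

  member : ∀ {xs : List A} → 1 ≤ length xs → ∃ (_∈ xs)
  member {x ∷ _} _ = x , here refl

  two-members : ∀ {xs : List A} → Unique xs → 2 ≤ length xs → ∃ λ x → ∃ λ y → x ∈ xs × y ∈ xs × x ≢ y
  two-members {x ∷ y ∷ _} ((x≢y ∷ _) ∷ _) _ = x , y , here refl , there (here refl) , x≢y
  two-members {_ ∷ []} _ (s≤s ())

  length≤1 : ∀ {xs : List A} → Unique xs → (∀ {x y} → x ∈ xs → y ∈ xs → x ≢ y → ⊥) → length xs ≤ 1
  length≤1 u no-pair = ≮⇒≥ λ two → let (_ , _ , x∈ , y∈ , x≢y) = two-members u two in no-pair x∈ y∈ x≢y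

  length≤0 : ∀ {xs : List A} → (∀ {x} → x ∈ xs → ⊥) → length xs ≤ 0
  length≤0 empty = ≮⇒≥ λ one → empty (proj₂ (member one))

length≤2 : ∀ {n} {xs : List (Fin n)} → Unique xs → ∀ {x y} → (∀ {z} → z ∈ xs → x ≢ z → y ≢ z → ⊥) →
    length xs ≤ 2
length≤2 {xs = []}               _ _ = z≤n
length≤2 {xs = _ ∷ []}           _ _ = s≤s z≤n
length≤2 {xs = _ ∷ _ ∷ []}       _ _ = s≤s (s≤s z≤n)
length≤2 {xs = _ ∷ _ ∷ _ ∷ _} u {x} {y} none =
  let (_ , z∈ , x≢z , y≢z) = third u x y in ⊥-elim (none z∈ x≢z y≢z)

side : Pos → Fin 4
side (R _) = zero
side (S _) = suc zero
side (U _) = suc (suc zero)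
side (L _) = suc (suc (suc zero))

module Bound {G D a b} (K : Coordinates G D a b) {X : Subset (Graph.n G)}
    (mv : MutualVisibilitySet G X) where
  open Metric G D
  open Coordinates K
  open Obstructions K mv
  private
    module Flipped  = Obstructions (flip K) mv

  -- Seen from either leg, the nearer of two points on a side hides the farther, and of three points
  -- on a side the middle one hides an end. `flip` reduces the leg `S` to the leg `R`.
  U-pair-rest< : ∀ {u v x i j} → u ∈ₛ X → v ∈ₛ X → x ∈ₛ X → pos u ≡ U i → pos v ≡ U j → i < j → u ≢ x →
      v ≢ x →
                 ∃ λ l → pos x ≡ L l
  U-pair-rest< {u} {v} {x} {i} {j} u∈ v∈ x∈ pu pv i<j u≢x v≢x with pos x in px
  ... | L l = l , refl
  ... | R t = ⊥-elim (U-pair-R x∈ u∈ v∈ px pu pv i<j)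
  ... | S t = ⊥-elim (Flipped.U-pair-R x∈ v∈ u∈ (cong turn px) (cong turn pv) (cong turn pu)
      (∸-monoʳ-< i<j (<⇒≤ (proj₂ (U-range pv)))))
    where turn = turnAround a b
  ... | U k with <-cmp k i | <-cmp k j
  ...   | tri< k<i _ _ | _ = ⊥-elim (U-triple x∈ u∈ v∈ px pu pv k<i i<j)
  ...   | tri≈ _ refl _ | _ = contradiction (pos-inj (trans pu (sym px))) u≢x
  ...   | tri> _ _ i<k | tri< k<j _ _ = ⊥-elim (U-triple u∈ x∈ v∈ pu px pv i<k k<j)
  ...   | _ | tri≈ _ refl _ = contradiction (pos-inj (trans pv (sym px))) v≢x
  ...   | _ | tri> _ _ j<k = ⊥-elim (U-triple u∈ v∈ x∈ pu pv px i<j j<k)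

  U-pair-rest : ∀ {u v x i j} → u ∈ₛ X → v ∈ₛ X → x ∈ₛ X → pos u ≡ U i → pos v ≡ U j → u ≢ v → u ≢ x →
      v ≢ x →
                ∃ λ l → pos x ≡ L l
  U-pair-rest {i = i} {j} u∈ v∈ x∈ pu pv u≢v u≢x v≢x with <-cmp i j
  ... | tri< i<j _ _  = U-pair-rest< u∈ v∈ x∈ pu pv i<j u≢x v≢x
  ... | tri≈ _ refl _ = contradiction (pos-inj (trans pu (sym pv))) u≢v
  ... | tri> _ _ j<i  = U-pair-rest< v∈ u∈ x∈ pv pu j<i v≢x u≢x

  -- `v` and `p` together cut the cycle so that `u` lies before the cut and `q` beyond it.
  quad : ∀ {u v p q i j l m} → u ∈ₛ X → v ∈ₛ X → p ∈ₛ X → q ∈ₛ X → pos u ≡ U i → pos v ≡ U j → pos p ≡ L l →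
      pos q ≡ L m →
         i < j → l < m → ⊥
  quad {u} {v} {p} {q} {i} {j} {l} {m} u∈ v∈ p∈ q∈ pu pv pp pq i<j l<m = separate u∈ q∈ v∈ p∈ pv pp
    (subst (Before j l) (sym pu) (onU i<j))
    (λ b → case subst (Before j l) pq b of λ { (onL m<l) → <-asym l<m m<l })
    (λ { refl → case trans (sym pv) pq of λ () })
    (λ { refl → case trans (sym pp) pq of λ { refl → <-irrefl refl l<m } })

  two-pairs : ∀ {u v p q i j l m} → u ∈ₛ X → v ∈ₛ X → p ∈ₛ X → q ∈ₛ X → pos u ≡ U i → pos v ≡ U j →
      pos p ≡ L l → pos q ≡ L m →
              u ≢ v → p ≢ q → ⊥
  two-pairs {i = i} {j} {l} {m} u∈ v∈ p∈ q∈ pu pv pp pq u≢v p≢q with <-cmp i j | <-cmp l m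
  ... | tri≈ _ refl _ | _             = u≢v (pos-inj (trans pu (sym pv)))
  ... | _             | tri≈ _ refl _ = p≢q (pos-inj (trans pp (sym pq)))
  ... | tri< i<j _ _  | tri< l<m _ _  = quad u∈ v∈ p∈ q∈ pu pv pp pq i<j l<m
  ... | tri< i<j _ _  | tri> _ _ m<l  = quad u∈ v∈ q∈ p∈ pu pv pq pp i<j m<l
  ... | tri> _ _ j<i  | tri< l<m _ _  = quad v∈ u∈ p∈ q∈ pv pu pp pq j<i l<m
  ... | tri> _ _ j<i  | tri> _ _ m<l  = quad v∈ u∈ q∈ p∈ pv pu pq pp j<i m<l

-- Each leg carries at most one member. Two members on one side force all others onto the opposite
-- side, and two pairs on opposite sides are excluded. Otherwise each of the four classes has one
-- member, and the two on the sides separate the two on the legs.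
at-most-three : ∀ {G D a b} → Coordinates G D a b → ∀ X → MutualVisibilitySet G X → ∣ X ∣ ≤ 3
at-most-three {G} {D} {a} {b} K X mv = ≮⇒≥ λ 4≤ →
    impossible (≤-trans 4≤ (≤-reflexive (sym (length-elements X))))
  where
  open Metric G D
  open Coordinates K
  open Obstructions K mv
  module B  = Bound K mv
  module B′ = Bound (mirror K) mv
  module Flipped = Obstructions (flip K) mv

  xs : List V
  xs = elements X

  bucket : Fin 4 → List V → List V
  bucket s = filter (λ v → side (pos v) ≟ s)

  rs ss us ls : List V
  rs = bucket zero xs
  ss = bucket (suc zero) xs
  us = bucket (suc (suc zero)) xs
  ls = bucket (suc (suc (suc zero))) xs

  bucket-lengths : ∀ vs → length vs ≡ length (bucket zero vs) + (length (bucket (suc zero) vs)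
    + (length (bucket (suc (suc zero)) vs) + length (bucket (suc (suc (suc zero))) vs)))
  bucket-lengths [] = refl
  bucket-lengths (v ∷ vs) with pos v | bucket-lengths vs
  ... | R _ | ih = cong suc ih
  ... | S _ | ih = trans (cong suc ih) (sym (+-suc (length (bucket zero vs)) _))
  ... | U _ | ih = lin (length vs ∷ length (bucket zero vs) ∷ length (bucket (suc zero) vs) ∷
      length (bucket (suc (suc zero)) vs) ∷ length (bucket (suc (suc (suc zero))) vs) ∷ [])
                     (λ n r s u l → n :≡ r :+ (s :+ (u :+ l)) ⟹
                         ⊢ # 1 :+ n :≡ r :+ (s :+ ((# 1 :+ u) :+ l))) ih
  ... | L _ | ih = lin (length vs ∷ length (bucket zero vs) ∷ length (bucket (suc zero) vs) ∷
      length (bucket (suc (suc zero)) vs) ∷ length (bucket (suc (suc (suc zero))) vs) ∷ [])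
                     (λ n r s u l → n :≡ r :+ (s :+ (u :+ l)) ⟹
                         ⊢ # 1 :+ n :≡ r :+ (s :+ (u :+ (# 1 :+ l)))) ih

  bucket-unique : ∀ s → Unique (bucket s xs)
  bucket-unique s = Unique.filter⁺ (λ v → side (pos v) ≟ s) (elements-unique X)

  in-X : ∀ {s x} → x ∈ bucket s xs → x ∈ₛ X
  in-X {s} x∈ = ∈-elements⁻ X (proj₁ (∈-filter⁻ (λ v → side (pos v) ≟ s) x∈))

  has-side : ∀ {s x} → x ∈ bucket s xs → side (pos x) ≡ s
  has-side {s} x∈ = proj₂ (∈-filter⁻ (λ v → side (pos v) ≟ s) {xs = xs} x∈)

  onR? : ∀ p → side p ≡ zero → ∃ λ t → p ≡ R t
  onR? (R t) _ = t , refl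
  onS? : ∀ p → side p ≡ suc zero → ∃ λ t → p ≡ S t
  onS? (S t) _ = t , refl
  onU? : ∀ p → side p ≡ suc (suc zero) → ∃ λ t → p ≡ U t
  onU? (U t) _ = t , refl
  onL? : ∀ p → side p ≡ suc (suc (suc zero)) → ∃ λ t → p ≡ L t
  onL? (L t) _ = t , refl

  atR : ∀ {x} → x ∈ rs → ∃ λ t → pos x ≡ R t
  atR x∈ = onR? _ (has-side x∈)
  atS : ∀ {x} → x ∈ ss → ∃ λ t → pos x ≡ S t
  atS x∈ = onS? _ (has-side x∈)
  atU : ∀ {x} → x ∈ us → ∃ λ t → pos x ≡ U t
  atU x∈ = onU? _ (has-side x∈)
  atL : ∀ {x} → x ∈ ls → ∃ λ t → pos x ≡ L t
  atL x∈ = onL? _ (has-side x∈)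

  apart : ∀ {s t x y} → s ≢ t → x ∈ bucket s xs → y ∈ bucket t xs → x ≢ y
  apart s≢t x∈ y∈ refl = s≢t (trans (sym (has-side x∈)) (has-side y∈))

  impossible : 4 ≤ length xs → ⊥
  impossible 4≤ = by-sides (2 ≤? length us) (2 ≤? length ls)
    where
    total : length xs ≡ length rs + (length ss + (length us + length ls))
    total = bucket-lengths xs

    another : ∀ x y → ∃ λ z → z ∈ₛ X × x ≢ z × y ≢ z
    another x y = pick xs (elements-unique X) refl 4≤
      where
      pick : ∀ vs → Unique vs → vs ≡ xs → 4 ≤ length vs → ∃ λ z → z ∈ₛ X × x ≢ z × y ≢ z
      pick (_ ∷ _ ∷ _ ∷ _) u eq _ = let (z , z∈ , p , q) = third u x y in z , ∈-elements⁻ X (subst (z ∈_) eq z∈) , p , q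
      pick (_ ∷ []) _ _ (s≤s ())
      pick (_ ∷ _ ∷ []) _ _ (s≤s (s≤s ()))

    rs≤1 : length rs ≤ 1
    rs≤1 = length≤1 (bucket-unique zero) λ {x} {y} x∈ y∈ x≢y → let (_ , z∈ , x≢z , y≢z) = another x y in
      R-pair (in-X x∈) (in-X y∈) z∈ (proj₂ (atR x∈)) (proj₂ (atR y∈)) x≢y x≢z y≢z

    ss≤1 : length ss ≤ 1
    ss≤1 = length≤1 (bucket-unique (suc zero)) λ {x} {y} x∈ y∈ x≢y → let (_ , z∈ , x≢z , y≢z) = another x y in
      Flipped.R-pair (in-X x∈) (in-X y∈) z∈ (cong (turnAround a b) (proj₂ (atS x∈)))
          (cong (turnAround a b) (proj₂ (atS y∈))) x≢y x≢z y≢z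

    by-sides : Dec (2 ≤ length us) → Dec (2 ≤ length ls) → ⊥
    by-sides (yes 2≤us) _ with two-members (bucket-unique (suc (suc zero))) 2≤us
    ... | u , v , u∈ , v∈ , u≢v with two-members (bucket-unique (suc (suc (suc zero)))) 2≤ls
      where
      rest : ∀ {x} → x ∈ₛ X → u ≢ x → v ≢ x → ∃ λ l → pos x ≡ L l
      rest x∈ = B.U-pair-rest (in-X u∈) (in-X v∈) x∈ (proj₂ (atU u∈)) (proj₂ (atU v∈)) u≢v
      clash : ∀ {s x} → s ≢ suc (suc (suc zero)) → x ∈ bucket s xs → u ≢ x → v ≢ x → ⊥
      clash s≢L x∈ u≢x v≢x = s≢L (trans (sym (has-side x∈)) (cong side (proj₂ (rest (in-X x∈) u≢x v≢x))))
      2≤ls : 2 ≤ length ls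
      2≤ls = lin (length xs ∷ length rs ∷ length ss ∷ length us ∷ length ls ∷ [])
        (λ n r s u l → n :≡ r :+ (s :+ (u :+ l)) ⟹ # 4 :≤ n ⟹ r :≤ # 0 ⟹ s :≤ # 0 ⟹ u :≤ # 2 ⟹
            ⊢ # 2 :≤ l) total 4≤
        (length≤0 λ x∈ → clash (λ ()) x∈ (apart (λ ()) u∈ x∈) (apart (λ ()) v∈ x∈))
        (length≤0 λ x∈ → clash (λ ()) x∈ (apart (λ ()) u∈ x∈) (apart (λ ()) v∈ x∈))
        (length≤2 (bucket-unique (suc (suc zero))) λ x∈ → clash (λ ()) x∈)
    ...   | p , q , p∈ , q∈ , p≢q = B.two-pairs (in-X u∈) (in-X v∈) (in-X p∈) (in-X q∈)
              (proj₂ (atU u∈)) (proj₂ (atU v∈)) (proj₂ (atL p∈)) (proj₂ (atL q∈)) u≢v p≢q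
    by-sides (no us<2) (yes 2≤ls) with two-members (bucket-unique (suc (suc (suc zero)))) 2≤ls
    ... | p , q , p∈ , q∈ , p≢q = lin (length xs ∷ length rs ∷ length ss ∷ length us ∷ length ls ∷ [])
        (λ n r s u l → n :≡ r :+ (s :+ (u :+ l)) ⟹ # 4 :≤ n ⟹ r :≤ # 0 ⟹ s :≤ # 0 ⟹ l :≤ # 2 ⟹ u :< # 2 ⟹
            ⊢ :⊥) total 4≤
        (length≤0 λ x∈ → clash (λ ()) x∈ (apart (λ ()) p∈ x∈) (apart (λ ()) q∈ x∈))
        (length≤0 λ x∈ → clash (λ ()) x∈ (apart (λ ()) p∈ x∈) (apart (λ ()) q∈ x∈))
        (length≤2 (bucket-unique (suc (suc (suc zero)))) λ x∈ → clash (λ ()) x∈)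
        (≰⇒> us<2)
      where
      rest : ∀ {x} → x ∈ₛ X → p ≢ x → q ≢ x → ∃ λ l → swap (pos x) ≡ L l
      rest x∈ = B′.U-pair-rest (in-X p∈) (in-X q∈) x∈ (cong swap (proj₂ (atL p∈)))
          (cong swap (proj₂ (atL q∈))) p≢q
      clash : ∀ {s x} → s ≢ suc (suc zero) → x ∈ bucket s xs → p ≢ x → q ≢ x → ⊥
      clash s≢U x∈ p≢x q≢x =
          s≢U (trans (sym (has-side x∈)) (cong side (swap-to (proj₂ (rest (in-X x∈) p≢x q≢x)))))
    by-sides (no us<2) (no ls<2) = all-four (member 1≤rs) (member 1≤ss) (member 1≤us) (member 1≤ls)
      where
      vars = length xs ∷ length rs ∷ length ss ∷ length us ∷ length ls ∷ []
      1≤rs : 1 ≤ length rs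
      1≤rs = lin vars (λ n r s u l → n :≡ r :+ (s :+ (u :+ l)) ⟹ # 4 :≤ n ⟹ s :≤ # 1 ⟹ u :< # 2 ⟹ l :< # 2 ⟹
          ⊢ # 1 :≤ r)
               total 4≤ ss≤1 (≰⇒> us<2) (≰⇒> ls<2)
      1≤ss : 1 ≤ length ss
      1≤ss = lin vars (λ n r s u l → n :≡ r :+ (s :+ (u :+ l)) ⟹ # 4 :≤ n ⟹ r :≤ # 1 ⟹ u :< # 2 ⟹ l :< # 2 ⟹
          ⊢ # 1 :≤ s)
               total 4≤ rs≤1 (≰⇒> us<2) (≰⇒> ls<2)
      1≤us : 1 ≤ length us
      1≤us = lin vars (λ n r s u l → n :≡ r :+ (s :+ (u :+ l)) ⟹ # 4 :≤ n ⟹ r :≤ # 1 ⟹ s :≤ # 1 ⟹ l :< # 2 ⟹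
          ⊢ # 1 :≤ u)
               total 4≤ rs≤1 ss≤1 (≰⇒> ls<2)
      1≤ls : 1 ≤ length ls
      1≤ls = lin vars (λ n r s u l → n :≡ r :+ (s :+ (u :+ l)) ⟹ # 4 :≤ n ⟹ r :≤ # 1 ⟹ s :≤ # 1 ⟹ u :< # 2 ⟹
          ⊢ # 1 :≤ l)
               total 4≤ rs≤1 ss≤1 (≰⇒> us<2)
      all-four : ∃ (_∈ rs) → ∃ (_∈ ss) → ∃ (_∈ us) → ∃ (_∈ ls) → ⊥
      all-four (x , x∈) (y , y∈) (u , u∈) (v , v∈) = separate (in-X x∈) (in-X y∈) (in-X u∈) (in-X v∈)
        (proj₂ (atU u∈)) (proj₂ (atL v∈)) (subst (Before _ _) (sym (proj₂ (atR x∈))) onR)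
        (λ before → case subst (Before _ _) (proj₂ (atS y∈)) before of λ ())
        (apart (λ ()) u∈ y∈) (apart (λ ()) v∈ y∈)

-- The visibility number of a frog

module Triple (G : Graph) (D : Distance G) where
  open Metric G D
  open Bigons G D

  -- The three arcs between c 0, c 1 and c h' are all geodesics.
  three-on-cycle : ∀ {g} (C : Cycle g) → (∀ j → j < g → ¬ Bigon j) → ∃ λ X →
      MutualVisibilitySet G X × 3 ≤ ∣ X ∣
  three-on-cycle {g} C none = fromList (c 0 ∷ c 1 ∷ c h' ∷ []) ,
    three-visible
      (arc 1 refl , ≤-reflexive
          (trans (len-arc 1 {0} refl) (sym (trans (d-forward 1 0 (twice 1≤h)) refl))) ,
        (c-distinct 0<h' h'<g ∷ []) ∷ (c-distinct 1<h' h'<g ∷ []) ∷ [])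
      (subst (λ v → Clear v (c h') (c 1 ∷ [])) c-g
          (clear-sym (arc h h+h' ,
          ≤-reflexive (trans (len-arc h _)
          (sym (trans (cong (λ t → d (c h') (c t)) (sym h+h')) (d-forward h h' (twice ≤-refl))))) ,
        All.map (λ { (t , t≤h , refl) → (off t t≤h) ∷ [] }) (verts-arc h h+h'))))
      (arc (h' ∸ 1) (m∸n+n≡m 0<h') ,
          ≤-reflexive (trans (len-arc (h' ∸ 1) _)
          (sym (trans (cong (λ t → d (c 1) (c t)) (sym (m∸n+n≡m 0<h')))
          (d-forward (h' ∸ 1) 1 (twice (∸-monoˡ-≤ 1 h'≤1+h)))))) ,
        All.map (λ { (t , t≤ , refl) →
            (c-distinct (m≤n+m 1 t)
            (≤-<-trans (≤-trans (+-monoˡ-≤ 1 t≤) (≤-reflexive (m∸n+n≡m 0<h'))) h'<g) ∘ sym) ∷ [] })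
            (verts-arc (h' ∸ 1) (m∸n+n≡m 0<h'))) ,
    ∣fromList∣ ((c-distinct ≤-refl (<-trans 1<h' h'<g) ∷ c-distinct 0<h' h'<g ∷ []) ∷
        (c-distinct 1<h' h'<g ∷ []) ∷ [] ∷ [])
    where
    open Isometric C none
    open Halves (halve g)
    1≤h : 1 ≤ h
    1≤h = lin (h ∷ h' ∷ g ∷ [])
        (λ h h' g → h :+ h' :≡ g ⟹ h' :≤ # 1 :+ h ⟹ # 3 :≤ g ⟹ ⊢ # 1 :≤ h) h+h' h'≤1+h g≥3
    1<h' : 1 < h'
    1<h' = lin (h ∷ h' ∷ g ∷ []) (λ h h' g → h :+ h' :≡ g ⟹ h :≤ h' ⟹ # 3 :≤ g ⟹ ⊢ # 2 :≤ h') h+h' h≤h' g≥3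
    0<h' : 0 < h'
    0<h' = <⇒≤ 1<h'
    h'<g : h' < g
    h'<g = lin (h ∷ h' ∷ g ∷ []) (λ h h' g → h :+ h' :≡ g ⟹ # 1 :≤ h ⟹ ⊢ h' :< g) h+h' 1≤h
    twice : ∀ {ℓ} → ℓ ≤ h → ℓ + ℓ ≤ g
    twice {ℓ} = lin (ℓ ∷ h ∷ h' ∷ g ∷ [])
        (λ ℓ h h' g → h :+ h' :≡ g ⟹ h :≤ h' ⟹ ℓ :≤ h ⟹ ⊢ ℓ :+ ℓ :≤ g) h+h' h≤h'
    c-g : c g ≡ c 0
    c-g = trans (cong c (sym (+-identityʳ g))) (period 0)
    off : ∀ t → t ≤ h → c (t + h') ≢ c 1
    off t t≤h with m≤n⇒m<n∨m≡n (≤-trans (+-monoˡ-≤ h' t≤h) (≤-reflexive h+h'))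
    ... | inj₁ lt = c-distinct (≤-trans 1<h' (m≤n+m h' t)) lt ∘ sym
    ... | inj₂ eq = λ p → c-distinct ≤-refl (<-trans 1<h' h'<g) (trans (sym (trans (cong c eq) c-g)) p)

module Frog (G : Graph) (D : Distance G) (triangle-free : TriangleFree G)
            (k r s : ℕ) (φ : Fin (Graph.n G) ↔ FrogV k r s)
            (iso : ∀ u v → Edge G u v ⇔ FrogAdj k r s (Inverse.to φ u) (Inverse.to φ v))
            (H : Halves (3 + k)) where
  open Metric G D
  open Bigons G D
  open Inverse φ using (to; from; strictlyInverseˡ; strictlyInverseʳ)

  g : ℕ
  g = 3 + k

  edge-adj : ∀ {x y} → Edge G x y → FrogAdj k r s (to x) (to y)
  edge-adj = Equivalence.to (iso _ _)

  base-edge : ∀ {a b} → FrogBase k r s a b → Edge G (from a) (from b)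
  base-edge {a} {b} e = Equivalence.from (iso _ _)
    (inj₁ (subst₂ (FrogBase k r s) (sym (strictlyInverseˡ a)) (sym (strictlyInverseˡ b)) e))

  from-injective : ∀ {a b} → from a ≡ from b → a ≡ b
  from-injective {a} {b} eq = trans (sym (strictlyInverseˡ a)) (trans (cong to eq) (strictlyInverseˡ b))

  position : ℕ → Fin g
  position i = fromℕ< (m%n<n i g)

  toℕ-position : ∀ i → toℕ (position i) ≡ i % g
  toℕ-position i = toℕ-fromℕ< (m%n<n i g)

  c : ℕ → V
  c i = from (inj₁ (position i))

  c-cong : ∀ i j → i % g ≡ j % g → c i ≡ c j
  c-cong i j eq = cong (from ∘ inj₁)
      (toℕ-injective (trans (toℕ-position i) (trans eq (sym (toℕ-position j)))))

  c-position : ∀ i → c (toℕ i) ≡ from (inj₁ i)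
  c-position i = cong (from ∘ inj₁) (toℕ-injective (trans (toℕ-position (toℕ i)) (m<n⇒m%n≡m (toℕ<n i))))

  c-residue : ∀ i j → c i ≡ c j → i % g ≡ j % g
  c-residue i j eq with from-injective eq
  ... | p = trans (sym (toℕ-position i)) (trans (cong toℕ (inj₁-inj p)) (toℕ-position j))
    where
    inj₁-inj : ∀ {a b : Fin g} → _≡_ {A = FrogV k r s} (inj₁ a) (inj₁ b) → a ≡ b
    inj₁-inj refl = refl

  cycle : Cycle g
  cycle = record { c = c ; g>0 = s≤s z≤n ; period = period ; step = step ; turn = turn }
    where
    period : ∀ i → c (g + i) ≡ c i
    period i = c-cong (g + i) i (trans (cong (_% g) (+-comm g i)) ([m+n]%n≡m%n i g))
    step : ∀ i → Edge G (c i) (c (suc i))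
    step i = base-edge (cyc (position i) (position (suc i))
      (trans (cong (λ t → suc t % g) (toℕ-position i))
          (trans (sym (mod-suc i g)) (sym (toℕ-position (suc i))))))
    turn : ∀ i → c i ≢ c (2 + i)
    turn i eq with c-residue i (2 + i) eq | mod-step i g | mod-step (suc i) g
    ... | e | inj₁ (_ , p)    | inj₁ (_ , q)    = m≢1+n+m (i % g) {1} (trans e (trans q (cong suc p)))
    ... | e | inj₁ (_ , p)    | inj₂ (last , q) =
        case trans (sym last) (cong suc (trans p (cong suc (trans e q)))) of λ ()
    ... | e | inj₂ (last , p) | inj₁ (_ , q)    =
        case trans (sym last) (cong suc (trans e (trans q (cong suc p)))) of λ ()
    ... | _ | inj₂ (_ , p)    | inj₂ (last , _) = case trans (sym last) (cong suc p) of λ ()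

  open Cycle cycle using (step; turn; period)

  -- The cycle of the frog serves here only to show that bigons exist; the three visible vertices
  -- are then taken on a least-bigon cycle, where the arcs are already known to be geodesics.
  has-bigon : ¬ NoBigon
  has-bigon free = closed-non-backtracking c g (s≤s z≤n) (λ i _ → step i) (λ i _ → turn i)
    (trans (cong c (sym (+-identityʳ g))) (period 0)) (λ j _ → free j)

  g≥4 : 4 ≤ g
  g≥4 with m≤n⇒m<n∨m≡n (m≤m+n 3 k)
  ... | inj₁ lt = lt
  ... | inj₂ eq = ⊥-elim
      (triangle-free (c 0) (c 1) (c 2) (step 0) (step 1) (edge-sym (subst (Edge G (c 2)) c3 (step 2))))
    where
    c3 : c 3 ≡ c 0
    c3 = trans (cong c (trans eq (sym (+-identityʳ g)))) (period 0)

  open Halves H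

  h≥2 : 2 ≤ h
  h≥2 = lin (h ∷ h' ∷ g ∷ [])
      (λ h h' g → h :+ h' :≡ g ⟹ h' :≤ # 1 :+ h ⟹ # 4 :≤ g ⟹ ⊢ # 2 :≤ h) h+h' h'≤1+h g≥4

  d-arc : ∀ m i → d (c i) (c (m + i)) ≤ m
  d-arc zero    i = ≤-reflexive (d-refl (c i))
  d-arc (suc m) i = ≤-trans (d-step (c i) (step (m + i))) (s≤s (d-arc m i))

  d-between : ∀ {i j} → i ≤ j → d (c i) (c j) + i ≤ j
  d-between {i} {j} i≤j =
      ≤-trans (+-monoˡ-≤ i (subst (λ t → d (c i) (c t) ≤ j ∸ i) (m∸n+n≡m i≤j) (d-arc (j ∸ i) i)))
                                  (≤-reflexive (m∸n+n≡m i≤j))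

  d-legR : ∀ m (a : Fin r) → toℕ a ≡ m → d (from (inj₂ (inj₁ a))) (c 0) ≤ suc m
  d-legR zero    a eq =
      ≤-reflexive (d-edge (edge-sym (base-edge (attR (position 0) a (toℕ-position 0) eq))))
  d-legR (suc m) a eq =
      ≤-trans (d-stepˡ (c 0) (edge-sym (base-edge (pathR a' a (trans (cong suc a'≡m) (sym eq))))))
                                (s≤s (d-legR m a' a'≡m))
    where
    m<r : m < r
    m<r = <-trans ≤-refl (subst (_< r) eq (toℕ<n a))
    a' = fromℕ< m<r
    a'≡m : toℕ a' ≡ m
    a'≡m = toℕ-fromℕ< m<r

  h<g : h < g
  h<g = lin (h ∷ h' ∷ g ∷ []) (λ h h' g → h :+ h' :≡ g ⟹ h :≤ h' ⟹ # 2 :≤ h ⟹ ⊢ h :< g) h+h' h≤h' h≥2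

  d-legS : ∀ m (a : Fin s) → toℕ a ≡ m → d (from (inj₂ (inj₂ a))) (c h) ≤ suc m
  d-legS zero    a eq = ≤-reflexive (d-edge (edge-sym (base-edge (attS (position h) a
                          (trans (toℕ-position h) (trans (m<n⇒m%n≡m h<g) h≡g/2)) eq))))
  d-legS (suc m) a eq =
      ≤-trans (d-stepˡ (c h) (edge-sym (base-edge (pathS a' a (trans (cong suc a'≡m) (sym eq))))))
                                (s≤s (d-legS m a' a'≡m))
    where
    m<s : m < s
    m<s = <-trans ≤-refl (subst (_< s) eq (toℕ<n a))
    a' = fromℕ< m<s
    a'≡m : toℕ a' ≡ m
    a'≡m = toℕ-fromℕ< m<s

  -- The cycle is cut where the legs are attached. `L` counts backwards from position `g`, that is
  -- from `c 0`, so both sides are measured from the first leg and have lengths `h` and `h'`.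
  data CyclePos : ℕ → Pos → Set where
    at-0 : CyclePos 0 (R 0)
    at-h : ∀ {i} → i ≡ h → CyclePos i (S 0)
    at-U : ∀ {i} → 1 ≤ i → i < h → CyclePos i (U i)
    at-L : ∀ {i l} → h < i → i < g → i + l ≡ g → CyclePos i (L l)

  cyclePos : ∀ i → i < g → ∃ (CyclePos i)
  cyclePos zero    _   = R 0 , at-0
  cyclePos (suc i) i<g with <-cmp (suc i) h
  ... | tri< i<h _ _  = U (suc i) , at-U (s≤s z≤n) i<h
  ... | tri≈ _ i≡h _ = S 0 , at-h i≡h
  ... | tri> _ _ h<i  = L (g ∸ suc i) , at-L h<i i<g (m+[n∸m]≡n (<⇒≤ i<g))

  frogPos : FrogV k r s → Pos
  frogPos (inj₁ i)        = proj₁ (cyclePos (toℕ i) (toℕ<n i))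
  frogPos (inj₂ (inj₁ a)) = R (suc (toℕ a))
  frogPos (inj₂ (inj₂ b)) = S (suc (toℕ b))

  view : ∀ i → CyclePos (toℕ i) (frogPos (inj₁ i))
  view i = proj₂ (cyclePos (toℕ i) (toℕ<n i))

  cyclePos-injective : ∀ {i j p} → CyclePos i p → CyclePos j p → i ≡ j
  cyclePos-injective at-0         at-0         = refl
  cyclePos-injective (at-h p)     (at-h q)     = trans p (sym q)
  cyclePos-injective (at-U _ _)   (at-U _ _)   = refl
  cyclePos-injective {i} {j} (at-L {l = l} _ _ p) (at-L _ _ q) = +-cancelʳ-≡ l i j (trans p (sym q))

  cyclePos-not-R : ∀ {i t} → ¬ CyclePos i (R (suc t))
  cyclePos-not-R ()

  cyclePos-not-S : ∀ {i t} → ¬ CyclePos i (S (suc t))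
  cyclePos-not-S ()

  frogPos-injective : ∀ a b → frogPos a ≡ frogPos b → a ≡ b
  frogPos-injective (inj₁ i) (inj₁ j) eq =
    cong inj₁ (toℕ-injective (cyclePos-injective (view i) (subst (CyclePos (toℕ j)) (sym eq) (view j))))
  frogPos-injective (inj₁ i) (inj₂ (inj₁ a)) eq =
      ⊥-elim (cyclePos-not-R (subst (CyclePos (toℕ i)) eq (view i)))
  frogPos-injective (inj₁ i) (inj₂ (inj₂ a)) eq =
      ⊥-elim (cyclePos-not-S (subst (CyclePos (toℕ i)) eq (view i)))
  frogPos-injective (inj₂ (inj₁ a)) (inj₁ i) eq =
      ⊥-elim (cyclePos-not-R (subst (CyclePos (toℕ i)) (sym eq) (view i)))
  frogPos-injective (inj₂ (inj₂ a)) (inj₁ i) eq =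
      ⊥-elim (cyclePos-not-S (subst (CyclePos (toℕ i)) (sym eq) (view i)))
  frogPos-injective (inj₂ (inj₁ a)) (inj₂ (inj₁ b)) eq = cong (inj₂ ∘ inj₁) (toℕ-injective (R-suc eq))
    where
    R-suc : ∀ {m n} → R (suc m) ≡ R (suc n) → m ≡ n
    R-suc refl = refl
  frogPos-injective (inj₂ (inj₂ a)) (inj₂ (inj₂ b)) eq = cong (inj₂ ∘ inj₂) (toℕ-injective (S-suc eq))
    where
    S-suc : ∀ {m n} → S (suc m) ≡ S (suc n) → m ≡ n
    S-suc refl = refl

  cycle-step : ∀ {i p q} → CyclePos i p → CyclePos (suc i) q → suc i < g → Step h h' p q ⊎ Step h h' q p
  cycle-step at-0 (at-U _ _) _ = inj₁ r-u
  cycle-step at-0 (at-L h<1 _ _) _ = ⊥-elim (<⇒≱ h<1 (<⇒≤ h≥2))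
  cycle-step at-0 (at-h eq) _ = ⊥-elim (<⇒≢ h≥2 eq)
  cycle-step (at-h refl) (at-h eq) _ = ⊥-elim (1+n≢n eq)
  cycle-step (at-U _ _) (at-h eq) _ = inj₁ (u-s _ eq)
  cycle-step (at-L h<i _ _) (at-h eq) _ = ⊥-elim (<⇒≱ h<i (≤-trans (n≤1+n _) (≤-reflexive eq)))
  cycle-step (at-U 1≤i i<h) (at-U _ 1+i<h) _ = inj₁ (u-u _ 1≤i 1+i<h)
  cycle-step (at-U _ i<h) (at-L h<1+i _ _) _ = ⊥-elim (<⇒≱ h<1+i i<h)
  cycle-step (at-h refl) (at-U _ 1+h<h) _ = ⊥-elim (<-asym 1+h<h ≤-refl)
  cycle-step (at-h refl) (at-L {l = l} _ _ eq) _ =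
      inj₂ (l-s l (+-cancelˡ-≡ h _ _ (trans (+-suc h l) (trans eq (sym h+h')))))
  cycle-step (at-L h<i _ _) (at-U _ 1+i<h) _ = ⊥-elim (<-asym h<i (<-trans ≤-refl 1+i<h))
  cycle-step {i} (at-L {l = l} h<i i<g eq) (at-L {l = l'} _ 1+i<g eq') _ =
    inj₂ (subst (λ t → Step h h' (L l') (L t)) l≡ (l-l l'
      (lin (i ∷ l' ∷ g ∷ []) (λ i l' g → # 1 :+ i :+ l' :≡ g ⟹ # 2 :+ i :≤ g ⟹ ⊢ # 1 :≤ l') eq' 1+i<g)
      (lin (i ∷ l' ∷ g ∷ h ∷ h' ∷ [])
          (λ i l' g h h' → # 1 :+ i :+ l' :≡ g ⟹ h :+ h' :≡ g ⟹ h :< i ⟹ ⊢ # 2 :+ l' :≤ h') eq' h+h' h<i)))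
    where
    l≡ : suc l' ≡ l
    l≡ = lin (i ∷ l ∷ l' ∷ g ∷ [])
        (λ i l l' g → i :+ l :≡ g ⟹ # 1 :+ i :+ l' :≡ g ⟹ ⊢ # 1 :+ l' :≡ l) eq eq'

  last-on-L : ∀ {i p} → CyclePos i p → suc i ≡ g → p ≡ L 1
  last-on-L at-0 eq = case eq of λ ()
  last-on-L (at-h refl) eq =
      ⊥-elim (lin (h ∷ h' ∷ g ∷ [])
      (λ h h' g → # 1 :+ h :≡ g ⟹ h :+ h' :≡ g ⟹ # 2 :≤ h ⟹ h :≤ h' ⟹ ⊢ :⊥) eq h+h' h≥2 h≤h')
  last-on-L (at-U _ i<h) eq = ⊥-elim (<⇒≱ h<g (≤-trans (≤-reflexive (sym eq)) i<h))
  last-on-L {i} (at-L {l = l} _ _ eq') eq =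
      cong L (+-cancelˡ-≡ i _ _ (trans eq' (trans (sym eq) (+-comm 1 i))))

  only-S-at-h : ∀ {i p} → i ≡ h → CyclePos i p → p ≡ S 0
  only-S-at-h eq   (at-h _)       = refl
  only-S-at-h eq   at-0           = ⊥-elim (<⇒≢ (<⇒≤ h≥2) eq)
  only-S-at-h refl (at-U _ i<h)   = ⊥-elim (<-irrefl refl i<h)
  only-S-at-h refl (at-L h<i _ _) = ⊥-elim (<-irrefl refl h<i)

  only-R-at-0 : ∀ {i p} → i ≡ 0 → CyclePos i p → p ≡ R 0
  only-R-at-0 _    at-0     = refl
  only-R-at-0 refl (at-h eq) = ⊥-elim (<⇒≢ (<⇒≤ h≥2) eq)
  only-R-at-0 refl (at-U () _)
  only-R-at-0 refl (at-L () _ _)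

  frog-step : ∀ {a b} → FrogBase k r s a b →
              Step h h' (frogPos a) (frogPos b) ⊎ Step h h' (frogPos b) (frogPos a)
  frog-step (cyc i j eq) with m≤n⇒m<n∨m≡n (toℕ<n i)
  ... | inj₁ lt = cycle-step (view i)
      (subst (λ t → CyclePos t (frogPos (inj₁ j))) (trans (sym eq) (m<n⇒m%n≡m lt)) (view j)) lt
  -- The closing edge of the cycle joins `L 1` to `R 0`.
  ... | inj₂ last = subst₂ (λ p q → Step h h' p q ⊎ Step h h' q p) (sym (last-on-L (view i) last))
      (sym (only-R-at-0 j≡0 (view j))) (inj₂ r-l)
    where
    j≡0 : toℕ j ≡ 0
    j≡0 = trans (sym eq) (trans (cong (_% g) last) (n%n≡0 g))
  frog-step (attR i a i≡0 a≡0) = subst₂ (λ p t → Step h h' p (R (suc t)) ⊎ Step h h' (R (suc t)) p)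
    (sym (only-R-at-0 i≡0 (view i))) (sym a≡0) (inj₁ (r-r 0))
  frog-step (pathR a b eq) = inj₁ (subst (λ t → Step h h' (R (suc (toℕ a))) (R (suc t))) eq (r-r _))
  frog-step (attS i b i≡h b≡0) = subst₂ (λ p t → Step h h' p (S (suc t)) ⊎ Step h h' (S (suc t)) p)
    (sym (only-S-at-h (trans i≡h (sym h≡g/2)) (view i))) (sym b≡0) (inj₁ (s-s 0))
  frog-step (pathS a b eq) = inj₁ (subst (λ t → Step h h' (S (suc (toℕ a))) (S (suc t))) eq (s-s _))

  at-position : ∀ {x i} → to x ≡ inj₁ i → x ≡ c (toℕ i)
  at-position {x} {i} eq = trans (sym (strictlyInverseʳ x)) (trans (cong from eq) (sym (c-position i)))

  pos : V → Pos
  pos x = frogPos (to x)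

  on-R : ∀ {x t} → pos x ≡ R t → d x (c 0) ≤ t
  on-R {x} {t} eq with to x in tx
  ... | inj₁ i = go (subst (CyclePos (toℕ i)) eq (view i)) (at-position tx)
    where
    go : ∀ {j t} → CyclePos j (R t) → x ≡ c j → d x (c 0) ≤ t
    go at-0 refl = ≤-reflexive (d-refl (c 0))
  on-R {x} refl | inj₂ (inj₁ a) = subst
      (λ v → d v (c 0) ≤ suc (toℕ a)) (trans (cong from (sym tx)) (strictlyInverseʳ x))
      (d-legR (toℕ a) a refl)

  on-S : ∀ {x t} → pos x ≡ S t → d x (c h) ≤ t
  on-S {x} {t} eq with to x in tx
  ... | inj₁ i = go (subst (CyclePos (toℕ i)) eq (view i)) (at-position tx)
    where
    go : ∀ {j t} → CyclePos j (S t) → x ≡ c j → d x (c h) ≤ t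
    go (at-h refl) refl = ≤-reflexive (d-refl (c h))
  on-S {x} refl | inj₂ (inj₂ a) = subst
      (λ v → d v (c h) ≤ suc (toℕ a)) (trans (cong from (sym tx)) (strictlyInverseʳ x))
      (d-legS (toℕ a) a refl)

  on-U : ∀ {x i} → pos x ≡ U i → x ≡ c i × 1 ≤ i × i < h
  on-U {x} eq with to x in tx
  ... | inj₁ j = go (subst (CyclePos (toℕ j)) eq (view j)) (at-position tx)
    where
    go : ∀ {j i} → CyclePos j (U i) → x ≡ c j → x ≡ c i × 1 ≤ i × i < h
    go (at-U 1≤i i<h) x≡ = x≡ , 1≤i , i<h
  on-U () | inj₂ (inj₁ _)
  on-U () | inj₂ (inj₂ _)

  on-L : ∀ {x l} → pos x ≡ L l → ∃ λ i → x ≡ c i × h < i × i < g × i + l ≡ g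
  on-L {x} eq with to x in tx
  ... | inj₁ j = go (subst (CyclePos (toℕ j)) eq (view j)) (at-position tx)
    where
    go : ∀ {j l} → CyclePos j (L l) → x ≡ c j → ∃ λ i → x ≡ c i × h < i × i < g × i + l ≡ g
    go (at-L h<i i<g eq) x≡ = _ , x≡ , h<i , i<g , eq
  on-L () | inj₂ (inj₁ _)
  on-L () | inj₂ (inj₂ _)

  coordinates : Coordinates G D h h'
  coordinates = record
    { pos      = pos
    ; pos-inj  = λ {x} {y} eq →
        trans (sym (strictlyInverseʳ x)) (trans (cong from (frogPos-injective _ _ eq)) (strictlyInverseʳ y))
    ; pos-edge = λ e → [ frog-step , (λ b → [ inj₂ , inj₁ ]′ (frog-step b)) ]′ (edge-adj e)
    ; a≥2 = h≥2 ; b≥2 = ≤-trans h≥2 h≤h' ; a≤ = ≤-trans h≤h' (n≤1+n h') ; b≤ = h'≤1+h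
    ; U-range = λ eq → proj₂ (on-U eq)
    ; L-range = L-range ; d-RU = d-RU ; d-RL = d-RL ; d-UU = d-UU ; d-LL = d-LL ; d-US = d-US ; d-LS =
        d-LS }
    where
    L-range : ∀ {x l} → pos x ≡ L l → 1 ≤ l × l < h'
    L-range {l = l} eq with on-L eq
    ... | i , _ , h<i , i<g , sum =
      lin (i ∷ l ∷ g ∷ []) (λ i l g → i :+ l :≡ g ⟹ i :< g ⟹ ⊢ # 1 :≤ l) sum i<g ,
      lin (i ∷ l ∷ g ∷ h ∷ h' ∷ [])
          (λ i l g h h' → i :+ l :≡ g ⟹ h :+ h' :≡ g ⟹ h :< i ⟹ ⊢ l :< h') sum h+h' h<i
    d-RU : ∀ {x y t j} → pos x ≡ R t → pos y ≡ U j → d x y ≤ t + j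
    d-RU {x} {y} {t} {j} px py with on-U py
    ... | refl , _ = ≤-trans (d-tri x (c 0) (c j))
        (+-mono-≤ (on-R px) (≤-trans (m≤m+n _ 0) (d-between z≤n)))
    d-RL : ∀ {x y t l} → pos x ≡ R t → pos y ≡ L l → d x y ≤ t + l
    d-RL {x} {y} {t} {l} px py with on-L py
    ... | i , refl , _ , _ , sum = ≤-trans (d-tri x (c 0) (c i)) (+-mono-≤ (on-R px)
          (≤-trans (≤-reflexive (trans (d-sym (c 0) (c i)) (cong (d (c i)) (sym around)))) (d-arc l i)))
      where
      around : c (l + i) ≡ c 0
      around = trans (cong c (trans (+-comm l i) (trans sum (sym (+-identityʳ g))))) (period 0)
    d-UU : ∀ {x y i j} → pos x ≡ U i → pos y ≡ U j → i ≤ j → d x y + i ≤ j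
    d-UU px py i≤j with on-U px | on-U py
    ... | refl , _ | refl , _ = d-between i≤j
    d-LL : ∀ {x y l m} → pos x ≡ L l → pos y ≡ L m → l ≤ m → d x y + l ≤ m
    d-LL {l = l} {m} px py l≤m with on-L px | on-L py
    ... | i , refl , _ , _ , sum | j , refl , _ , _ , sum' =
      lin (d (c i) (c j) ∷ d (c j) (c i) ∷ i ∷ j ∷ l ∷ m ∷ g ∷ [])
        (λ x y i j l m g → x :≡ y ⟹ y :+ j :≤ i ⟹ i :+ l :≡ g ⟹ j :+ m :≡ g ⟹ ⊢ x :+ l :≤ m)
        (d-sym _ _) (d-between
            (lin (i ∷ j ∷ l ∷ m ∷ g ∷ [])
            (λ i j l m g → i :+ l :≡ g ⟹ j :+ m :≡ g ⟹ l :≤ m ⟹ ⊢ j :≤ i) sum sum' l≤m)) sum sum'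
    d-US : ∀ {x y i t} → pos x ≡ U i → pos y ≡ S t → d x y + i ≤ h + t
    d-US {x} {y} {i} {t} px py with on-U px
    ... | refl , _ , i<h = lin (d (c i) y ∷ d (c i) (c h) ∷ d (c h) y ∷ d y (c h) ∷ i ∷ h ∷ t ∷ [])
      (λ xy xh hy yh i h t → xy :≤ xh :+ hy ⟹ xh :+ i :≤ h ⟹ hy :≡ yh ⟹ yh :≤ t ⟹ ⊢ xy :+ i :≤ h :+ t)
      (d-tri (c i) (c h) y) (d-between (<⇒≤ i<h)) (d-sym _ _) (on-S py)
    d-LS : ∀ {x y l t} → pos x ≡ L l → pos y ≡ S t → d x y + l ≤ h' + t
    d-LS {x} {y} {l} {t} px py with on-L px
    ... | i , refl , h<i , _ , sum =
        lin (d (c i) y ∷ d (c i) (c h) ∷ d (c h) (c i) ∷ d (c h) y ∷ d y (c h) ∷ i ∷ h ∷ h' ∷ g ∷ l ∷ t ∷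
        [])
      (λ xy xh hx hy yh i h h' g l t → xy :≤ xh :+ hy ⟹ xh :≡ hx ⟹ hx :+ h :≤ i ⟹ hy :≡ yh ⟹ yh :≤ t ⟹
          i :+ l :≡ g ⟹ h :+ h' :≡ g ⟹ ⊢ xy :+ l :≤ h' :+ t)
      (d-tri (c i) (c h) y) (d-sym _ _) (d-between (<⇒≤ h<i)) (d-sym _ _) (on-S py) sum h+h'

  frog-μ : MuIs G 3
  frog-μ = [ (λ free → ⊥-elim (has-bigon free)) ,
      (λ (_ , big , none) → conclude (three-on-cycle (least-bigon-cycle big none) none)) ]′
             no-bigon-or-least
    where
    open Triple G D
    conclude : (∃ λ X → MutualVisibilitySet G X × 3 ≤ ∣ X ∣) → MuIs G 3
    conclude (X , mv , 3≤) = (X , mv , ≤-antisym (at-most-three coordinates X mv) 3≤) ,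
        at-most-three coordinates

theorem4p4 : (G : Graph) → Connected G → TriangleFree G →
    (MuIs G 3 ⇔ ((IsTree G × numLeaves G ≡ 3) ⊎ IsFrog G))
theorem4p4 G conn triangle-free = mk⇔ forth back
  where
  D : Distance G
  D = distance G conn
  open Bigons G D
  open Leaves G
  open Trees G D

  forth : MuIs G 3 → (IsTree G × numLeaves G ≡ 3) ⊎ IsFrog G
  forth ((X , mv , ∣X∣≡3) , small) =
    [ (λ free → inj₁ ((conn , no-bigon⇒acyclic free) ,
        ≤-antisym (small leaves leaves-visible) (three free)))
    , (λ (_ , big , none) → inj₂ (bigon⇒frog G D conn triangle-free small big none)) ]′ no-bigon-or-least
    where
    three : NoBigon → 3 ≤ numLeaves G
    three free = subst (_≤ numLeaves G) ∣X∣≡3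
      (tree-bound free mv (≤-trans (n≤1+n 2) (≤-reflexive (sym ∣X∣≡3))))

  back : (IsTree G × numLeaves G ≡ 3) ⊎ IsFrog G → MuIs G 3
  back (inj₁ ((_ , acyclic) , three)) = (leaves , leaves-visible , three) , bound
    where
    bound : ∀ X → MutualVisibilitySet G X → ∣ X ∣ ≤ 3
    bound X mv with 2 ≤? ∣ X ∣
    ... | yes 2≤ = ≤-trans (tree-bound (acyclic⇒no-bigon acyclic) mv 2≤) (≤-reflexive three)
    ... | no <2  = ≤-trans (<⇒≤ (≰⇒> <2)) (n≤1+n 2)
  back (inj₂ (k , r , s , φ , iso)) = Frog.frog-μ G D triangle-free k r s φ iso (halve (3 + k))
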